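{- Let $q$ be a transcendental complex number. Let $v,w$ be positive integers and let $(r_i,s_i)_{1\le i\le v}$, $(t_j,u_j)_{1\le j\le w}$ be pairs of integers with $s_i>0$ for all $i$ and $u_j\neq 0$ for all $j$, such that $\alpha_i:=r_i/s_i\notin\mathbb Z_{\leq 0}$ and $\beta_j:=t_j/u_j\notin\mathbb Z_{\le 0}$ for all $i,j$. Let $$Q_{\mathbf r,\mathbf t}(q;n):=\frac{(q^{r_1};q^{s_1})_n\cdots(q^{r_v};q^{s_v})_n}{(q^{t_1};q^{u_1})_n\cdots(q^{t_w};q^{u_w})_n},\quad n\geq 0.$$ Then the following are equivalent: (i) the sequence $(Q_{\mathbf r,\mathbf t}(q;n))_{n\geq0}$ is $q$-integral; (ii) for every $b\in\{1,\dots,d_{\mathbf r,\mathbf t}\}$ and every $x\in\mathbb R$, $\Xi_{\mathbf r,\mathbf t}(b,x)\geq 0$.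
   Context: $(q^r;q^s)_n:=\prod_{i=0}^{n-1}(1-q^{r+si})$ for $n\ge 0$. A sequence $(R(q;n))_{n\ge0}$ in $\mathbb Q(q)$ with $R(q;0)=1$ is $q$-integral if there is $C(q)\in\mathbb Z[q]\setminus\{0\}$ with $C(q)^nR(q;n)\in\mathbb Z[q]$ for all $n\ge0$. For real $x$, $\langle x\rangle$ is the fractional part of $x$ if $x\notin\mathbb Z$ and $1$ if $x\in\mathbb Z$. Christol order on $\mathbb R$: $x\preceq y$ iff $\langle x\rangle<\langle y\rangle$, or $\langle x\rangle=\langle y\rangle$ and $x\ge y$. Let $d_{\mathbf r,\mathbf t}$ be the (positive) least common multiple of $s_1,\dots,s_v,u_1,\dots,u_w$. For $b\in\{1,\dots,d_{\mathbf r,\mathbf t}\}$: set $c_i:=\gcd(r_i,s_i,b)$, $d_j:=\gcd(t_j,u_j,b)$, $V_b:=\{i:\gcd(s_i,b)=c_i\}$, $W_b:=\{j:\gcd(u_j,b)=d_j\}$; for $i\in V_b$, $j\in W_b$ choose positive integers $e_i,f_j$ with $be_i\equiv c_i \pmod{s_i}$ and $bf_j\equiv d_j\pmod{u_j}$; let $\tilde b$ be the greatest divisor of $b$ coprime to $d_{\mathbf r,\mathbf t}$ and $a\in\{1,\dots,d_{\mathbf r,\mathbf t}\}$ with $a\tilde b\equiv1\pmod{d_{\mathbf r,\mathbf t}}$. Then $$\Xi_{\mathbf r,\mathbf t}(b,x):=\#\Big\{(i,k)\in V_b\times\{0,\dots,c_i-1\}:\tfrac{\langle e_i\alpha_i\rangle+k}{c_i}-\lfloor1-a\alpha_i\rfloor\preceq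 x\Big\}-\#\Big\{(j,\ell)\in W_b\times\{0,\dots,d_j-1\}:\tfrac{\langle f_j\beta_j\rangle+\ell}{d_j}-\lfloor1-a\beta_j\rfloor\preceq x\Big\}$$ (this does not depend on the choice of $e_i,f_j$).
   Formalization: In condition (ii), x ranges over the rational numbers instead of the real numbers; since all points compared with x are rational, every irrational x can be replaced by a rational one giving the same value of Ξ. -}

module Defs where

open import Data.Nat as ℕ using (ℕ; zero; suc; NonZero)
open import Data.Nat.DivMod using (_%_)
open import Data.Nat.GCD using (gcd)
open import Data.Nat.LCM using (lcm)
open import Data.Integer as ℤ using (ℤ; +_; -[1+_]; ∣_∣; 0ℤ; 1ℤ)
open import Data.Rational as ℚ using (ℚ; floor; 1ℚ)
open import Data.Rational.Properties as ℚP using ()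
open import Data.Fin using (Fin)
open import Data.List using (List; []; _∷_; replicate)
open import Data.List.Relation.Unary.All using (All)
open import Data.Product using (_×_; _,_; proj₁; proj₂; Σ)
open import Data.Sum using (_⊎_)
open import Data.Bool using (Bool; true; false; if_then_else_; _∧_)
open import Relation.Nullary using (Dec; yes; no; ¬_; does)
open import Relation.Nullary.Decidable using (_⊎-dec_; _×-dec_)
open import Relation.Binary.PropositionalEquality using (_≡_)

-- Polynomials in ℤ[q] as coefficient lists (constant term first)

Poly : Set
Poly = List ℤ

infixl 6 _+ₚ_ _-ₚ_
infixl 7 _*ₚ_ _·ₚ_

_+ₚ_ : Poly → Poly → Poly
[]       +ₚ g        = g
(a ∷ f)  +ₚ []       = a ∷ f
(a ∷ f)  +ₚ (b ∷ g)  = (a ℤ.+ b) ∷ (f +ₚ g)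

_·ₚ_ : ℤ → Poly → Poly
c ·ₚ []      = []
c ·ₚ (a ∷ f) = (c ℤ.* a) ∷ (c ·ₚ f)

_-ₚ_ : Poly → Poly → Poly
f -ₚ g = f +ₚ (ℤ.- 1ℤ ·ₚ g)

_*ₚ_ : Poly → Poly → Poly
[]      *ₚ g = []
(a ∷ f) *ₚ g = (a ·ₚ g) +ₚ (0ℤ ∷ (f *ₚ g))

1ₚ : Poly
1ₚ = 1ℤ ∷ []

qPow : ℕ → Poly
qPow k = replicate k 0ℤ Data.List.++ (1ℤ ∷ [])
  where import Data.List

_^ₚ_ : Poly → ℕ → Poly
f ^ₚ zero  = 1ₚ
f ^ₚ suc n = f *ₚ (f ^ₚ n)

IsZeroₚ : Poly → Set
IsZeroₚ f = All (_≡ 0ℤ) f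

_≈ₚ_ : Poly → Poly → Set
f ≈ₚ g = IsZeroₚ (f -ₚ g)

-- Laurent polynomials in ℤ[q,q⁻¹] represented as  q^(-e) · f
-- (the pair (e , f)).

Laurent : Set
Laurent = ℕ × Poly

_*L_ : Laurent → Laurent → Laurent
(e , f) *L (e' , f') = (e ℕ.+ e') , (f *ₚ f')

1L : Laurent
1L = 0 , 1ₚ

oneMinusQ : ℤ → Laurent
oneMinusQ (+ k)      = 0 , (1ₚ -ₚ qPow k)
oneMinusQ -[1+ k ]   = suc k , (qPow (suc k) -ₚ 1ₚ)      -- 1 - q^{-(k+1)} = q^{-(k+1)} (q^{k+1} - 1)

qPoch : ℤ → ℤ → ℕ → Laurent
qPoch r s zero    = 1L
qPoch r s (suc n) = qPoch r s n *L oneMinusQ (r ℤ.+ s ℤ.* + n)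

prodL : (v : ℕ) → (Fin v → Laurent) → Laurent
prodL zero    F = 1L
prodL (suc v) F = F Fin.zero *L prodL v (λ i → F (Fin.suc i))
  where import Data.Fin as Fin

QNum : (v : ℕ) → (Fin v → ℤ) → (Fin v → ℤ) → ℕ → Laurent
QNum v r s n = prodL v (λ i → qPoch (r i) (s i) n)

-- A sequence R(q;n) = N(n) / D(n) (quotients of nonzero Laurent
-- polynomials) is q-integral iff there is a nonzero C ∈ ℤ[q] with
-- C^n · R(q;n) ∈ ℤ[q] for all n, i.e. C^n · N(n) = P · D(n) for some P ∈ ℤ[q].
-- With N = q^{-eN} pN and D = q^{-eD} pD this reads
--   q^{eD} · C^n · pN = q^{eN} · P · pD   in ℤ[q].
QIntegral : (ℕ → Laurent) → (ℕ → Laurent) → Set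
QIntegral N D =
  Σ Poly λ C → ¬ IsZeroₚ C ×
    ((n : ℕ) → Σ Poly λ P →
      (qPow (proj₁ (D n)) *ₚ (C ^ₚ n) *ₚ proj₂ (N n))
        ≈ₚ (qPow (proj₁ (N n)) *ₚ P *ₚ proj₂ (D n)))

-- t / u as a rational number (u ≠ 0; value 0 when u = 0, never used)
ratio : ℤ → ℤ → ℚ
ratio t (+ zero)    = ℚ.0ℚ
ratio t (+ suc n)   = t ℚ./ suc n
ratio t -[1+ n ]    = (ℤ.- t) ℚ./ suc n

frac : ℚ → ℚ
frac x with (x ℚ.- (floor x ℚ./ 1)) ℚP.≟ ℚ.0ℚ
... | yes _ = 1ℚ
... | no  _ = x ℚ.- (floor x ℚ./ 1)

_≼_ : ℚ → ℚ → Set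
x ≼ y = (frac x ℚ.< frac y) ⊎ ((frac x ≡ frac y) × (y ℚ.≤ x))

_≼?_ : (x y : ℚ) → Dec (x ≼ y)
x ≼? y = (frac x ℚP.<? frac y) ⊎-dec ((frac x ℚP.≟ frac y) ×-dec (y ℚP.≤? x))

lcmFin : (v : ℕ) → (Fin v → ℤ) → ℕ
lcmFin zero    s = 1
lcmFin (suc v) s = lcm ∣ s Fin.zero ∣ (lcmFin v (λ i → s (Fin.suc i)))
  where import Data.Fin as Fin

dRT : (v w : ℕ) → (Fin v → ℤ) → (Fin w → ℤ) → ℕ
dRT v w s u = lcm (lcmFin v s) (lcmFin w u)

modEqᵇ : ℕ → ℕ → ℕ → Bool
modEqᵇ x y zero    = does (x ℕ.≟ y)
modEqᵇ x y (suc m) = does ((x % suc m) ℕ.≟ (y % suc m))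

firstUpTo : ℕ → (ℕ → Bool) → ℕ
firstUpTo n P = go n 1
  where
  go : ℕ → ℕ → ℕ
  go zero    k = 1
  go (suc m) k = if P k then k else go m (suc k)

lastUpTo : ℕ → (ℕ → Bool) → ℕ
lastUpTo zero    P = 1
lastUpTo (suc n) P = if P (suc n) then suc n else lastUpTo n P

bTilde : ℕ → ℕ → ℕ
bTilde d b = lastUpTo b (λ k → does (Data.Nat.Divisibility._∣?_ k b) ∧ does (gcd k d ℕ.≟ 1))
  where import Data.Nat.Divisibility

aOf : ℕ → ℕ → ℕ
aOf d b = firstUpTo d (λ a → modEqᵇ (a ℕ.* bTilde d b) 1 d)

cOf : ℤ → ℤ → ℕ → ℕ
cOf r s b = gcd (gcd ∣ r ∣ ∣ s ∣) b

inVᵇ : ℤ → ℤ → ℕ → Bool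
inVᵇ r s b = does (gcd ∣ s ∣ b ℕ.≟ cOf r s b)

eOf : ℤ → ℤ → ℕ → ℕ
eOf r s b = firstUpTo ∣ s ∣ (λ e → modEqᵇ (b ℕ.* e) (cOf r s b) ∣ s ∣)

-- x / n for a positive natural n (0 if n = 0, never used)
divℕ : ℚ → ℕ → ℚ
divℕ x zero    = ℚ.0ℚ
divℕ x (suc n) = x ℚ.* (1ℤ ℚ./ suc n)

point : ℤ → ℤ → ℕ → ℕ → ℕ → ℚ
point r s b a k =
  divℕ (frac ((+ eOf r s b ℚ./ 1) ℚ.* α) ℚ.+ (+ k ℚ./ 1)) (cOf r s b)
    ℚ.- (floor (1ℚ ℚ.- ((+ a ℚ./ 1) ℚ.* α)) ℚ./ 1)
  where
  α : ℚ
  α = ratio r s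

countBelow : ℕ → (ℕ → Bool) → ℕ
countBelow zero    P = 0
countBelow (suc n) P = countBelow n P ℕ.+ (if P n then 1 else 0)

sumFin : (v : ℕ) → (Fin v → ℕ) → ℕ
sumFin zero    f = 0
sumFin (suc v) f = f Fin.zero ℕ.+ sumFin v (λ i → f (Fin.suc i))
  where import Data.Fin as Fin

sideCount : (v : ℕ) → (Fin v → ℤ) → (Fin v → ℤ) → ℕ → ℕ → ℚ → ℕ
sideCount v r s b a x =
  sumFin v (λ i →
    if inVᵇ (r i) (s i) b
    then countBelow (cOf (r i) (s i) b) (λ k → does (point (r i) (s i) b a k ≼? x))
    else 0)

Xi : (v w : ℕ) → (r s : Fin v → ℤ) → (t u : Fin w → ℤ) → ℕ → ℚ → ℤ
Xi v w r s t u b x =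
  (+ sideCount v r s b a x) ℤ.- (+ sideCount w t u b a x)
  where
  a : ℕ
  a = aOf (dRT v w s u) b

XiCondition : (v w : ℕ) → (r s : Fin v → ℤ) → (t u : Fin w → ℤ) → Set
XiCondition v w r s t u =
  (b : ℕ) → 1 ℕ.≤ b → b ℕ.≤ dRT v w s u →
  (x : ℚ) → 0ℤ ℤ.≤ Xi v w r s t u b x

{-# OPTIONS --safe #-}
module Submission where

-- The polynomial q ^ n - 1 is the product of the Φ d with d ∣ n, and distinct Φ's are coprime up to a nonzero integer.
-- Hence Φ m occurs in the n-th quotient with exponent Δ m n, the number of multiples of m among the exponents r i + s i k
-- (k < n) minus the number among the t j + u j k. If Δ m ≥ 0 for all m > M, then q ^ κ (Φ 1 ⋯ Φ M) ^ w clears all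
-- denominators. Conversely, if Δ m n < 0 then Φ m divides every C that clears them (ℤ[q]/(q ^ m - 1) is reduced), and a
-- nonzero C has only finitely many divisors Φ m. Finally, let m ≡ b modulo d be large. Within a period k < m, the solutions
-- of m ∣ r + s k exist iff gcd s b = c, and they are k = m p - α with p = (⟨e α⟩ + z) / c for z < c. Comparing two solutions
-- compares first the p's and then, among equal p's, the α's in reverse, which is the Christol order on the points counted
-- by Ξ. So Δ m ≥ 0 iff Ξ b x ≥ 0 for all x; the number a matters only through its positivity.

open import Algebra.Bundles using (CommutativeRing)
open import Data.Bool using (true; false; if_then_else_; Bool)
open import Data.Fin using (Fin)
open import Data.Integer as ℤ using (ℤ; +_; 0ℤ; 1ℤ; -[1+_])
open import Data.Integer.Tactic.RingSolver using (solve-∀)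
open import Data.List using (List; []; _∷_; _++_; replicate; length; reverse; [_]; _∷ʳ_; initLast; _∷ʳ′_; applyDownFrom)
open import Data.List.Relation.Unary.All using (All; []; _∷_)
open import Data.Nat as ℕ using (ℕ; zero; suc; _≤_; _<_; z≤n; s≤s; NonZero)
open import Data.Nat.DivMod using (_%_)
open import Data.Nat.Divisibility using (divides; _∣?_) renaming (_∣_ to _∣ℕ_)
open import Data.Nat.Induction using (<-rec)
open import Data.Product using (Σ; ∃; _×_; _,_; proj₁; proj₂)
open import Data.Rational as ℚ using (ℚ; mkℚ; floor; 0ℚ; 1ℚ; toℚᵘ)
open import Data.Rational.Unnormalised as ℚᵘ using (mkℚᵘ; *≡*; *≤*; *<*)
open import Data.Sum using (_⊎_; inj₁; inj₂)
open import Defs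
open import Function using (_∘_)
open import Function.Bundles using (_⇔_; mk⇔)
open import Relation.Binary.Definitions using (tri<; tri≈; tri>)
open import Relation.Binary.PropositionalEquality using (_≡_; _≢_)
open import Relation.Nullary using (Dec; yes; no; ¬_; does; contradiction)
open import Relation.Nullary.Decidable using (dec-true; dec-false)
import Algebra.Properties.CommutativeSemigroup.Divisibility as Divisibility
import Algebra.Properties.CommutativeSemiring.Exp as Exp
import Algebra.Properties.Group as GroupProperties
import Algebra.Properties.Monoid.Divisibility as MonoidDivisibility
import Algebra.Properties.Ring as RingProperties
import Algebra.Properties.Semiring.Mult as Multiples
import Algebra.Solver.Ring.NaturalCoefficients.Default as SemiringSolver
import Data.Fin as Fin
import Data.Integer.DivMod as ℤD
import Data.Integer.Divisibility.Signed as ℤS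
import Data.Integer.Properties as ℤP
import Data.List.Properties as ListP
import Data.List.Relation.Unary.All as All
import Data.List.Relation.Unary.All.Properties as AllP
import Data.Nat.DivMod as ℕM
import Data.Nat.Divisibility as ℕD
import Data.Nat.GCD as ℕG
import Data.Nat.LCM as ℕL
import Data.Nat.Properties as ℕP
import Data.Nat.Tactic.RingSolver as ℕR
import Data.Rational.Properties as ℚP
import Data.Rational.Unnormalised.Properties as ℚᵘP
import Level
import Relation.Binary.PropositionalEquality as ≡
import Relation.Binary.Reasoning.Setoid as SetoidReasoning

-- All divisibility takes place in ℤ[q], where two distinct Φ's need not be comaximal. The integer
-- left in their Bézout identity is cancelled because ℤ[q]/(f) has no ℤ-torsion; division with
-- remainder gives this for f = q ^ n - 1, and divisors inherit it. Φ n is constructed as the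
-- cofactor in q ^ n - 1 of the product over the proper divisors of n, so its degree is not visible.
-- It equals the totient because both satisfy the same divisor-sum identity, and its positivity is
-- what makes infinitely many divisors Φ m of C impossible. Reducedness, which leads from Φ m ∣ C ^
-- n to Φ m ∣ C, rests on a positive definite form: the constant coefficient of f(q) f(q⁻¹) modulo q
-- ^ m - 1 is the sum of the squares of the coefficients of the remainder of f. "Large" means m >
-- 2B, where B bounds |α d| for all parameters: since k + α = m p, two different p's in (1/d)ℤ then
-- outweigh any difference of the α's. If the p's agree, the α's differ by an integer j and the
-- floors of 1 - a α by a j, so a ≥ 1 keeps the order.

-- Divisibility, saturation and coprimality up to an integer in a commutative ring.

module Divisors {c ℓ} (R : CommutativeRing c ℓ) where
  open CommutativeRing R hiding (_≉_)
  open Multiples semiring using (×-assoc-*; ×1-homo-*) renaming (_×_ to _·_)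
  open Exp commutativeSemiring using (_^_; ^-homo-*)
  open Divisibility *-commutativeSemigroup
    using (_∣_; _,_; x∣ʳyx; ∣ʳ-respʳ-≈; ∣ʳ-respˡ-≈; ∣ʳ-trans; x∣ʳy⇒x∣ʳzy; ∙-cong-∣; x∣y⇒zx∣zy)
  open MonoidDivisibility *-monoid using (∣ʳ-refl; ε∣ʳ_)
  open SemiringSolver commutativeSemiring using (solve; _:=_; _:+_; _:*_)
  open SetoidReasoning setoid

  Regular : Carrier → Set _
  Regular f = ∀ y → y * f ≈ 0# → y ≈ 0#

  -- f is regular and R/(f) has no ℤ-torsion.
  record Saturated (f : Carrier) : Set (c Level.⊔ ℓ) where
    field
      regular     : Regular f
      torsionFree : ∀ n y → f ∣ suc n · y → f ∣ y
  open Saturated public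

  x∣xy : ∀ x y → x ∣ x * y
  x∣xy x y = ∣ʳ-respʳ-≈ (*-comm y x) (x∣ʳyx x y)

  ∣-minus : ∀ {f a b} → f ∣ a + b → f ∣ a → f ∣ b
  ∣-minus {f} {a} {b} (p , pf≈a+b) (q , qf≈a) = p - q , (begin
    (p - q) * f          ≈⟨ distribʳ f p (- q) ⟩
    p * f + - q * f      ≈⟨ +-cong pf≈a+b (trans (sym (-‿distribˡ-* q f)) (-‿cong qf≈a)) ⟩
    (a + b) - a          ≈⟨ +-congʳ (+-comm a b) ⟩
    (b + a) - a          ≈⟨ +-assoc b a (- a) ⟩
    b + (a - a)          ≈⟨ +-congˡ (-‿inverseʳ a) ⟩
    b + 0#               ≈⟨ +-identityʳ b ⟩
    b                    ∎)
    where open RingProperties ring using (-‿distribˡ-*)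

  regular-cancel : ∀ {f} → Regular f → ∀ a b → a * f ≈ b * f → a ≈ b
  regular-cancel {f} reg a b af≈bf = x∙y⁻¹≈ε⇒x≈y a b (reg (a - b) (begin
    (a - b) * f      ≈⟨ distribʳ f a (- b) ⟩
    a * f + - b * f  ≈⟨ +-cong af≈bf (sym (-‿distribˡ-* b f)) ⟩
    b * f - b * f    ≈⟨ -‿inverseʳ (b * f) ⟩
    0#               ∎))
    where
    open RingProperties ring using (-‿distribˡ-*)
    open GroupProperties +-group using (x∙y⁻¹≈ε⇒x≈y)

  ∣-cancelˡ : ∀ {f a b} → Saturated f → f * a ∣ f * b → a ∣ b
  ∣-cancelˡ {f} {a} {b} sf (q , qfa≈fb) = q , regular-cancel (regular sf) (q * a) b
    (trans (solve 3 (λ q f a → (q :* a) :* f := q :* (f :* a)) refl q f a) (trans qfa≈fb (*-comm f b)))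

  saturated-cong : ∀ {f g} → f ≈ g → Saturated f → Saturated g
  saturated-cong f≈g sf = record
    { regular     = λ y yg≈0 → regular sf y (trans (*-congˡ f≈g) yg≈0)
    ; torsionFree = λ n y g∣ → ∣ʳ-respˡ-≈ f≈g (torsionFree sf n y (∣ʳ-respˡ-≈ (sym f≈g) g∣))
    }

  saturated-1 : Saturated 1#
  saturated-1 = record
    { regular     = λ y y1≈0 → trans (sym (*-identityʳ y)) y1≈0
    ; torsionFree = λ n y _ → ε∣ʳ y
    }

  -- Torsion-freeness is proved in two stages: f is split off y first, then f is cancelled and g
  -- acts on the cofactor.
  saturated-* : ∀ {f g} → Saturated f → Saturated g → Saturated (f * g)
  saturated-* {f} {g} sf sg = record
    { regular     = λ y yfg≈0 → regular sf y (regular sg (y * f) (trans (*-assoc y f g) yfg≈0))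
    ; torsionFree = tf
    }
    where
    tf : ∀ n y → f * g ∣ suc n · y → f * g ∣ y
    tf n y fg∣ny with torsionFree sf n y (∣ʳ-trans (x∣xy f g) fg∣ny)
    ... | z , zf≈y = ∣ʳ-respʳ-≈ (trans (*-comm f z) zf≈y) (x∣y⇒zx∣zy f (torsionFree sg n z
      (∣-cancelˡ sf (∣ʳ-respʳ-≈ ny≈fnz fg∣ny))))
      where
      ny≈fnz : suc n · y ≈ f * (suc n · z)
      ny≈fnz = begin
        suc n · y          ≈⟨ Multiples.×-congʳ semiring (suc n) (sym zf≈y) ⟩
        suc n · (z * f)    ≈⟨ sym (×-assoc-* (suc n) z f) ⟩
        (suc n · z) * f    ≈⟨ *-comm _ f ⟩
        f * (suc n · z)    ∎

  -- Cancellation is available for f * g only, not for f alone; a further multiplication by g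
  -- completes f to f * g.
  saturated-factorʳ : ∀ {f g} → Saturated (f * g) → Saturated g
  saturated-factorʳ {f} {g} sfg = record
    { regular     = λ y yg≈0 → regular sfg y (trans (solve 3 (λ y f g → y :* (f :* g) := f :* (y :* g)) refl y f g)
                                                    (trans (*-congˡ yg≈0) (zeroʳ f)))
    ; torsionFree = λ n y g∣ny → ∣-cancelˡ′ y (torsionFree sfg n (f * y)
        (∣ʳ-respʳ-≈ (Multiples.×-comm-* semiring (suc n) f y) (x∣y⇒zx∣zy f g∣ny)))
    }
    where
    ∣-cancelˡ′ : ∀ y → f * g ∣ f * y → g ∣ y
    ∣-cancelˡ′ y (q , qfg≈fy) = q , regular-cancel (regular sfg) (q * g) y (begin
      q * g * (f * g)    ≈⟨ solve 3 (λ q f g → q :* g :* (f :* g) := q :* (f :* g) :* g) refl q f g ⟩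
      q * (f * g) * g    ≈⟨ *-congʳ qfg≈fy ⟩
      f * y * g          ≈⟨ solve 3 (λ y f g → f :* y :* g := y :* (f :* g)) refl y f g ⟩
      y * (f * g)        ∎)

  saturated-∣ : ∀ {f g} → f ∣ g → Saturated g → Saturated f
  saturated-∣ (q , qf≈g) sg = saturated-factorʳ (saturated-cong (sym qf≈g) sg)

  -- The ideal (f, g) is only asked to contain a positive integer. In ℤ[q] the polynomials q - 1 and
  -- q + 1 generate an ideal that meets ℤ in the even integers, so the constant cannot always be 1.
  record Coprime (f g : Carrier) : Set (c Level.⊔ ℓ) where
    constructor bezout
    field
      constant : ℕ
      u v      : Carrier
      identity : suc constant · 1# ≈ u * f + v * g

  coprime-sym : ∀ {f g} → Coprime f g → Coprime g f
  coprime-sym (bezout n u v eq) = bezout n v u (trans eq (+-comm _ _))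

  coprime-∣ : ∀ {f f′ g g′} → f′ ∣ f → g′ ∣ g → Coprime f g → Coprime f′ g′
  coprime-∣ {f′ = f′} {g′ = g′} (p , pf′≈f) (q , qg′≈g) (bezout n u v eq) = bezout n (u * p) (v * q)
    (trans eq (+-cong (trans (*-congˡ (sym pf′≈f)) (sym (*-assoc u p f′)))
                      (trans (*-congˡ (sym qg′≈g)) (sym (*-assoc v q g′)))))

  coprime-1ʳ : ∀ {f} → Coprime f 1#
  coprime-1ʳ {f} = bezout 0 0# 1# (begin
    1# + 0#           ≈⟨ +-comm 1# 0# ⟩
    0# + 1#           ≈⟨ +-cong (sym (zeroˡ f)) (sym (*-identityˡ 1#)) ⟩
    0# * f + 1# * 1#  ∎)

  -- The two Bézout identities are multiplied; every term of the product except `b * v * (g * h)`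
  -- contains f.
  coprime-*ʳ : ∀ {f g h} → Coprime f g → Coprime f h → Coprime f (g * h)
  coprime-*ʳ {f} {g} {h} (bezout m a b ab) (bezout n u v uv) =
    bezout (n ℕ.+ m ℕ.* suc n) (a * u * f + a * v * h + b * g * u) (b * v) (begin
      (suc m ℕ.* suc n) · 1#                   ≈⟨ ×1-homo-* (suc m) (suc n) ⟩
      (suc m · 1#) * (suc n · 1#)              ≈⟨ *-cong ab uv ⟩
      (a * f + b * g) * (u * f + v * h)        ≈⟨ solve 7 (λ a b u v f g h →
        (a :* f :+ b :* g) :* (u :* f :+ v :* h) :=
        (a :* u :* f :+ a :* v :* h :+ b :* g :* u) :* f :+ b :* v :* (g :* h)) refl a b u v f g h ⟩
      (a * u * f + a * v * h + b * g * u) * f + b * v * (g * h) ∎)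

  coprime-^ʳ : ∀ {f g} n → Coprime f g → Coprime f (g ^ n)
  coprime-^ʳ zero    cop = coprime-1ʳ
  coprime-^ʳ (suc n) cop = coprime-*ʳ cop (coprime-^ʳ n cop)

  -- Multiplying the Bézout identity by h shows that f divides a positive multiple of h;
  -- torsion-freeness of R/(f) removes the multiple.
  gauss : ∀ {f g h} → Saturated f → Coprime f g → f ∣ g * h → f ∣ h
  gauss {f} {g} {h} sf (bezout n u v eq) f∣gh = torsionFree sf n h (∣ʳ-respʳ-≈ (sym nh≈) f∣ufh+vgh)
    where
    nh≈ : suc n · h ≈ h * u * f + v * (g * h)
    nh≈ = begin
      suc n · h               ≈⟨ Multiples.×-congʳ semiring (suc n) (sym (*-identityˡ h)) ⟩
      suc n · (1# * h)        ≈⟨ sym (×-assoc-* (suc n) 1# h) ⟩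
      (suc n · 1#) * h        ≈⟨ *-congʳ eq ⟩
      (u * f + v * g) * h     ≈⟨ solve 5 (λ u v f g h → (u :* f :+ v :* g) :* h := h :* u :* f :+ v :* (g :* h)) refl u v f g h ⟩
      h * u * f + v * (g * h) ∎
    f∣ufh+vgh : f ∣ h * u * f + v * (g * h)
    f∣ufh+vgh with x∣ʳy⇒x∣ʳzy v f∣gh
    ... | q , qf≈ = h * u + q , trans (distribʳ f (h * u) q) (+-congˡ qf≈)

  coprime-*-∣ : ∀ {f g h} → Saturated f → Coprime f g → f ∣ h → g ∣ h → f * g ∣ h
  coprime-*-∣ {f} {g} {h} sf cop f∣h (q , qg≈h) with gauss sf cop (∣ʳ-respʳ-≈ (trans (sym qg≈h) (*-comm q g)) f∣h)
  ... | p , pf≈q = p , (begin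
    p * (f * g) ≈⟨ sym (*-assoc p f g) ⟩
    p * f * g   ≈⟨ *-congʳ pf≈q ⟩
    q * g       ≈⟨ qg≈h ⟩
    h           ∎)

  ^-∣-mono : ∀ f {m n} → m ≤ n → f ^ m ∣ f ^ n
  ^-∣-mono f {m} {n} m≤n with ℕP.m≤n⇒∃[o]m+o≡n m≤n
  ... | o , ≡.refl = ∣ʳ-respʳ-≈ (sym (^-homo-* f m o)) (x∣xy (f ^ m) (f ^ o))

  ∏ : ℕ → (ℕ → Carrier) → Carrier
  ∏ zero    F = 1#
  ∏ (suc n) F = ∏ n F * F (suc n)

  ∏-cong : ∀ n {F G} → (∀ k → 1 ≤ k → k ≤ n → F k ≈ G k) → ∏ n F ≈ ∏ n G
  ∏-cong zero    eq = refl
  ∏-cong (suc n) eq = *-cong (∏-cong n (λ k 1≤k k≤n → eq k 1≤k (ℕP.m≤n⇒m≤1+n k≤n))) (eq (suc n) (s≤s z≤n) ℕP.≤-refl)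

  ∏-* : ∀ n F G → ∏ n (λ k → F k * G k) ≈ ∏ n F * ∏ n G
  ∏-* zero    F G = sym (*-identityˡ 1#)
  ∏-* (suc n) F G = trans (*-congʳ (∏-* n F G))
    (solve 4 (λ a b c d → a :* b :* (c :* d) := a :* c :* (b :* d)) refl _ _ _ _)

  ∏-1 : ∀ n {F} → (∀ k → 1 ≤ k → k ≤ n → F k ≈ 1#) → ∏ n F ≈ 1#
  ∏-1 zero    eq = refl
  ∏-1 (suc n) eq = trans (*-cong (∏-1 n (λ k 1≤k k≤n → eq k 1≤k (ℕP.m≤n⇒m≤1+n k≤n))) (eq (suc n) (s≤s z≤n) ℕP.≤-refl))
                         (*-identityˡ 1#)

  ∏-∣ : ∀ n {F G} → (∀ k → 1 ≤ k → k ≤ n → F k ∣ G k) → ∏ n F ∣ ∏ n G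
  ∏-∣ zero    div = ∣ʳ-refl
  ∏-∣ (suc n) div = ∙-cong-∣ (∏-∣ n (λ k 1≤k k≤n → div k 1≤k (ℕP.m≤n⇒m≤1+n k≤n))) (div (suc n) (s≤s z≤n) ℕP.≤-refl)

  ∏-extend : ∀ {m n} F → m ≤ n → (∀ k → m < k → k ≤ n → F k ≈ 1#) → ∏ n F ≈ ∏ m F
  ∏-extend {m} {zero} F z≤n eq = refl
  ∏-extend {m} {suc n} F m≤1+n eq with ℕP.m≤n⇒m<n∨m≡n m≤1+n
  ... | inj₂ ≡.refl      = refl
  ... | inj₁ (s≤s m≤n) = trans (*-cong (∏-extend F m≤n (λ k m<k k≤n → eq k m<k (ℕP.m≤n⇒m≤1+n k≤n))) (eq (suc n) (s≤s m≤n) ℕP.≤-refl))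
                               (*-identityʳ _)

  ∏-coprimeʳ : ∀ {f} n F → (∀ k → 1 ≤ k → k ≤ n → Coprime f (F k)) → Coprime f (∏ n F)
  ∏-coprimeʳ zero    F cop = coprime-1ʳ
  ∏-coprimeʳ (suc n) F cop = coprime-*ʳ (∏-coprimeʳ n F (λ k 1≤k k≤n → cop k 1≤k (ℕP.m≤n⇒m≤1+n k≤n))) (cop (suc n) (s≤s z≤n) ℕP.≤-refl)

  ∏-coprime-∣ : ∀ {h} n F → (∀ k → 1 ≤ k → k ≤ n → Saturated (F k)) →
    (∀ j k → 1 ≤ j → j < k → k ≤ n → Coprime (F k) (F j)) →
    (∀ k → 1 ≤ k → k ≤ n → F k ∣ h) → ∏ n F ∣ h
  ∏-coprime-∣ {h} zero    F sat cop div = ε∣ʳ h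
  ∏-coprime-∣ (suc n) F sat cop div = ∣ʳ-respˡ-≈ (*-comm _ _) (coprime-*-∣ (sat (suc n) (s≤s z≤n) ℕP.≤-refl)
    (∏-coprimeʳ n F (λ k 1≤k k≤n → cop k (suc n) 1≤k (s≤s k≤n) ℕP.≤-refl))
    (div (suc n) (s≤s z≤n) ℕP.≤-refl)
    (∏-coprime-∣ n F (λ k 1≤k k≤n → sat k 1≤k (ℕP.m≤n⇒m≤1+n k≤n))
      (λ j k 1≤j j<k k≤n → cop j k 1≤j j<k (ℕP.m≤n⇒m≤1+n k≤n))
      (λ k 1≤k k≤n → div k 1≤k (ℕP.m≤n⇒m≤1+n k≤n))))

-- Exponent functions and products of powers.

indicator : ∀ {p} {P : Set p} → Dec P → ℕ
indicator P? = if does P? then 1 else 0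

indicator-yes : ∀ {p} {P : Set p} (P? : Dec P) → P → indicator P? ≡ 1
indicator-yes P? p rewrite dec-true P? p = ≡.refl

indicator-no : ∀ {p} {P : Set p} (P? : Dec P) → ¬ P → indicator P? ≡ 0
indicator-no P? ¬p rewrite dec-false P? ¬p = ≡.refl

indicator-mono : ∀ {p q} {P : Set p} {Q : Set q} (P? : Dec P) (Q? : Dec Q) → (P → Q) → indicator P? ≤ indicator Q?
indicator-mono (no  _) Q? f = z≤n
indicator-mono (yes p) Q? f = ℕP.≤-reflexive (≡.sym (indicator-yes Q? (f p)))

infix 8 ⟦_∣_⟧
⟦_∣_⟧ : ℕ → ℕ → ℕ
⟦ k ∣ n ⟧ = indicator (k ∣? n)

infix 8 _at_
_at_ : ℕ → ℕ → ℕ → ℕ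
(c at m) k = if does (k ℕ.≟ m) then c else 0

at-self : ∀ c m → (c at m) m ≡ c
at-self c m rewrite dec-true (m ℕ.≟ m) ≡.refl = ≡.refl

at-other : ∀ c {m k} → k ≢ m → (c at m) k ≡ 0
at-other c {m} {k} k≢m rewrite dec-false (k ℕ.≟ m) k≢m = ≡.refl

module PowerProducts {c ℓ} (R : CommutativeRing c ℓ) where
  open CommutativeRing R hiding (_≉_)
  open Divisors R
  open Exp commutativeSemiring using (_^_; ^-homo-*; ^-congʳ)
  open Divisibility *-commutativeSemigroup using (_∣_)
  open SetoidReasoning setoid

  module _ (Φ : ℕ → Carrier) where

    powProd : ℕ → (ℕ → ℕ) → Carrier
    powProd N e = ∏ N (λ k → Φ k ^ e k)

    powProd-cong : ∀ N {e e′} → (∀ k → 1 ≤ k → k ≤ N → e k ≡ e′ k) → powProd N e ≈ powProd N e′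
    powProd-cong N eq = ∏-cong N (λ k 1≤k k≤N → ^-congʳ (Φ k) (eq k 1≤k k≤N))

    powProd-+ : ∀ N e e′ → powProd N (λ k → e k ℕ.+ e′ k) ≈ powProd N e * powProd N e′
    powProd-+ N e e′ = trans (∏-cong N (λ k _ _ → ^-homo-* (Φ k) (e k) (e′ k))) (∏-* N _ _)

    powProd-mono : ∀ N {e e′} → (∀ k → 1 ≤ k → k ≤ N → e k ≤ e′ k) → powProd N e ∣ powProd N e′
    powProd-mono N le = ∏-∣ N (λ k 1≤k k≤N → ^-∣-mono (Φ k) (le k 1≤k k≤N))

    powProd-extend : ∀ {M N} e → M ≤ N → (∀ k → M < k → k ≤ N → e k ≡ 0) → powProd N e ≈ powProd M e
    powProd-extend e M≤N eq = ∏-extend _ M≤N (λ k M<k k≤N → ^-congʳ (Φ k) (eq k M<k k≤N))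

    powProd-at : ∀ {m N} c → 1 ≤ m → m ≤ N → powProd N (c at m) ≈ Φ m ^ c
    powProd-at {suc m} {N} c _ m≤N = begin
      powProd N (c at suc m)
        ≈⟨ powProd-extend (c at suc m) m≤N (λ k m<k _ → at-other c (ℕP.>⇒≢ m<k)) ⟩
      powProd m (c at suc m) * Φ (suc m) ^ (c at suc m) (suc m)
        ≈⟨ *-cong (∏-1 m (λ k _ k≤m → ^-congʳ (Φ k) (at-other c (ℕP.<⇒≢ (s≤s k≤m))))) (^-congʳ (Φ (suc m)) (at-self c (suc m))) ⟩
      1# * Φ (suc m) ^ c
        ≈⟨ *-identityˡ _ ⟩
      Φ (suc m) ^ c ∎

    powProd-coprimeʳ : ∀ {f} N e → (∀ k → 1 ≤ k → k ≤ N → (e k ≡ 0) ⊎ Coprime f (Φ k)) → Coprime f (powProd N e)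
    powProd-coprimeʳ {f} N e cop = ∏-coprimeʳ N _ go
      where
      go : ∀ k → 1 ≤ k → k ≤ N → Coprime f (Φ k ^ e k)
      go k 1≤k k≤N with cop k 1≤k k≤N
      ... | inj₁ ek≡0 rewrite ek≡0 = coprime-1ʳ
      ... | inj₂ c = coprime-^ʳ (e k) c

-- Cyclotomic factors of x ^ n - 1 in a commutative ring.

module Cyclotomic {c ℓ} (R : CommutativeRing c ℓ) (x : CommutativeRing.Carrier R) where
  open CommutativeRing R hiding (_≉_)
  open Divisors R
  open PowerProducts R
  open Multiples semiring using () renaming (_×_ to _·_)
  open Exp commutativeSemiring using (_^_; ^-homo-*; ^-congˡ)
  open Divisibility *-commutativeSemigroup
    using (module _∣ʳ_; _∣_; _,_; ∣ʳ-respʳ-≈; ∣ʳ-respˡ-≈; ∣ʳ-trans)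
  open MonoidDivisibility *-monoid using (∣ʳ-refl; ε∣ʳ_)
  open RingProperties ring using (-‿distribˡ-*)
  open GroupProperties +-group using (∙-cancelʳ)
  open SemiringSolver commutativeSemiring using (solve; _:=_; _:+_; _:*_)
  open SetoidReasoning setoid

  X : ℕ → Carrier
  X n = x ^ n - 1#

  X+1 : ∀ n → X n + 1# ≈ x ^ n
  X+1 n = trans (+-assoc _ _ _) (trans (+-congˡ (-‿inverseˡ 1#)) (+-identityʳ _))

  X-+ : ∀ m n → X (m ℕ.+ n) ≈ X m + x ^ m * X n
  X-+ m n = ∙-cancelʳ 1# _ _ (begin
    X (m ℕ.+ n) + 1#           ≈⟨ X+1 (m ℕ.+ n) ⟩
    x ^ (m ℕ.+ n)              ≈⟨ ^-homo-* x m n ⟩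
    x ^ m * x ^ n              ≈⟨ *-congˡ (sym (X+1 n)) ⟩
    x ^ m * (X n + 1#)         ≈⟨ distribˡ _ _ _ ⟩
    x ^ m * X n + x ^ m * 1#   ≈⟨ +-congˡ (trans (*-identityʳ _) (sym (X+1 m))) ⟩
    x ^ m * X n + (X m + 1#)   ≈⟨ sym (+-assoc _ _ _) ⟩
    x ^ m * X n + X m + 1#     ≈⟨ +-congʳ (+-comm _ _) ⟩
    X m + x ^ m * X n + 1#     ∎)

  X-0 : X 0 ≈ 0#
  X-0 = -‿inverseʳ 1#

  -- The geometric sum 1 + x ^ n + ... + x ^ ((k - 1) n). Since x ^ n is 1 modulo `X n`, the sum is
  -- k modulo `X n`; `tail` is the cofactor of this congruence and later provides the integer in the
  -- coprimality of the Φ's.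
  record Quotient (k n : ℕ) : Set (c Level.⊔ ℓ) where
    field
      quotient tail : Carrier
      quotient*X    : quotient * X n ≈ X (k ℕ.* n)
      quotient≈     : quotient ≈ k · 1# + tail * X n

  quotientX : ∀ k n → Quotient k n
  quotientX zero    n = record
    { quotient   = 0#
    ; tail       = 0#
    ; quotient*X = trans (zeroˡ _) (sym X-0)
    ; quotient≈  = sym (trans (+-identityˡ _) (zeroˡ _))
    }
  quotientX (suc k) n = record
    { quotient   = 1# + x ^ n * S
    ; tail       = S + T
    ; quotient*X = begin
        (1# + x ^ n * S) * X n          ≈⟨ distribʳ (X n) 1# _ ⟩
        1# * X n + x ^ n * S * X n      ≈⟨ +-cong (*-identityˡ _) (*-assoc _ S _) ⟩
        X n + x ^ n * (S * X n)         ≈⟨ +-congˡ (*-congˡ quotient*X) ⟩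
        X n + x ^ n * X (k ℕ.* n)       ≈⟨ sym (X-+ n (k ℕ.* n)) ⟩
        X (n ℕ.+ k ℕ.* n)               ∎
    ; quotient≈  = begin
        1# + x ^ n * S                    ≈⟨ +-congˡ (*-congʳ (sym (X+1 n))) ⟩
        1# + (X n + 1#) * S               ≈⟨ +-congˡ (distribʳ S (X n) 1#) ⟩
        1# + (X n * S + 1# * S)           ≈⟨ +-congˡ (+-cong (*-comm _ S) (trans (*-identityˡ S) quotient≈)) ⟩
        1# + (S * X n + (k · 1# + T * X n)) ≈⟨ solve 5 (λ o S X k T → o :+ (S :* X :+ (k :+ T :* X)) := (o :+ k) :+ (S :+ T) :* X)
                                                refl 1# S (X n) (k · 1#) T ⟩
        1# + k · 1# + (S + T) * X n       ∎
    }
    where open Quotient (quotientX k n) renaming (quotient to S; tail to T)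

  X-∣ : ∀ {m n} → m ∣ℕ n → X m ∣ X n
  X-∣ {m} (divides k ≡.refl) = quotient , quotient*X
    where open Quotient (quotientX k m)

  -- The Bézout identity d + j n = i m of natural numbers is lifted to exponents: `X (i * m)` equals
  -- `X d` plus x ^ d times `X (j * n)`, and the other two terms are multiples of `X m` and `X n`.
  X-gcd : ∀ m n → ∃ λ u → ∃ λ v → u * X m + v * X n ≈ X (ℕG.gcd m n)
  X-gcd m n = go (ℕG.Bézout.identity (ℕG.gcd-GCD m n))
    where
    d = ℕG.gcd m n
    combine : ∀ i j {m n} → d ℕ.+ j ℕ.* n ≡ i ℕ.* m → ∃ λ u → ∃ λ v → u * X m + v * X n ≈ X d
    combine i j {m} {n} eq = P.quotient , - (x ^ d * Q.quotient) , (begin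
      P.quotient * X m + - (x ^ d * Q.quotient) * X n
        ≈⟨ +-cong P.quotient*X (sym (-‿distribˡ-* _ _)) ⟩
      X (i ℕ.* m) - x ^ d * Q.quotient * X n
        ≈⟨ +-cong (reflexive (≡.cong X (≡.sym eq))) (-‿cong (trans (*-assoc _ _ _) (*-congˡ Q.quotient*X))) ⟩
      X (d ℕ.+ j ℕ.* n) - x ^ d * X (j ℕ.* n)
        ≈⟨ +-congʳ (X-+ d (j ℕ.* n)) ⟩
      X d + x ^ d * X (j ℕ.* n) - x ^ d * X (j ℕ.* n)
        ≈⟨ trans (+-assoc _ _ _) (trans (+-congˡ (-‿inverseʳ _)) (+-identityʳ _)) ⟩
      X d ∎)
      where
      module P = Quotient (quotientX i m)
      module Q = Quotient (quotientX j n)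
    go : ℕG.Bézout.Identity d m n → ∃ λ u → ∃ λ v → u * X m + v * X n ≈ X d
    go (ℕG.Bézout.+- i j eq) = combine i j eq
    go (ℕG.Bézout.-+ i j eq) with combine j i eq
    ... | u , v , eq′ = v , u , trans (+-comm _ _) eq′

  module _ (X-saturated : ∀ {n} → 1 ≤ n → Saturated (X n)) where

    -- A stage of the recursive construction of Φ. The factorisations up to N are enough to prove
    -- the Φ's up to N coprime, which in turn allows the next Φ to be defined by a division.
    record Factorisation (N : ℕ) : Set (c Level.⊔ ℓ) where
      field
        Φ         : ℕ → Carrier
        factorise : ∀ n → 1 ≤ n → n ≤ N → X n ≈ powProd Φ N ⟦_∣ n ⟧

    module FactorisationProperties {N} (F : Factorisation N) where
      open Factorisation F

      Φ∣X : ∀ {k n} → k ∣ℕ n → 1 ≤ k → k ≤ N → 1 ≤ n → n ≤ N → Φ k ∣ X n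
      Φ∣X {k} {n} k∣n 1≤k k≤N 1≤n n≤N =
        ∣ʳ-respˡ-≈ (trans (powProd-at Φ 1 1≤k k≤N) (*-identityʳ _))
        (∣ʳ-respʳ-≈ (sym (factorise n 1≤n n≤N)) (powProd-mono Φ N le))
        where
        le : ∀ j → 1 ≤ j → j ≤ N → (1 at k) j ≤ ⟦ j ∣ n ⟧
        le j _ _ with j ℕ.≟ k
        ... | yes ≡.refl rewrite at-self 1 k = ℕP.≤-reflexive (≡.sym (indicator-yes (j ∣? n) k∣n))
        ... | no  j≢k rewrite at-other 1 j≢k = z≤n

      Φ-saturated : ∀ {k} → 1 ≤ k → k ≤ N → Saturated (Φ k)
      Φ-saturated 1≤k k≤N = saturated-∣ (Φ∣X ℕD.∣-refl 1≤k k≤N 1≤k k≤N) (X-saturated 1≤k)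

      -- In terms of exponents: the divisors of g, together with n, are distinct divisors of n.
      ΦX∣X : ∀ {g n} → g ∣ℕ n → g < n → 1 ≤ g → n ≤ N → X g * Φ n ∣ X n
      ΦX∣X {g} {n} g∣n g<n 1≤g n≤N =
        ∣ʳ-respˡ-≈ (trans (powProd-+ Φ N ⟦_∣ g ⟧ (1 at n))
          (*-cong (sym (factorise g 1≤g g≤N)) (trans (powProd-at Φ 1 1≤n n≤N) (*-identityʳ _))))
        (∣ʳ-respʳ-≈ (sym (factorise n 1≤n n≤N)) (powProd-mono Φ N le))
        where
        g≤N = ℕP.≤-trans (ℕP.<⇒≤ g<n) n≤N
        1≤n = ℕP.≤-trans 1≤g (ℕP.<⇒≤ g<n)
        le : ∀ j → 1 ≤ j → j ≤ N → ⟦ j ∣ g ⟧ ℕ.+ (1 at n) j ≤ ⟦ j ∣ n ⟧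
        le j _ _ with j ℕ.≟ n
        ... | yes ≡.refl rewrite at-self 1 n | indicator-no (n ∣? g) (λ n∣g → ℕP.<⇒≱ g<n (ℕD.∣⇒≤ {{ℕ.>-nonZero 1≤g}} n∣g)) =
              ℕP.≤-reflexive (≡.sym (indicator-yes (n ∣? n) ℕD.∣-refl))
        ... | no  j≢n rewrite at-other 1 j≢n | ℕP.+-identityʳ ⟦ j ∣ g ⟧ = indicator-mono (j ∣? g) (j ∣? n) (λ j∣g → ℕD.∣-trans j∣g g∣n)

      Φ∣quotient : ∀ {g k} → g < k ℕ.* g → 1 ≤ g → k ℕ.* g ≤ N → Φ (k ℕ.* g) ∣ Quotient.quotient (quotientX k g)
      Φ∣quotient {g} {k} g<n 1≤g n≤N = ∣-cancelˡ (X-saturated 1≤g)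
        (∣ʳ-respʳ-≈ (trans (sym (quotient*X)) (*-comm _ _)) (ΦX∣X (divides k ≡.refl) g<n 1≤g n≤N))
        where open Quotient (quotientX k g)

      -- `Φ b` divides the geometric sum `X b` / `X a`, which is congruent to the integer b / a
      -- modulo `X a`, and `Φ a` divides `X a`.
      Φ-coprime-∣ : ∀ {a b} → a ∣ℕ b → a < b → 1 ≤ a → b ≤ N → Coprime (Φ a) (Φ b)
      Φ-coprime-∣ {a} (divides zero ≡.refl) () 1≤a b≤N
      Φ-coprime-∣ {a} (divides (suc k) ≡.refl) a<b 1≤a b≤N =
        coprime-∣ (Φ∣X ℕD.∣-refl 1≤a a≤N 1≤a a≤N) (Φ∣quotient {k = suc k} a<b 1≤a b≤N)
          (bezout k (- tail) 1# (begin
            suc k · 1#                                    ≈⟨ sym (trans (+-congʳ (-‿inverseˡ _)) (+-identityˡ _)) ⟩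
            - (tail * X a) + tail * X a + suc k · 1#      ≈⟨ trans (+-assoc _ _ _) (+-congˡ (+-comm _ _)) ⟩
            - (tail * X a) + (suc k · 1# + tail * X a)    ≈⟨ +-cong (-‿distribˡ-* _ _) (trans (sym quotient≈) (sym (*-identityˡ _))) ⟩
            - tail * X a + 1# * quotient                  ∎))
        where
        open Quotient (quotientX (suc k) a)
        a≤N = ℕP.≤-trans (ℕP.<⇒≤ a<b) b≤N

      -- If the gcd g is neither a nor b, dividing the identity of `X-gcd` by `X g` yields a Bézout
      -- identity with constant 1 for `X a` / `X g` and `X b` / `X g`, which `Φ a` and `Φ b` divide.
      -- Otherwise one index divides the other.
      Φ-coprime : ∀ {a b} → a ≢ b → 1 ≤ a → a ≤ N → 1 ≤ b → b ≤ N → Coprime (Φ a) (Φ b)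
      Φ-coprime {a} {b} a≢b 1≤a a≤N 1≤b b≤N = go (ℕG.gcd[m,n]∣m a b) (ℕG.gcd[m,n]∣n a b) (g ℕ.≟ a) (g ℕ.≟ b)
        where
        g = ℕG.gcd a b
        1≤g : 1 ≤ g
        1≤g = ℕP.n≢0⇒n>0 (λ g≡0 → ℕP.<⇒≢ 1≤a (≡.sym (ℕG.gcd[m,n]≡0⇒m≡0 g≡0)))
        g≤a = ℕD.∣⇒≤ {{ℕ.>-nonZero 1≤a}} (ℕG.gcd[m,n]∣m a b)
        g≤b = ℕD.∣⇒≤ {{ℕ.>-nonZero 1≤b}} (ℕG.gcd[m,n]∣n a b)
        both : ∀ {i j} → a ≡ i ℕ.* g → b ≡ j ℕ.* g → g < a → g < b → Coprime (Φ a) (Φ b)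
        both {i} {j} a≡ b≡ g<a g<b =
          coprime-∣ (≡.subst (λ n → Φ n ∣ P.quotient) (≡.sym a≡) (Φ∣quotient {k = i} (≡.subst (g <_) a≡ g<a) 1≤g (≡.subst (_≤ N) a≡ a≤N)))
                    (≡.subst (λ n → Φ n ∣ Q.quotient) (≡.sym b≡) (Φ∣quotient {k = j} (≡.subst (g <_) b≡ g<b) 1≤g (≡.subst (_≤ N) b≡ b≤N)))
            (bezout 0 u v (sym (regular-cancel (regular (X-saturated 1≤g)) _ _ (begin
              (u * P.quotient + v * Q.quotient) * X g
                ≈⟨ solve 5 (λ u p v q X → (u :* p :+ v :* q) :* X := u :* (p :* X) :+ v :* (q :* X)) refl u P.quotient v Q.quotient (X g) ⟩
              u * (P.quotient * X g) + v * (Q.quotient * X g)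
                ≈⟨ +-cong (*-congˡ (trans P.quotient*X (reflexive (≡.cong X (≡.sym a≡)))))
                          (*-congˡ (trans Q.quotient*X (reflexive (≡.cong X (≡.sym b≡))))) ⟩
              u * X a + v * X b    ≈⟨ uv ⟩
              X g                  ≈⟨ sym (*-identityˡ _) ⟩
              1# * X g             ≈⟨ *-congʳ (sym (+-identityʳ 1#)) ⟩
              (1# + 0#) * X g      ∎))))
          where
          module P = Quotient (quotientX i g)
          module Q = Quotient (quotientX j g)
          u = proj₁ (X-gcd a b)
          v = proj₁ (proj₂ (X-gcd a b))
          uv = proj₂ (proj₂ (X-gcd a b))
        go : g ∣ℕ a → g ∣ℕ b → Dec (g ≡ a) → Dec (g ≡ b) → Coprime (Φ a) (Φ b)
        go g∣a g∣b (yes g≡a) _ =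
          Φ-coprime-∣ (≡.subst (_∣ℕ b) g≡a g∣b) (ℕP.≤∧≢⇒< (≡.subst (_≤ b) g≡a g≤b) a≢b) 1≤a b≤N
        go g∣a g∣b (no _) (yes g≡b) =
          coprime-sym (Φ-coprime-∣ (≡.subst (_∣ℕ a) g≡b g∣a) (ℕP.≤∧≢⇒< (≡.subst (_≤ a) g≡b g≤a) (λ b≡a → a≢b (≡.sym b≡a))) 1≤b a≤N)
        go (divides i a≡) (divides j b≡) (no g≢a) (no g≢b) = both {i} {j} a≡ b≡ (ℕP.≤∧≢⇒< g≤a g≢a) (ℕP.≤∧≢⇒< g≤b g≢b)

      abstract
        -- The Φ k for proper divisors k of N + 1 are pairwise coprime and each divides `X (suc N)`,
        -- hence so does their product. The cofactor becomes the Φ of index N + 1.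
        next∣X : powProd Φ N ⟦_∣ suc N ⟧ ∣ X (suc N)
        next∣X = ∏-coprime-∣ N _ (λ k 1≤k k≤N → sat k 1≤k k≤N (k ∣? suc N))
          (λ j k 1≤j j<k k≤N → cop (j ∣? suc N) (k ∣? suc N)
            (Φ-coprime (ℕP.>⇒≢ j<k) (ℕP.≤-trans 1≤j (ℕP.<⇒≤ j<k)) k≤N 1≤j (ℕP.≤-trans (ℕP.<⇒≤ j<k) k≤N)))
          (λ k 1≤k k≤N → div k 1≤k k≤N (k ∣? suc N))
          where
          sat : ∀ k → 1 ≤ k → k ≤ N → (k∣?n : Dec (k ∣ℕ suc N)) → Saturated (Φ k ^ indicator k∣?n)
          sat k 1≤k k≤N (yes _) = saturated-cong (sym (*-identityʳ _)) (Φ-saturated 1≤k k≤N)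
          sat k 1≤k k≤N (no  _) = saturated-1
          cop : ∀ {j k} {A B : Set} (d : Dec A) (d′ : Dec B) → Coprime (Φ k) (Φ j) → Coprime (Φ k ^ indicator d′) (Φ j ^ indicator d)
          cop d d′ c = coprime-^ʳ (indicator d) (coprime-sym (coprime-^ʳ (indicator d′) (coprime-sym c)))
          div : ∀ k → 1 ≤ k → k ≤ N → (k∣?n : Dec (k ∣ℕ suc N)) → Φ k ^ indicator k∣?n ∣ X (suc N)
          div k 1≤k k≤N (yes k∣n) = ∣ʳ-respˡ-≈ (sym (*-identityʳ _))
            (∣ʳ-trans (Φ∣X ℕD.∣-refl 1≤k k≤N 1≤k k≤N) (X-∣ k∣n))
          div k 1≤k k≤N (no  _) = ε∣ʳ _

      Φ⁺ : ℕ → Carrier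
      Φ⁺ k = if does (k ℕ.≟ suc N) then _∣ʳ_.quotient next∣X else Φ k

      Φ⁺-old : ∀ {k} → k ≤ N → Φ⁺ k ≡ Φ k
      Φ⁺-old {k} k≤N rewrite dec-false (k ℕ.≟ suc N) (ℕP.<⇒≢ (s≤s k≤N)) = ≡.refl

      Φ⁺-new : Φ⁺ (suc N) ≡ _∣ʳ_.quotient next∣X
      Φ⁺-new rewrite dec-true (suc N ℕ.≟ suc N) ≡.refl = ≡.refl

      powProd-Φ⁺ : ∀ e → powProd Φ⁺ N e ≈ powProd Φ N e
      powProd-Φ⁺ e = ∏-cong N (λ k _ k≤N → ^-congˡ (e k) (reflexive (Φ⁺-old k≤N)))

      extension : Factorisation (suc N)
      extension = record { Φ = Φ⁺ ; factorise = fac }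
        where
        fac : ∀ n → 1 ≤ n → n ≤ suc N → X n ≈ powProd Φ⁺ (suc N) ⟦_∣ n ⟧
        fac n 1≤n n≤1+N with ℕP.m≤n⇒m<n∨m≡n n≤1+N
        ... | inj₁ (s≤s n≤N) = begin
              X n                            ≈⟨ factorise n 1≤n n≤N ⟩
              powProd Φ N ⟦_∣ n ⟧            ≈⟨ sym (powProd-Φ⁺ ⟦_∣ n ⟧) ⟩
              powProd Φ⁺ N ⟦_∣ n ⟧           ≈⟨ sym (powProd-extend Φ⁺ ⟦_∣ n ⟧ (ℕP.n≤1+n N)
                (λ k N<k _ → indicator-no (k ∣? n) (λ k∣n → ℕP.<⇒≱ (ℕP.≤-<-trans n≤N N<k) (ℕD.∣⇒≤ {{ℕ.>-nonZero 1≤n}} k∣n)))) ⟩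
              powProd Φ⁺ (suc N) ⟦_∣ n ⟧     ∎
        ... | inj₂ ≡.refl = begin
              X (suc N)                                         ≈⟨ sym (_∣ʳ_.equality next∣X) ⟩
              _∣ʳ_.quotient next∣X * powProd Φ N ⟦_∣ suc N ⟧     ≈⟨ *-comm _ _ ⟩
              powProd Φ N ⟦_∣ suc N ⟧ * _∣ʳ_.quotient next∣X     ≈⟨ *-cong (sym (powProd-Φ⁺ ⟦_∣ suc N ⟧)) (sym (*-identityʳ _)) ⟩
              powProd Φ⁺ N ⟦_∣ suc N ⟧ * (_∣ʳ_.quotient next∣X ^ 1)
                ≈⟨ *-congˡ (reflexive (≡.cong₂ _^_ (≡.sym Φ⁺-new) (≡.sym (indicator-yes (suc N ∣? suc N) ℕD.∣-refl)))) ⟩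
              powProd Φ⁺ (suc N) ⟦_∣ suc N ⟧ ∎

    factorisation : ∀ N → Factorisation N
    factorisation zero    = record { Φ = λ _ → 1# ; factorise = λ { zero () _ ; (suc _) _ () } }
    factorisation (suc N) = FactorisationProperties.extension (factorisation N)

    Φ : ℕ → Carrier
    Φ n = Factorisation.Φ (factorisation n) n

    -- An extension alters Φ at its new index only.
    Φ-stable : ∀ {N k} → k ≤ N → Factorisation.Φ (factorisation N) k ≡ Φ k
    Φ-stable {zero}  z≤n = ≡.refl
    Φ-stable {suc N} k≤1+N with ℕP.m≤n⇒m<n∨m≡n k≤1+N
    ... | inj₁ (s≤s k≤N) = ≡.trans (FactorisationProperties.Φ⁺-old (factorisation N) k≤N) (Φ-stable k≤N)
    ... | inj₂ ≡.refl    = ≡.refl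

    X≈powProd : ∀ {n N} → 1 ≤ n → n ≤ N → X n ≈ powProd Φ N ⟦_∣ n ⟧
    X≈powProd {n} {N} 1≤n n≤N = trans (Factorisation.factorise (factorisation N) n 1≤n n≤N)
      (∏-cong N (λ k _ k≤N → ^-congˡ ⟦ k ∣ n ⟧ (reflexive (Φ-stable k≤N))))

    open FactorisationProperties using () renaming (Φ∣X to Φ∣X′; Φ-saturated to Φ-saturated′; Φ-coprime to Φ-coprime′)

    Φ∣X : ∀ {k n} → k ∣ℕ n → 1 ≤ k → 1 ≤ n → Φ k ∣ X n
    Φ∣X {k} {n} k∣n 1≤k 1≤n = ≡.subst (_∣ X n) (Φ-stable k≤n) (Φ∣X′ (factorisation n) k∣n 1≤k k≤n 1≤n ℕP.≤-refl)
      where k≤n = ℕD.∣⇒≤ {{ℕ.>-nonZero 1≤n}} k∣n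

    Φ-saturated : ∀ {k} → 1 ≤ k → Saturated (Φ k)
    Φ-saturated {k} 1≤k = Φ-saturated′ (factorisation k) 1≤k ℕP.≤-refl

    Φ-coprime : ∀ {a b} → a ≢ b → 1 ≤ a → 1 ≤ b → Coprime (Φ a) (Φ b)
    Φ-coprime {a} {b} a≢b 1≤a 1≤b = ≡.subst₂ Coprime (Φ-stable (ℕP.m≤m⊔n a b)) (Φ-stable (ℕP.m≤n⊔m a b))
      (Φ-coprime′ (factorisation (a ℕ.⊔ b)) a≢b 1≤a (ℕP.m≤m⊔n a b) 1≤b (ℕP.m≤n⊔m a b))

    -- Modulo `X m` the element x is invertible, with inverse x ^ (m - 1).
    Φ-coprime-x : ∀ {m} → 1 ≤ m → Coprime (Φ m) x
    Φ-coprime-x {suc m} 1≤m = coprime-∣ (Φ∣X ℕD.∣-refl 1≤m 1≤m) ∣ʳ-refl (bezout 0 (- 1#) (x ^ m) (begin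
      1# + 0#                                      ≈⟨ +-identityʳ 1# ⟩
      1#                                           ≈⟨ sym (trans (+-congʳ (-‿inverseˡ _)) (+-identityˡ _)) ⟩
      - X (suc m) + X (suc m) + 1#                 ≈⟨ trans (+-assoc _ _ _) (+-congˡ (X+1 (suc m))) ⟩
      - X (suc m) + x * x ^ m                      ≈⟨ +-cong (trans (-‿cong (sym (*-identityˡ _))) (-‿distribˡ-* _ _)) (*-comm _ _) ⟩
      - 1# * X (suc m) + x ^ m * x                 ∎))

-- Clearing quotients of products of cyclotomic factors.

module CyclotomicQuotients {c ℓ} (R : CommutativeRing c ℓ) (x : CommutativeRing.Carrier R)
  (X-saturated : ∀ {n} → 1 ≤ n → Divisors.Saturated R (Cyclotomic.X R x n)) where
  open CommutativeRing R hiding (_≉_)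
  open Divisors R
  open PowerProducts R
  open Cyclotomic R x hiding (Φ; Φ∣X; Φ-saturated; Φ-coprime; Φ-coprime-x; X≈powProd)
  private
    module C = Cyclotomic R x
  Φ = C.Φ X-saturated
  Φ-saturated : ∀ {k} → 1 ≤ k → Saturated (Φ k)
  Φ-saturated = C.Φ-saturated X-saturated
  open Exp commutativeSemiring using (_^_; ^-distrib-*; ^-assocʳ)
  open Divisibility *-commutativeSemigroup
    using (_∣_; _∥_; _,_; ∣ʳ-respʳ-≈; ∣ʳ-respˡ-≈; ∣ʳ-trans; x∣ʳy⇒x∣ʳzy; ∙-cong-∣; x∣y⇒zx∣zy)
  open MonoidDivisibility *-monoid using (∣ʳ-reflexive; ε∣ʳ_)
  open SemiringSolver commutativeSemiring using (solve; _:=_; _:*_)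
  open SetoidReasoning setoid

  powΦ : ℕ → (ℕ → ℕ) → Carrier
  powΦ = powProd Φ

  neg∣ : ∀ {a b} → - a ≈ b → a ∣ b
  neg∣ {a} -a≈b = - 1# , trans (trans (sym (-‿distribˡ-* 1# a)) (-‿cong (*-identityˡ a))) -a≈b
    where open RingProperties ring using (-‿distribˡ-*)

  -- Elements are compared by mutual divisibility so that the sign between 1 - q ^ k and `X k` need
  -- not be tracked.
  neg-∥ : ∀ {a b} → - a ≈ b → a ∥ b
  neg-∥ {a} -a≈b = neg∣ -a≈b , neg∣ (trans (-‿cong (sym -a≈b)) (⁻¹-involutive a))
    where open RingProperties ring using () renaming (-‿involutive to ⁻¹-involutive)

  X∥powΦ : ∀ {n N} → 1 ≤ n → n ≤ N → X n ∥ powΦ N ⟦_∣ n ⟧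
  X∥powΦ 1≤n n≤N = ∣ʳ-reflexive (C.X≈powProd X-saturated 1≤n n≤N) , ∣ʳ-reflexive (sym (C.X≈powProd X-saturated 1≤n n≤N))

  powΦ-+-∥ : ∀ {a b} N e e′ → a ∥ powΦ N e → b ∥ powΦ N e′ → a * b ∥ powΦ N (λ k → e k ℕ.+ e′ k)
  powΦ-+-∥ N e e′ (a∣ , ∣a) (b∣ , ∣b) = ∣ʳ-respʳ-≈ (sym (powProd-+ Φ N e e′)) (∙-cong-∣ a∣ b∣) ,
                                         ∣ʳ-respˡ-≈ (sym (powProd-+ Φ N e e′)) (∙-cong-∣ ∣a ∣b)

  powΦ-0-∥ : ∀ N → 1# ∥ powΦ N (λ _ → 0)
  powΦ-0-∥ N = ∣ʳ-reflexive (sym (∏-1 N (λ _ _ _ → refl))) , ∣ʳ-reflexive (∏-1 N (λ _ _ _ → refl))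

  powProd-coprime : ∀ {m} N e → 1 ≤ m → e m ≡ 0 → Coprime (Φ m) (powΦ N e)
  powProd-coprime {m} N e 1≤m em≡0 = powProd-coprimeʳ Φ N e go
    where
    go : ∀ k → 1 ≤ k → k ≤ N → (e k ≡ 0) ⊎ Coprime (Φ m) (Φ k)
    go k 1≤k _ with m ℕ.≟ k
    ... | yes ≡.refl = inj₁ em≡0
    ... | no  m≢k    = inj₂ (C.Φ-coprime X-saturated m≢k 1≤m 1≤k)

  -- Setting the exponent of Φ m to 0 leaves powers of other Φ's, all of them coprime to Φ m.
  powProd-split : ∀ {m N} e → 1 ≤ m → m ≤ N →
    ∃ λ rest → (powΦ N e ≈ Φ m ^ e m * rest) × Coprime (Φ m) rest
  powProd-split {m} {N} e 1≤m m≤N = powΦ N e′ , split , powProd-coprime N e′ 1≤m (e′m)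
    where
    e′ : ℕ → ℕ
    e′ k = e k ℕ.∸ (e m at m) k
    e′m : e′ m ≡ 0
    e′m = ≡.trans (≡.cong (e m ℕ.∸_) (at-self (e m) m)) (ℕP.n∸n≡0 (e m))
    at≤ : ∀ k → (e m at m) k ≤ e k
    at≤ k with k ℕ.≟ m
    ... | yes ≡.refl = ℕP.≤-reflexive (at-self (e m) m)
    ... | no  k≢m rewrite at-other (e m) k≢m = z≤n
    split : powΦ N e ≈ Φ m ^ e m * powΦ N e′
    split = begin
      powΦ N e                                  ≈⟨ powProd-cong Φ N (λ k _ _ → ≡.sym (ℕP.m+[n∸m]≡n (at≤ k))) ⟩
      powΦ N (λ k → (e m at m) k ℕ.+ e′ k)      ≈⟨ powProd-+ Φ N (e m at m) e′ ⟩
      powΦ N (e m at m) * powΦ N e′             ≈⟨ *-congʳ (powProd-at Φ (e m) 1≤m m≤N) ⟩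
      Φ m ^ e m * powΦ N e′                     ∎

  saturated-^ : ∀ {f} n → Saturated f → Saturated (f ^ n)
  saturated-^ zero    sf = saturated-1
  saturated-^ (suc n) sf = saturated-* sf (saturated-^ n sf)

  module _ (X-reduced : ∀ {m} f → 1 ≤ m → X m ∣ f * f → X m ∣ f) where

    -- Write `X m` as ψ Φ m. If Φ m divides f², then `X m` divides (ψ f)², hence ψ f, and ψ can be
    -- cancelled.
    Φ-reduced : ∀ {m} f → 1 ≤ m → Φ m ∣ f * f → Φ m ∣ f
    Φ-reduced {m} f 1≤m Φ∣ff with C.Φ∣X X-saturated ℕD.∣-refl 1≤m 1≤m
    ... | ψ , ψΦ≈X = ∣-cancelˡ (saturated-∣ (∣ʳ-respʳ-≈ ψΦ≈X (x∣xy ψ (Φ m))) (X-saturated 1≤m))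
      (∣ʳ-respˡ-≈ (sym ψΦ≈X) (X-reduced (ψ * f) 1≤m (∣ʳ-respˡ-≈ ψΦ≈X
        (∣ʳ-respʳ-≈ (solve 2 (λ ψ f → ψ :* (ψ :* (f :* f)) := ψ :* f :* (ψ :* f)) refl ψ f)
          (x∣y⇒zx∣zy ψ (x∣ʳy⇒x∣ʳzy ψ Φ∣ff))))))

    -- A power f ^ (n + 2) divides the square of f ^ (n + 1), so each use of reducedness lowers the
    -- exponent by one.
    Φ-radical : ∀ {m} f n → 1 ≤ m → Φ m ∣ f ^ n → Φ m ∣ f
    Φ-radical f zero          1≤m Φ∣1 = ∣ʳ-trans Φ∣1 (ε∣ʳ f)
    Φ-radical f (suc zero)    1≤m Φ∣f = ∣ʳ-respʳ-≈ (*-identityʳ f) Φ∣f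
    Φ-radical {m} f (suc (suc n)) 1≤m Φ∣f^n = Φ-radical f (suc n) 1≤m (Φ-reduced (f ^ suc n) 1≤m
      (∣ʳ-respʳ-≈ (solve 2 (λ f p → p :* (f :* (f :* p)) := (f :* p) :* (f :* p)) refl f (f ^ n)) (x∣ʳy⇒x∣ʳzy (f ^ n) Φ∣f^n)))

    -- After the power of Φ m in p is cancelled, one factor Φ m remains on the left. It is coprime
    -- to x ^ κ and to the rest of p, so it divides C ^ n.
    deficit⇒Φ∣ : ∀ {m M p q} C κ n hN hD → p ∥ powΦ M hN → q ∥ powΦ M hD → 1 ≤ m → m ≤ M →
      hN m < hD m → q ∣ x ^ κ * C ^ n * p → Φ m ∣ C
    deficit⇒Φ∣ {m} {M} {p} {q} C κ n hN hD (p∣ , _) (_ , ∣q) 1≤m m≤M hN<hD q∣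
      with powProd-split hN 1≤m m≤M | powProd-split hD 1≤m m≤M
    ... | N′ , N≈ , copN | D′ , D≈ , _ = Φ-radical C n 1≤m
      (gauss (Φ-saturated 1≤m) copN (gauss (Φ-saturated 1≤m) (coprime-^ʳ κ (C.Φ-coprime-x X-saturated 1≤m)) Φ∣))
      where
      f = Φ m
      f^∣ : f ^ suc (hN m) ∣ x ^ κ * C ^ n * (f ^ hN m * N′)
      f^∣ = ∣ʳ-trans (∣ʳ-trans (^-∣-mono f hN<hD) (∣ʳ-respʳ-≈ (sym D≈) (x∣xy _ D′)))
            (∣ʳ-trans ∣q (∣ʳ-trans q∣ (x∣y⇒zx∣zy _ (∣ʳ-respʳ-≈ N≈ p∣))))
      Φ∣ : f ∣ x ^ κ * (N′ * C ^ n)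
      Φ∣ = ∣-cancelˡ (saturated-^ (hN m) (Φ-saturated 1≤m)) (∣ʳ-respˡ-≈ (*-comm _ _) (∣ʳ-respʳ-≈
        (solve 4 (λ x c f n → x :* c :* (f :* n) := f :* (x :* (n :* c))) refl (x ^ κ) (C ^ n) (f ^ hN m) N′) f^∣))

  -- For indices up to M₀ the exponent w n supplied by the first factor already covers that of q;
  -- above M₀ the exponent in p does.
  surplus⇒∣ : ∀ {M p q} M₀ w n hN hD → p ∥ powΦ M hN → q ∥ powΦ M hD → M₀ ≤ M →
    (∀ m → hD m ≤ n ℕ.* w) → (∀ m → M₀ < m → m ≤ M → hD m ≤ hN m) →
    q ∣ powΦ M₀ (λ _ → w) ^ n * p
  surplus⇒∣ {M} {p} {q} M₀ w n hN hD (_ , ∣p) (q∣ , _) M₀≤M small large =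
    ∣ʳ-trans q∣ (∣ʳ-trans (powProd-mono Φ M le) (∣ʳ-respˡ-≈ (sym (powProd-+ Φ M cut hN)) (∙-cong-∣ (∣ʳ-reflexive cut≈) ∣p)))
    where
    cut : ℕ → ℕ
    cut k = if-≤ (k ℕ.≤? M₀)
      where
      if-≤ : Dec (k ≤ M₀) → ℕ
      if-≤ (yes _) = w ℕ.* n
      if-≤ (no  _) = 0
    le : ∀ k → 1 ≤ k → k ≤ M → hD k ≤ cut k ℕ.+ hN k
    le k _ k≤M with k ℕ.≤? M₀
    ... | yes _   = ℕP.≤-trans (small k) (ℕP.≤-trans (ℕP.≤-reflexive (ℕP.*-comm n w)) (ℕP.m≤m+n (w ℕ.* n) (hN k)))
    ... | no k≰M₀ = large k (ℕP.≰⇒> k≰M₀) k≤M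
    cut≤ : ∀ k → 1 ≤ k → k ≤ M₀ → cut k ≡ w ℕ.* n
    cut≤ k _ k≤M₀ with k ℕ.≤? M₀
    ... | yes _   = ≡.refl
    ... | no k≰M₀ = contradiction k≤M₀ k≰M₀
    cut> : ∀ k → M₀ < k → k ≤ M → cut k ≡ 0
    cut> k M₀<k _ with k ℕ.≤? M₀
    ... | yes k≤M₀ = contradiction k≤M₀ (ℕP.<⇒≱ M₀<k)
    ... | no _     = ≡.refl
    ∏-^ : ∀ N → ∏ N (λ k → Φ k ^ w) ^ n ≈ ∏ N (λ k → Φ k ^ (w ℕ.* n))
    ∏-^ zero    = one n
      where
      one : ∀ n → 1# ^ n ≈ 1#
      one zero    = refl
      one (suc n) = trans (*-identityˡ _) (one n)
    ∏-^ (suc N) = trans (^-distrib-* _ _ n) (*-cong (∏-^ N) (^-assocʳ (Φ (suc N)) w n))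
    cut≈ : powΦ M cut ≈ powΦ M₀ (λ _ → w) ^ n
    cut≈ = begin
      powΦ M cut                    ≈⟨ powProd-extend Φ cut M₀≤M cut> ⟩
      powΦ M₀ cut                   ≈⟨ powProd-cong Φ M₀ cut≤ ⟩
      powΦ M₀ (λ _ → w ℕ.* n)       ≈⟨ sym (∏-^ M₀) ⟩
      powΦ M₀ (λ _ → w) ^ n         ∎

  ∏Φ∣ : ∀ {h} n (σ : ℕ → ℕ) → (∀ k → 1 ≤ σ k) → (∀ j k → j < k → σ j ≢ σ k) → (∀ k → Φ (σ k) ∣ h) → ∏ n (λ k → Φ (σ k)) ∣ h
  ∏Φ∣ n σ 1≤σ σ-inj div = ∏-coprime-∣ n _ (λ k _ _ → Φ-saturated (1≤σ k))
    (λ j k _ j<k _ → C.Φ-coprime X-saturated (λ σk≡σj → σ-inj j k j<k (≡.sym σk≡σj)) (1≤σ k) (1≤σ j)) (λ k _ _ → div k)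

-- The ring ℤ[q]

coef : Poly → ℕ → ℤ
coef []      _       = 0ℤ
coef (a ∷ f) zero    = a
coef (a ∷ f) (suc k) = coef f k

infix 4 _≋_
-- Coefficient lists that differ only by trailing zeros denote the same polynomial, hence the
-- comparison through `coef`.
record _≋_ (f g : Poly) : Set where
  constructor coefwise
  field
    coef-≡ : ∀ k → coef f k ≡ coef g k
open _≋_

coef-+ : ∀ f g k → coef (f +ₚ g) k ≡ coef f k ℤ.+ coef g k
coef-+ []      g       k       = ≡.sym (ℤP.+-identityˡ _)
coef-+ (a ∷ f) []      k       = ≡.sym (ℤP.+-identityʳ _)
coef-+ (a ∷ f) (b ∷ g) zero    = ≡.refl
coef-+ (a ∷ f) (b ∷ g) (suc k) = coef-+ f g k

coef-· : ∀ c f k → coef (c ·ₚ f) k ≡ c ℤ.* coef f k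
coef-· c []      k       = ≡.sym (ℤP.*-zeroʳ c)
coef-· c (a ∷ f) zero    = ≡.refl
coef-· c (a ∷ f) (suc k) = coef-· c f k

coef-*-suc : ∀ a f g k → coef ((a ∷ f) *ₚ g) (suc k) ≡ a ℤ.* coef g (suc k) ℤ.+ coef (f *ₚ g) k
coef-*-suc a f g k = ≡.trans (coef-+ (a ·ₚ g) _ (suc k)) (≡.cong (λ y → y ℤ.+ coef (f *ₚ g) k) (coef-· a g (suc k)))

coef-*-zero : ∀ a f g → coef ((a ∷ f) *ₚ g) 0 ≡ a ℤ.* coef g 0
coef-*-zero a f g = ≡.trans (coef-+ (a ·ₚ g) _ 0) (≡.trans (ℤP.+-identityʳ _) (coef-· a g 0))

≋-refl : ∀ {f} → f ≋ f
≋-refl = coefwise λ _ → ≡.refl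

≋-sym : ∀ {f g} → f ≋ g → g ≋ f
≋-sym p = coefwise λ k → ≡.sym (coef-≡ p k)

≋-trans : ∀ {f g h} → f ≋ g → g ≋ h → f ≋ h
≋-trans p q = coefwise λ k → ≡.trans (coef-≡ p k) (coef-≡ q k)

∷-cong : ∀ {a b f g} → a ≡ b → f ≋ g → a ∷ f ≋ b ∷ g
∷-cong a≡b p = coefwise λ { zero → a≡b ; (suc k) → coef-≡ p k }

0∷[]≋[] : 0ℤ ∷ [] ≋ []
0∷[]≋[] = coefwise λ { zero → ≡.refl ; (suc k) → ≡.refl }

+ₚ-cong : ∀ {f f′ g g′} → f ≋ f′ → g ≋ g′ → f +ₚ g ≋ f′ +ₚ g′
+ₚ-cong {f} {f′} {g} {g′} p q = coefwise λ k →
  ≡.trans (coef-+ f g k) (≡.trans (≡.cong₂ ℤ._+_ (coef-≡ p k) (coef-≡ q k)) (≡.sym (coef-+ f′ g′ k)))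

·ₚ-cong : ∀ c {f g} → f ≋ g → c ·ₚ f ≋ c ·ₚ g
·ₚ-cong c {f} {g} p = coefwise λ k →
  ≡.trans (coef-· c f k) (≡.trans (≡.cong (c ℤ.*_) (coef-≡ p k)) (≡.sym (coef-· c g k)))

+ₚ-comm : ∀ f g → f +ₚ g ≋ g +ₚ f
+ₚ-comm f g = coefwise λ k → ≡.trans (coef-+ f g k) (≡.trans (ℤP.+-comm (coef f k) _) (≡.sym (coef-+ g f k)))

+ₚ-assoc : ∀ f g h → (f +ₚ g) +ₚ h ≋ f +ₚ (g +ₚ h)
+ₚ-assoc f g h = coefwise λ k → begin
  coef ((f +ₚ g) +ₚ h) k                    ≡⟨ coef-+ (f +ₚ g) h k ⟩
  coef (f +ₚ g) k ℤ.+ coef h k              ≡⟨ ≡.cong (λ y → y ℤ.+ coef h k) (coef-+ f g k) ⟩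
  coef f k ℤ.+ coef g k ℤ.+ coef h k        ≡⟨ ℤP.+-assoc (coef f k) _ _ ⟩
  coef f k ℤ.+ (coef g k ℤ.+ coef h k)      ≡⟨ ≡.cong (λ y → coef f k ℤ.+ y) (coef-+ g h k) ⟨
  coef f k ℤ.+ coef (g +ₚ h) k              ≡⟨ coef-+ f (g +ₚ h) k ⟨
  coef (f +ₚ (g +ₚ h)) k                    ∎
  where open ≡.≡-Reasoning

+ₚ-identityʳ : ∀ f → f +ₚ [] ≋ f
+ₚ-identityʳ f = coefwise λ k → ≡.trans (coef-+ f [] k) (ℤP.+-identityʳ _)

+ₚ-inverseʳ : ∀ f → f -ₚ f ≋ []
+ₚ-inverseʳ f = coefwise λ k → ≡.trans (coef-+ f _ k)
  (≡.trans (≡.cong (λ y → coef f k ℤ.+ y) (coef-· (ℤ.- 1ℤ) f k)) (lem (coef f k)))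
  where
  lem : ∀ a → a ℤ.+ ℤ.- 1ℤ ℤ.* a ≡ 0ℤ
  lem = solve-∀

*ₚ-zeroʳ : ∀ f → f *ₚ [] ≋ []
*ₚ-zeroʳ []      = ≋-refl
*ₚ-zeroʳ (a ∷ f) = ≋-trans (∷-cong ≡.refl (*ₚ-zeroʳ f)) 0∷[]≋[]

-- The product is defined by recursion on its left factor; this is the mirror recursion, and
-- commutativity follows by matching the two.
*ₚ-∷ʳ : ∀ f b g → f *ₚ (b ∷ g) ≋ (b ·ₚ f) +ₚ (0ℤ ∷ f *ₚ g)
*ₚ-∷ʳ []      b g = ≋-sym 0∷[]≋[]
*ₚ-∷ʳ (a ∷ f) b g = coefwise λ where
    zero    → ≡.trans (coef-*-zero a f (b ∷ g)) (≡.trans (ℤP.*-comm a b) (≡.sym (ℤP.+-identityʳ _)))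
    (suc k) → begin
      coef ((a ∷ f) *ₚ (b ∷ g)) (suc k)                                 ≡⟨ coef-*-suc a f (b ∷ g) k ⟩
      a ℤ.* coef g k ℤ.+ coef (f *ₚ (b ∷ g)) k                          ≡⟨ ≡.cong (λ y → a ℤ.* coef g k ℤ.+ y) (coef-≡ (*ₚ-∷ʳ f b g) k) ⟩
      a ℤ.* coef g k ℤ.+ coef (b ·ₚ f +ₚ (0ℤ ∷ f *ₚ g)) k               ≡⟨ ≡.cong (λ y → a ℤ.* coef g k ℤ.+ y) (coef-+ (b ·ₚ f) _ k) ⟩
      a ℤ.* coef g k ℤ.+ (coef (b ·ₚ f) k ℤ.+ coef (0ℤ ∷ f *ₚ g) k)     ≡⟨ swap (a ℤ.* coef g k) (coef (b ·ₚ f) k) _ ⟩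
      coef (b ·ₚ f) k ℤ.+ (a ℤ.* coef g k ℤ.+ coef (0ℤ ∷ f *ₚ g) k)     ≡⟨ ≡.cong (λ y → coef (b ·ₚ f) k ℤ.+ (y ℤ.+ coef (0ℤ ∷ f *ₚ g) k)) (coef-· a g k) ⟨
      coef (b ·ₚ f) k ℤ.+ (coef (a ·ₚ g) k ℤ.+ coef (0ℤ ∷ f *ₚ g) k)    ≡⟨ ≡.cong (λ y → coef (b ·ₚ f) k ℤ.+ y) (coef-+ (a ·ₚ g) _ k) ⟨
      coef (b ·ₚ f) k ℤ.+ coef ((a ∷ f) *ₚ g) k                         ≡⟨ coef-+ (b ·ₚ f) _ k ⟨
      coef (b ·ₚ f +ₚ ((a ∷ f) *ₚ g)) k                                 ∎
  where
  open ≡.≡-Reasoning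
  swap : ∀ a b c → a ℤ.+ (b ℤ.+ c) ≡ b ℤ.+ (a ℤ.+ c)
  swap = solve-∀

*ₚ-congʳ : ∀ f {g g′} → g ≋ g′ → f *ₚ g ≋ f *ₚ g′
*ₚ-congʳ []      p = ≋-refl
*ₚ-congʳ (a ∷ f) p = +ₚ-cong (·ₚ-cong a p) (∷-cong ≡.refl (*ₚ-congʳ f p))

*ₚ-comm : ∀ f g → f *ₚ g ≋ g *ₚ f
*ₚ-comm []      g = ≋-sym (*ₚ-zeroʳ g)
*ₚ-comm (a ∷ f) g = ≋-trans (+ₚ-cong ≋-refl (∷-cong ≡.refl (*ₚ-comm f g))) (≋-sym (*ₚ-∷ʳ g a f))

*ₚ-congˡ : ∀ {f f′} g → f ≋ f′ → f *ₚ g ≋ f′ *ₚ g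
*ₚ-congˡ {f} {f′} g p = ≋-trans (*ₚ-comm f g) (≋-trans (*ₚ-congʳ g p) (*ₚ-comm g f′))

*ₚ-distribˡ : ∀ f g h → f *ₚ (g +ₚ h) ≋ f *ₚ g +ₚ f *ₚ h
*ₚ-distribˡ []      g h = ≋-refl
*ₚ-distribˡ (a ∷ f) g h = coefwise λ where
    zero    → begin
      coef ((a ∷ f) *ₚ (g +ₚ h)) 0                            ≡⟨ coef-*-zero a f (g +ₚ h) ⟩
      a ℤ.* coef (g +ₚ h) 0                                   ≡⟨ ≡.cong (a ℤ.*_) (coef-+ g h 0) ⟩
      a ℤ.* (coef g 0 ℤ.+ coef h 0)                           ≡⟨ ℤP.*-distribˡ-+ a _ _ ⟩
      a ℤ.* coef g 0 ℤ.+ a ℤ.* coef h 0                       ≡⟨ ≡.cong₂ ℤ._+_ (coef-*-zero a f g) (coef-*-zero a f h) ⟨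
      coef ((a ∷ f) *ₚ g) 0 ℤ.+ coef ((a ∷ f) *ₚ h) 0         ≡⟨ coef-+ ((a ∷ f) *ₚ g) _ 0 ⟨
      coef ((a ∷ f) *ₚ g +ₚ (a ∷ f) *ₚ h) 0                   ∎
    (suc k) → begin
      coef ((a ∷ f) *ₚ (g +ₚ h)) (suc k)                      ≡⟨ coef-*-suc a f (g +ₚ h) k ⟩
      a ℤ.* coef (g +ₚ h) (suc k) ℤ.+ coef (f *ₚ (g +ₚ h)) k  ≡⟨ ≡.cong₂ (λ y z → a ℤ.* y ℤ.+ z) (coef-+ g h (suc k))
                                                                (≡.trans (coef-≡ (*ₚ-distribˡ f g h) k) (coef-+ (f *ₚ g) _ k)) ⟩
      a ℤ.* (coef g (suc k) ℤ.+ coef h (suc k)) ℤ.+ (coef (f *ₚ g) k ℤ.+ coef (f *ₚ h) k)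
                                                              ≡⟨ expand a (coef g (suc k)) (coef h (suc k)) _ _ ⟩
      a ℤ.* coef g (suc k) ℤ.+ coef (f *ₚ g) k ℤ.+ (a ℤ.* coef h (suc k) ℤ.+ coef (f *ₚ h) k)
                                                              ≡⟨ ≡.cong₂ ℤ._+_ (coef-*-suc a f g k) (coef-*-suc a f h k) ⟨
      coef ((a ∷ f) *ₚ g) (suc k) ℤ.+ coef ((a ∷ f) *ₚ h) (suc k) ≡⟨ coef-+ ((a ∷ f) *ₚ g) _ (suc k) ⟨
      coef ((a ∷ f) *ₚ g +ₚ (a ∷ f) *ₚ h) (suc k)             ∎
  where
  open ≡.≡-Reasoning
  expand : ∀ a b c d e → a ℤ.* (b ℤ.+ c) ℤ.+ (d ℤ.+ e) ≡ a ℤ.* b ℤ.+ d ℤ.+ (a ℤ.* c ℤ.+ e)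
  expand = solve-∀

*ₚ-distribʳ : ∀ h f g → (f +ₚ g) *ₚ h ≋ f *ₚ h +ₚ g *ₚ h
*ₚ-distribʳ h f g = ≋-trans (*ₚ-comm (f +ₚ g) h) (≋-trans (*ₚ-distribˡ h f g) (+ₚ-cong (*ₚ-comm h f) (*ₚ-comm h g)))

·ₚ-*ₚ : ∀ c f g → (c ·ₚ f) *ₚ g ≋ c ·ₚ (f *ₚ g)
·ₚ-*ₚ c []      g = ≋-refl
·ₚ-*ₚ c (a ∷ f) g = coefwise λ where
    zero    → ≡.trans (coef-*-zero (c ℤ.* a) (c ·ₚ f) g) (≡.trans (ℤP.*-assoc c a _)
                (≡.trans (≡.cong (c ℤ.*_) (≡.sym (coef-*-zero a f g))) (≡.sym (coef-· c ((a ∷ f) *ₚ g) 0))))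
    (suc k) → begin
      coef ((c ℤ.* a ∷ c ·ₚ f) *ₚ g) (suc k)                         ≡⟨ coef-*-suc (c ℤ.* a) (c ·ₚ f) g k ⟩
      c ℤ.* a ℤ.* coef g (suc k) ℤ.+ coef ((c ·ₚ f) *ₚ g) k          ≡⟨ ≡.cong (λ y → c ℤ.* a ℤ.* coef g (suc k) ℤ.+ y)
                                                                      (≡.trans (coef-≡ (·ₚ-*ₚ c f g) k) (coef-· c (f *ₚ g) k)) ⟩
      c ℤ.* a ℤ.* coef g (suc k) ℤ.+ c ℤ.* coef (f *ₚ g) k           ≡⟨ expand c a (coef g (suc k)) _ ⟩
      c ℤ.* (a ℤ.* coef g (suc k) ℤ.+ coef (f *ₚ g) k)               ≡⟨ ≡.cong (c ℤ.*_) (coef-*-suc a f g k) ⟨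
      c ℤ.* coef ((a ∷ f) *ₚ g) (suc k)                              ≡⟨ coef-· c ((a ∷ f) *ₚ g) (suc k) ⟨
      coef (c ·ₚ ((a ∷ f) *ₚ g)) (suc k)                             ∎
  where
  open ≡.≡-Reasoning
  expand : ∀ c a b d → c ℤ.* a ℤ.* b ℤ.+ c ℤ.* d ≡ c ℤ.* (a ℤ.* b ℤ.+ d)
  expand = solve-∀

0·ₚ : ∀ f → 0ℤ ·ₚ f ≋ []
0·ₚ f = coefwise λ k → ≡.trans (coef-· 0ℤ f k) (ℤP.*-zeroˡ (coef f k))

0∷-*ₚ : ∀ f g → (0ℤ ∷ f) *ₚ g ≋ 0ℤ ∷ f *ₚ g
0∷-*ₚ f g = +ₚ-cong (0·ₚ g) ≋-refl

*ₚ-assoc : ∀ f g h → (f *ₚ g) *ₚ h ≋ f *ₚ (g *ₚ h)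
*ₚ-assoc []      g h = ≋-refl
*ₚ-assoc (a ∷ f) g h = ≋-trans (*ₚ-distribʳ h (a ·ₚ g) (0ℤ ∷ f *ₚ g))
  (+ₚ-cong (·ₚ-*ₚ a g h) (≋-trans (0∷-*ₚ (f *ₚ g) h) (∷-cong ≡.refl (*ₚ-assoc f g h))))

*ₚ-identityˡ : ∀ f → 1ₚ *ₚ f ≋ f
*ₚ-identityˡ f = ≋-trans (+ₚ-cong (coefwise λ k → ≡.trans (coef-· 1ℤ f k) (ℤP.*-identityˡ _)) 0∷[]≋[]) (+ₚ-identityʳ f)

polyRing : CommutativeRing _ _
polyRing = record
  { Carrier = Poly ; _≈_ = _≋_ ; _+_ = _+ₚ_ ; _*_ = _*ₚ_ ; -_ = ℤ.- 1ℤ ·ₚ_ ; 0# = [] ; 1# = 1ₚ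
  ; isCommutativeRing = record
    { isRing = record
      { +-isAbelianGroup = record
        { isGroup = record
          { isMonoid = record
            { isSemigroup = record
              { isMagma = record
                { isEquivalence = record { refl = ≋-refl ; sym = ≋-sym ; trans = ≋-trans }
                ; ∙-cong = +ₚ-cong }
              ; assoc = +ₚ-assoc }
            ; identity = (λ _ → ≋-refl) , +ₚ-identityʳ }
          ; inverse = (λ f → ≋-trans (+ₚ-comm _ f) (+ₚ-inverseʳ f)) , +ₚ-inverseʳ
          ; ⁻¹-cong = ·ₚ-cong (ℤ.- 1ℤ) }
        ; comm = +ₚ-comm }
      ; *-cong = λ {_} {f′} {g} p q → ≋-trans (*ₚ-congˡ g p) (*ₚ-congʳ f′ q)
      ; *-assoc = *ₚ-assoc
      ; *-identity = *ₚ-identityˡ , λ f → ≋-trans (*ₚ-comm f 1ₚ) (*ₚ-identityˡ f)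
      ; distrib = *ₚ-distribˡ , *ₚ-distribʳ }
    ; *-comm = *ₚ-comm } }

≋⇒≈ₚ : ∀ {f g} → f ≋ g → f ≈ₚ g
≋⇒≈ₚ {f} {g} p = all (f -ₚ g) λ k → coef-≡ (≋-trans (+ₚ-cong p (≋-refl {ℤ.- 1ℤ ·ₚ g})) (+ₚ-inverseʳ g)) k
  where
  all : ∀ h → (∀ k → coef h k ≡ 0ℤ) → IsZeroₚ h
  all []      z = []
  all (a ∷ h) z = z 0 ∷ all h (λ k → z (suc k))

IsZero⇒≋ : ∀ {f} → IsZeroₚ f → f ≋ []
IsZero⇒≋ []      = ≋-refl
IsZero⇒≋ (p ∷ z) = ≋-trans (∷-cong p (IsZero⇒≋ z)) 0∷[]≋[]

≋⇒IsZero : ∀ f → f ≋ [] → IsZeroₚ f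
≋⇒IsZero []      z = []
≋⇒IsZero (a ∷ f) z = coef-≡ z 0 ∷ ≋⇒IsZero f (coefwise λ k → coef-≡ z (suc k))

≈ₚ⇒≋ : ∀ {f g} → f ≈ₚ g → f ≋ g
≈ₚ⇒≋ {f} {g} z = coefwise λ k → ℤP.i-j≡0⇒i≡j (coef f k) (coef g k) (≡.trans
  (≡.trans (lem (coef f k) (coef g k)) (≡.trans (≡.cong (λ y → coef f k ℤ.+ y) (≡.sym (coef-· (ℤ.- 1ℤ) g k)))
    (≡.sym (coef-+ f _ k)))) (coef-≡ (IsZero⇒≋ z) k))
  where
  lem : ∀ a b → a ℤ.- b ≡ a ℤ.+ ℤ.- 1ℤ ℤ.* b
  lem = solve-∀

-- The quotient of a commutative ring by a principal ideal.

module _ {c ℓ} (R : CommutativeRing c ℓ) (m : CommutativeRing.Carrier R) where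
  open CommutativeRing R
  open RingProperties ring using (-‿distribˡ-*; -‿+-comm)
  open SemiringSolver commutativeSemiring using (solve; _:=_; _:+_; _:*_)
  open SetoidReasoning setoid

  record _≈mod_ (a b : Carrier) : Set (c Level.⊔ ℓ) where
    constructor congruent
    field
      multiplier : Carrier
      equality   : a ≈ b + multiplier * m

  ≈⇒≈mod : ∀ {a b} → a ≈ b → a ≈mod b
  ≈⇒≈mod a≈b = congruent 0# (trans a≈b (sym (trans (+-congˡ (zeroˡ m)) (+-identityʳ _))))

  ≈mod-sym : ∀ {a b} → a ≈mod b → b ≈mod a
  ≈mod-sym {a} {b} (congruent k eq) = congruent (- k) (sym (begin
    a + - k * m             ≈⟨ +-cong eq (sym (-‿distribˡ-* k m)) ⟩
    b + k * m - k * m       ≈⟨ trans (+-assoc b _ _) (trans (+-congˡ (-‿inverseʳ _)) (+-identityʳ b)) ⟩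
    b                       ∎))

  ≈mod-trans : ∀ {a b d} → a ≈mod b → b ≈mod d → a ≈mod d
  ≈mod-trans {a} {b} {d} (congruent k eq) (congruent l eq′) = congruent (k + l)
    (trans eq (trans (+-congʳ eq′) (solve 4 (λ k l d m → d :+ l :* m :+ k :* m := d :+ (k :+ l) :* m) refl k l d m)))

  quotientRing : CommutativeRing c (c Level.⊔ ℓ)
  quotientRing = record
    { Carrier = Carrier ; _≈_ = _≈mod_ ; _+_ = _+_ ; _*_ = _*_ ; -_ = -_ ; 0# = 0# ; 1# = 1#
    ; isCommutativeRing = record
      { isRing = record
        { +-isAbelianGroup = record
          { isGroup = record
            { isMonoid = record
              { isSemigroup = record
                { isMagma = record
                  { isEquivalence = record { refl = ≈⇒≈mod refl ; sym = ≈mod-sym ; trans = ≈mod-trans }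
                  ; ∙-cong = λ {a} {a′} {b} {b′} (congruent k eq) (congruent l eq′) → congruent (k + l)
                      (trans (+-cong eq eq′) (solve 5 (λ a b k l m → a :+ k :* m :+ (b :+ l :* m) := a :+ b :+ (k :+ l) :* m)
                        refl a′ b′ k l m)) }
                ; assoc = λ a b d → ≈⇒≈mod (+-assoc a b d) }
              ; identity = (λ a → ≈⇒≈mod (+-identityˡ a)) , λ a → ≈⇒≈mod (+-identityʳ a) }
            ; inverse = (λ a → ≈⇒≈mod (-‿inverseˡ a)) , λ a → ≈⇒≈mod (-‿inverseʳ a)
            ; ⁻¹-cong = λ {a} {b} (congruent k eq) → congruent (- k)
                (trans (-‿cong eq) (trans (sym (-‿+-comm b (k * m))) (+-congˡ (-‿distribˡ-* k m)))) }
          ; comm = λ a b → ≈⇒≈mod (+-comm a b) }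
        ; *-cong = λ {a} {a′} {b} {b′} (congruent k eq) (congruent l eq′) → congruent (a′ * l + k * b′ + k * l * m)
            (trans (*-cong eq eq′) (solve 5 (λ a b k l m →
              (a :+ k :* m) :* (b :+ l :* m) := a :* b :+ (a :* l :+ k :* b :+ k :* l :* m) :* m) refl a′ b′ k l m))
        ; *-assoc = λ a b d → ≈⇒≈mod (*-assoc a b d)
        ; *-identity = (λ a → ≈⇒≈mod (*-identityˡ a)) , λ a → ≈⇒≈mod (*-identityʳ a)
        ; distrib = (λ a b d → ≈⇒≈mod (distribˡ a b d)) , λ a b d → ≈⇒≈mod (distribʳ a b d) }
      ; *-comm = λ a b → ≈⇒≈mod (*-comm a b) } }

-- Multiples of q ^ n - 1 and division with remainder.

coef-beyond : ∀ f {k} → length f ≤ k → coef f k ≡ 0ℤ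
coef-beyond []      _         = ≡.refl
coef-beyond (a ∷ f) (s≤s f≤k) = coef-beyond f f≤k

q : Poly
q = 0ℤ ∷ 1ℤ ∷ []

open CommutativeRing polyRing using (commutativeSemiring; semiring; *-commutativeSemigroup)
  renaming (setoid to ≋-setoid)
open Exp commutativeSemiring using () renaming (_^_ to _^^_)
open Divisibility *-commutativeSemigroup using (_,_) renaming (_∣_ to _∣ₚ_)
open Cyclotomic polyRing q using (X)
open Divisors polyRing using (Saturated)

q*-≋ : ∀ f → q *ₚ f ≋ 0ℤ ∷ f
q*-≋ f = ≋-trans (0∷-*ₚ 1ₚ f) (∷-cong ≡.refl (*ₚ-identityˡ f))

shift : ℕ → Poly → Poly
shift n f = replicate n 0ℤ ++ f

q^*-≋ : ∀ n f → (q ^^ n) *ₚ f ≋ shift n f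
q^*-≋ zero    f = *ₚ-identityˡ f
q^*-≋ (suc n) f = ≋-trans (*ₚ-assoc q (q ^^ n) f) (≋-trans (q*-≋ _) (∷-cong ≡.refl (q^*-≋ n f)))

q^≋qPow : ∀ n → q ^^ n ≋ qPow n
q^≋qPow n = ≋-trans (≋-trans (≋-sym (*ₚ-identityˡ _)) (*ₚ-comm 1ₚ (q ^^ n))) (q^*-≋ n 1ₚ)

coef-shift : ∀ n f k → coef (shift n f) (n ℕ.+ k) ≡ coef f k
coef-shift zero    f k = ≡.refl
coef-shift (suc n) f k = coef-shift n f k

*X-≋ : ∀ n f → f *ₚ X n ≋ shift n f -ₚ f
*X-≋ n f = ≋-trans (*ₚ-comm f (X n)) (≋-trans (*ₚ-distribʳ f (q ^^ n) (ℤ.- 1ℤ ·ₚ 1ₚ))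
  (+ₚ-cong (q^*-≋ n f) (≋-trans (·ₚ-*ₚ (ℤ.- 1ℤ) 1ₚ f) (·ₚ-cong (ℤ.- 1ℤ) (*ₚ-identityˡ f)))))

coef-- : ∀ f g k → coef (f -ₚ g) k ≡ coef f k ℤ.- coef g k
coef-- f g k = ≡.trans (coef-+ f _ k) (≡.trans (≡.cong (λ y → coef f k ℤ.+ y) (coef-· (ℤ.- 1ℤ) g k)) (lem (coef f k) (coef g k)))
  where
  lem : ∀ a b → a ℤ.+ ℤ.- 1ℤ ℤ.* b ≡ a ℤ.- b
  lem = solve-∀

coef-*X : ∀ n f k → coef (f *ₚ X n) k ≡ coef (shift n f) k ℤ.- coef f k
coef-*X n f k = ≡.trans (coef-≡ (*X-≋ n f) k) (coef-- (shift n f) f k)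

coef-*X-+ : ∀ n f k → coef (f *ₚ X n) (n ℕ.+ k) ≡ coef f k ℤ.- coef f (n ℕ.+ k)
coef-*X-+ n f k = ≡.trans (coef-*X n f (n ℕ.+ k)) (≡.cong (ℤ._- coef f (n ℕ.+ k)) (coef-shift n f k))

-- The coefficients of f in a residue class modulo n are eventually constant, hence zero.
periodic⇒0 : ∀ n f j → 1 ≤ n → (∀ k → j ≤ k → coef f (n ℕ.+ k) ≡ coef f k) → ∀ k → j ≤ k → coef f k ≡ 0ℤ
periodic⇒0 n f j 1≤n per k j≤k = ≡.trans (≡.sym (steps (length f))) (coef-beyond f
  (ℕP.≤-trans (ℕP.≤-trans (ℕP.≤-reflexive (≡.sym (ℕP.*-identityʳ _))) (ℕP.*-monoʳ-≤ (length f) 1≤n)) (ℕP.m≤m+n _ k)))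
  where
  steps : ∀ i → coef f (i ℕ.* n ℕ.+ k) ≡ coef f k
  steps zero    = ≡.refl
  steps (suc i) = ≡.trans (≡.cong (coef f) (ℕP.+-assoc n (i ℕ.* n) k))
    (≡.trans (per (i ℕ.* n ℕ.+ k) (ℕP.≤-trans j≤k (ℕP.m≤n+m k (i ℕ.* n)))) (steps i))

-- From index n on, the coefficients of `f *ₚ X n` are differences of coefficients of f at distance
-- n, so their vanishing makes f periodic. This yields both the regularity of `X n` and the
-- uniqueness of remainders.
low*X≋0 : ∀ n f → 1 ≤ n → (∀ k → n ≤ k → coef (f *ₚ X n) k ≡ 0ℤ) → f ≋ []
low*X≋0 n f 1≤n low = coefwise λ k → periodic⇒0 n f 0 1≤n
  (λ k _ → ≡.sym (ℤP.i-j≡0⇒i≡j _ _ (≡.trans (≡.sym (coef-*X-+ n f k)) (low (n ℕ.+ k) (ℕP.m≤m+n n k))))) k z≤n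

∷ʳ-≋ : ∀ f a → f ∷ʳ a ≋ f +ₚ (a ·ₚ (q ^^ length f))
∷ʳ-≋ []      a = ∷-cong (≡.sym (ℤP.*-identityʳ a)) ≋-refl
∷ʳ-≋ (b ∷ f) a = ≋-trans (∷-cong (≡.sym (ℤP.+-identityʳ b)) (∷ʳ-≋ f a))
  (+ₚ-cong (≋-refl {b ∷ f}) (≋-trans (∷-cong (≡.sym (ℤP.*-zeroʳ a)) ≋-refl) (·ₚ-cong a (≋-sym (q*-≋ (q ^^ length f))))))

-- The remainder is padded to length exactly n, so that reversing the list later corresponds to the
-- substitution of q⁻¹ modulo q ^ n - 1 up to a fixed power of q.
record Division (n : ℕ) (f : Poly) : Set where
  field
    quot rem : Poly
    length-rem : length rem ≡ n
    f≋       : f ≋ quot *ₚ X n +ₚ rem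

-- Multiplying the remainder of f by q pushes its last coefficient l to q ^ (n + 1), which is
-- `X (suc n)` plus 1: l joins the quotient and wraps around to the constant coefficient.
divide : ∀ n f → Division (suc n) f
divide n [] = record
  { quot = [] ; rem = replicate (suc n) 0ℤ ; length-rem = ListP.length-replicate (suc n)
  ; f≋ = coefwise (λ k → ≡.sym (zeros (suc n) k)) }
  where
  zeros : ∀ n k → coef (replicate n 0ℤ) k ≡ 0ℤ
  zeros zero    k       = ≡.refl
  zeros (suc n) zero    = ≡.refl
  zeros (suc n) (suc k) = zeros n k
divide n (a ∷ f) = go (initLast rem) length-rem f≋
  where
  open Division (divide n f)
  open CommutativeRing polyRing using (+-congˡ; sym; refl)
  open SemiringSolver commutativeSemiring using (solve; _:=_; _:+_; _:*_)
  go : ∀ {r} → Data.List.InitLast r → length r ≡ suc n → f ≋ quot *ₚ X (suc n) +ₚ r → Division (suc n) (a ∷ f)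
  go Data.List.[] () eq
  go (i ∷ʳ′ l) len eq = record
    { quot = (0ℤ ∷ quot) +ₚ [ l ]
    ; rem  = (a ℤ.+ l) ∷ i
    ; length-rem = ≡.cong suc len-i
    ; f≋ = begin
        a ∷ f
          ≈⟨ ∷-cong (≡.sym (ℤP.+-identityʳ a)) eq ⟩
        [ a ] +ₚ (0ℤ ∷ (quot *ₚ X (suc n) +ₚ (i ∷ʳ l)))
          ≈⟨ +ₚ-cong (≋-refl {[ a ]}) (∷-cong ≡.refl (+ₚ-cong (≋-refl {quot *ₚ X (suc n)}) (∷ʳ-≋ i l))) ⟩
        [ a ] +ₚ ((0ℤ ∷ quot *ₚ X (suc n)) +ₚ ((0ℤ ∷ i) +ₚ (0ℤ ∷ (l ·ₚ (q ^^ length i)))))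
          ≈⟨ +ₚ-cong (≋-refl {[ a ]}) (+ₚ-cong (≋-sym (0∷-*ₚ quot (X (suc n)))) (+ₚ-cong (≋-refl {0ℤ ∷ i}) top)) ⟩
        [ a ] +ₚ ((0ℤ ∷ quot) *ₚ X (suc n) +ₚ ((0ℤ ∷ i) +ₚ ([ l ] *ₚ X (suc n) +ₚ [ l ])))
          ≈⟨ solve 6 (λ a Q X i L l → a :+ (Q :* X :+ (i :+ (L :* X :+ l))) := (Q :+ L) :* X :+ ((a :+ l) :+ i))
              refl [ a ] (0ℤ ∷ quot) (X (suc n)) (0ℤ ∷ i) [ l ] [ l ] ⟩
        ((0ℤ ∷ quot) +ₚ [ l ]) *ₚ X (suc n) +ₚ (([ a ] +ₚ [ l ]) +ₚ (0ℤ ∷ i))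
          ≈⟨ +-congˡ {((0ℤ ∷ quot) +ₚ [ l ]) *ₚ X (suc n)} (∷-cong (ℤP.+-identityʳ _) refl) ⟩
        ((0ℤ ∷ quot) +ₚ [ l ]) *ₚ X (suc n) +ₚ ((a ℤ.+ l) ∷ i) ∎ }
    where
    open SetoidReasoning ≋-setoid
    len-i : length i ≡ n
    len-i = ℕP.suc-injective (≡.trans (≡.trans (ℕP.+-comm 1 (length i)) (≡.sym (ListP.length-++ i))) len)
    [l]* : ∀ f → [ l ] *ₚ f ≋ l ·ₚ f
    [l]* f = ≋-trans (+ₚ-cong ≋-refl 0∷[]≋[]) (+ₚ-identityʳ _)
    top : 0ℤ ∷ (l ·ₚ (q ^^ length i)) ≋ [ l ] *ₚ X (suc n) +ₚ [ l ]
    top = begin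
      0ℤ ∷ (l ·ₚ (q ^^ length i))          ≈⟨ ∷-cong (≡.sym (ℤP.*-zeroʳ l)) refl ⟩
      l ·ₚ (0ℤ ∷ (q ^^ length i))          ≈⟨ ·ₚ-cong l (≋-sym (q*-≋ _)) ⟩
      l ·ₚ (q ^^ suc (length i))           ≈⟨ [l]* _ ⟨
      [ l ] *ₚ (q ^^ suc (length i))       ≡⟨ ≡.cong (λ j → [ l ] *ₚ (q ^^ suc j)) len-i ⟩
      [ l ] *ₚ (q ^^ suc n)                ≈⟨ *ₚ-congʳ [ l ] (Cyclotomic.X+1 polyRing q (suc n)) ⟨
      [ l ] *ₚ (X (suc n) +ₚ 1ₚ)           ≈⟨ *ₚ-distribˡ [ l ] (X (suc n)) 1ₚ ⟩
      [ l ] *ₚ X (suc n) +ₚ [ l ] *ₚ 1ₚ    ≈⟨ +-congˡ {[ l ] *ₚ X (suc n)} (≋-trans (*ₚ-comm [ l ] 1ₚ) (*ₚ-identityˡ [ l ])) ⟩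
      [ l ] *ₚ X (suc n) +ₚ [ l ]          ∎

open Multiples semiring using () renaming (_×_ to _·ℕ_)

coef-·ℕ : ∀ n f k → coef (n ·ℕ f) k ≡ + n ℤ.* coef f k
coef-·ℕ zero    f k = ≡.sym (ℤP.*-zeroˡ (coef f k))
coef-·ℕ (suc n) f k = ≡.trans (coef-+ f (n ·ℕ f) k) (≡.trans (≡.cong (λ y → coef f k ℤ.+ y) (coef-·ℕ n f k))
  (lem (coef f k) (+ n)))
  where
  lem : ∀ a n → a ℤ.+ n ℤ.* a ≡ (1ℤ ℤ.+ n) ℤ.* a
  lem = solve-∀

length-·ₚ : ∀ a f → length (a ·ₚ f) ≡ length f
length-·ₚ a []      = ≡.refl
length-·ₚ a (_ ∷ f) = ≡.cong suc (length-·ₚ a f)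

remainder≋0 : ∀ {n r} → 1 ≤ n → length r ≤ n → X n ∣ₚ r → r ≋ []
remainder≋0 {n} {r} 1≤n len (h , hX≋r) = ≋-trans (≋-sym hX≋r)
  (*ₚ-congˡ (X n) (low*X≋0 n h 1≤n (λ k n≤k → ≡.trans (coef-≡ hX≋r k) (coef-beyond r (ℕP.≤-trans len n≤k)))))

-- For torsion-freeness, let `X n` divide a positive multiple of y. The same multiple of the
-- remainder of y is then divisible by `X n` and too short to be nonzero; since ℤ has no torsion,
-- the remainder itself vanishes.
X-saturated : ∀ {n} → 1 ≤ n → Saturated (X n)
X-saturated {n@(suc n′)} 1≤n = record
  { regular     = λ y y*X≋0 → low*X≋0 n y 1≤n (λ k _ → coef-≡ y*X≋0 k)
  ; torsionFree = tf
  }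
  where
  tf : ∀ c y → X n ∣ₚ suc c ·ℕ y → X n ∣ₚ y
  tf c y X∣cy = quot , ≋-sym (≋-trans f≋ (≋-trans (+ₚ-cong (≋-refl {quot *ₚ X n}) rem≋0) (+ₚ-identityʳ _)))
    where
    open Division (divide n′ y)
    module D = Divisors polyRing
    open CommutativeRing polyRing using (sym; trans)
    c-rem : Poly
    c-rem = + suc c ·ₚ rem
    split : suc c ·ℕ y ≋ (+ suc c ·ₚ quot) *ₚ X n +ₚ c-rem
    split = coefwise λ k → begin
      coef (suc c ·ℕ y) k                                          ≡⟨ coef-·ℕ (suc c) y k ⟩
      + suc c ℤ.* coef y k                                         ≡⟨ ≡.cong (+ suc c ℤ.*_) (≡.trans (coef-≡ f≋ k) (coef-+ (quot *ₚ X n) rem k)) ⟩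
      + suc c ℤ.* (coef (quot *ₚ X n) k ℤ.+ coef rem k)            ≡⟨ ℤP.*-distribˡ-+ (+ suc c) (coef (quot *ₚ X n) k) _ ⟩
      + suc c ℤ.* coef (quot *ₚ X n) k ℤ.+ + suc c ℤ.* coef rem k
        ≡⟨ ≡.cong₂ ℤ._+_ (≡.sym (≡.trans (coef-≡ (·ₚ-*ₚ (+ suc c) quot (X n)) k) (coef-· (+ suc c) (quot *ₚ X n) k)))
                         (≡.sym (coef-· (+ suc c) rem k)) ⟩
      coef ((+ suc c ·ₚ quot) *ₚ X n) k ℤ.+ coef c-rem k           ≡⟨ coef-+ ((+ suc c ·ₚ quot) *ₚ X n) c-rem k ⟨
      coef ((+ suc c ·ₚ quot) *ₚ X n +ₚ c-rem) k                   ∎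
      where open ≡.≡-Reasoning
    c-rem≋0 : c-rem ≋ []
    c-rem≋0 = remainder≋0 1≤n (ℕP.≤-reflexive (≡.trans (length-·ₚ (+ suc c) rem) length-rem))
      (D.∣-minus {a = (+ suc c ·ₚ quot) *ₚ X n} {b = c-rem}
        (Divisibility.∣ʳ-respʳ-≈ *-commutativeSemigroup split X∣cy) ((+ suc c ·ₚ quot) , ≋-refl))
    rem≋0 : rem ≋ []
    rem≋0 = coefwise λ k → ℤP.*-cancelˡ-≡ (+ suc c) (coef rem k) 0ℤ
      (≡.trans (≡.sym (coef-· (+ suc c) rem k)) (≡.trans (coef-≡ c-rem≋0 k) (≡.sym (ℤP.*-zeroʳ (+ suc c)))))

-- ℤ[q]/(q ^ m - 1) is reduced

-- Horner's rule for substituting y for q.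
compose : Poly → Poly → Poly
compose y []      = []
compose y (a ∷ f) = [ a ] +ₚ y *ₚ compose y f

constant-*ₚ : ∀ a f → [ a ] *ₚ f ≋ a ·ₚ f
constant-*ₚ a f = ≋-trans (+ₚ-cong (≋-refl {a ·ₚ f}) 0∷[]≋[]) (+ₚ-identityʳ _)

constant+ₚ : ∀ a f → [ a ] +ₚ (0ℤ ∷ f) ≋ a ∷ f
constant+ₚ a f = ∷-cong (ℤP.+-identityʳ a) ≋-refl

module _ (y : Poly) where
  open CommutativeRing polyRing using (setoid; refl; sym; trans)
  open SemiringSolver (CommutativeRing.commutativeSemiring polyRing) using (solve; _:=_; _:+_; _:*_)
  open SetoidReasoning setoid

  compose-0 : ∀ {f} → f ≋ [] → compose y f ≋ []
  compose-0 {[]}    f≋0 = refl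
  compose-0 {a ∷ f} f≋0 = trans (+ₚ-cong (∷-cong (coef-≡ f≋0 0) refl) (*ₚ-congʳ y (compose-0 {f} (coefwise λ k → coef-≡ f≋0 (suc k)))))
    (trans (+ₚ-cong 0∷[]≋[] (*ₚ-zeroʳ y)) refl)

  compose-cong : ∀ {f g} → f ≋ g → compose y f ≋ compose y g
  compose-cong {[]}    {g}     f≋g = sym (compose-0 (sym f≋g))
  compose-cong {a ∷ f} {[]}    f≋g = compose-0 f≋g
  compose-cong {a ∷ f} {b ∷ g} f≋g = +ₚ-cong (∷-cong (coef-≡ f≋g 0) refl)
    (*ₚ-congʳ y (compose-cong {f} {g} (coefwise λ k → coef-≡ f≋g (suc k))))

  compose-+ : ∀ f g → compose y (f +ₚ g) ≋ compose y f +ₚ compose y g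
  compose-+ []      g       = refl
  compose-+ (a ∷ f) []      = sym (+ₚ-identityʳ _)
  compose-+ (a ∷ f) (b ∷ g) = begin
    [ a ℤ.+ b ] +ₚ y *ₚ compose y (f +ₚ g)                       ≈⟨ +ₚ-cong (refl {[ a ] +ₚ [ b ]}) (*ₚ-congʳ y (compose-+ f g)) ⟩
    ([ a ] +ₚ [ b ]) +ₚ y *ₚ (compose y f +ₚ compose y g)        ≈⟨ solve 5 (λ a b y F G → (a :+ b) :+ y :* (F :+ G) := (a :+ y :* F) :+ (b :+ y :* G))
                                                                    refl [ a ] [ b ] y (compose y f) (compose y g) ⟩
    ([ a ] +ₚ y *ₚ compose y f) +ₚ ([ b ] +ₚ y *ₚ compose y g)   ∎

  compose-· : ∀ c f → compose y (c ·ₚ f) ≋ c ·ₚ compose y f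
  compose-· c []      = refl
  compose-· c (a ∷ f) = begin
    [ c ℤ.* a ] +ₚ y *ₚ compose y (c ·ₚ f)             ≈⟨ +ₚ-cong (sym (constant-*ₚ c [ a ])) (*ₚ-congʳ y (trans (compose-· c f) (sym (constant-*ₚ c _)))) ⟩
    [ c ] *ₚ [ a ] +ₚ y *ₚ ([ c ] *ₚ compose y f)      ≈⟨ solve 4 (λ c a y F → c :* a :+ y :* (c :* F) := c :* (a :+ y :* F)) refl [ c ] [ a ] y (compose y f) ⟩
    [ c ] *ₚ ([ a ] +ₚ y *ₚ compose y f)               ≈⟨ constant-*ₚ c _ ⟩
    c ·ₚ ([ a ] +ₚ y *ₚ compose y f)                   ∎

  compose-* : ∀ f g → compose y (f *ₚ g) ≋ compose y f *ₚ compose y g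
  compose-* []      g = refl
  compose-* (a ∷ f) g = begin
    compose y (a ·ₚ g +ₚ (0ℤ ∷ f *ₚ g))                                  ≈⟨ compose-+ (a ·ₚ g) (0ℤ ∷ f *ₚ g) ⟩
    compose y (a ·ₚ g) +ₚ ([ 0ℤ ] +ₚ y *ₚ compose y (f *ₚ g))             ≈⟨ +ₚ-cong (trans (compose-· a g) (sym (constant-*ₚ a _)))
                                                                            (+ₚ-cong 0∷[]≋[] (*ₚ-congʳ y (compose-* f g))) ⟩
    [ a ] *ₚ compose y g +ₚ y *ₚ (compose y f *ₚ compose y g)            ≈⟨ solve 4 (λ a y F G → a :* G :+ y :* (F :* G) := (a :+ y :* F) :* G)
                                                                            refl [ a ] y (compose y f) (compose y g) ⟩
    ([ a ] +ₚ y *ₚ compose y f) *ₚ compose y g                           ∎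

  compose-const : ∀ a → compose y [ a ] ≋ [ a ]
  compose-const a = trans (+ₚ-cong (refl {[ a ]}) (*ₚ-zeroʳ y)) (+ₚ-identityʳ _)

  compose-^ : ∀ f n → compose y (f ^^ n) ≋ compose y f ^^ n
  compose-^ f zero    = compose-const 1ℤ
  compose-^ f (suc n) = trans (compose-* f (f ^^ n)) (*ₚ-congʳ (compose y f) (compose-^ f n))

  compose-q : compose y q ≋ y
  compose-q = trans (+ₚ-cong 0∷[]≋[] (trans (*ₚ-congʳ y (compose-const 1ℤ)) (trans (*ₚ-comm y 1ₚ) (*ₚ-identityˡ y)))) refl

sumSquares : Poly → ℤ
sumSquares []      = 0ℤ
sumSquares (a ∷ f) = a ℤ.* a ℤ.+ sumSquares f

0≤a² : ∀ a → 0ℤ ℤ.≤ a ℤ.* a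
0≤a² (+ n)    = ≡.subst (0ℤ ℤ.≤_) (ℤP.pos-* n n) (ℤ.+≤+ z≤n)
0≤a² -[1+ n ] = ℤ.+≤+ z≤n

sumSquares≥0 : ∀ f → 0ℤ ℤ.≤ sumSquares f
sumSquares≥0 []      = ℤP.≤-refl
sumSquares≥0 (a ∷ f) = ℤP.+-mono-≤ (0≤a² a) (sumSquares≥0 f)

sumSquares≡0 : ∀ f → sumSquares f ≡ 0ℤ → f ≋ []
sumSquares≡0 []      _  = ≋-refl
sumSquares≡0 (a ∷ f) eq = ≋-trans (∷-cong a≡0 (sumSquares≡0 f rest≡0)) 0∷[]≋[]
  where
  a²≡0 : a ℤ.* a ≡ 0ℤ
  a²≡0 = ℤP.≤-antisym (ℤP.≤-trans (ℤP.≤-reflexive (≡.sym (ℤP.+-identityʳ _)))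
    (ℤP.≤-trans (ℤP.+-monoʳ-≤ (a ℤ.* a) (sumSquares≥0 f)) (ℤP.≤-reflexive eq))) (0≤a² a)
  a≡0 : a ≡ 0ℤ
  a≡0 with ℤP.i*j≡0⇒i≡0∨j≡0 a a²≡0
  ... | inj₁ p = p
  ... | inj₂ p = p
  rest≡0 : sumSquares f ≡ 0ℤ
  rest≡0 = ≡.trans (≡.sym (ℤP.+-identityˡ _)) (≡.trans (≡.cong (ℤ._+ sumSquares f) (≡.sym a²≡0)) eq)

coef-++ : ∀ f (g : Poly) k → coef (f ++ g) (length f ℕ.+ k) ≡ coef g k
coef-++ []      g k = ≡.refl
coef-++ (a ∷ f) g k = coef-++ f g k

-- At this index each coefficient of f meets itself. The prepended zero shifts degrees by one, which
-- makes the index `length f` correct for the empty list too; g is general because peeling the head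
-- off f leaves it at the end of the reversed tail.
coef-*-reverse : ∀ f g → coef ((0ℤ ∷ f) *ₚ (reverse f ++ g)) (length f) ≡ sumSquares f
coef-*-reverse []      g = ≡.trans (coef-*-zero 0ℤ [] g) (ℤP.*-zeroˡ (coef g 0))
coef-*-reverse (a ∷ f) g rewrite ListP.unfold-reverse a f | ListP.++-assoc (reverse f) [ a ] g = begin
  coef ((0ℤ ∷ a ∷ f) *ₚ G) (suc n)                                ≡⟨ coef-*-suc 0ℤ (a ∷ f) G n ⟩
  0ℤ ℤ.* coef G (suc n) ℤ.+ coef ((a ∷ f) *ₚ G) n                 ≡⟨ ℤP.+-identityˡ _ ⟩
  coef ((a ∷ f) *ₚ G) n                                           ≡⟨ coef-≡ (*ₚ-congˡ G (∷-cong (≡.sym (ℤP.+-identityʳ a)) (≋-refl {f}))) n ⟩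
  coef (([ a ] +ₚ (0ℤ ∷ f)) *ₚ G) n                               ≡⟨ coef-≡ (*ₚ-distribʳ G [ a ] (0ℤ ∷ f)) n ⟩
  coef ([ a ] *ₚ G +ₚ (0ℤ ∷ f) *ₚ G) n                            ≡⟨ coef-+ ([ a ] *ₚ G) _ n ⟩
  coef ([ a ] *ₚ G) n ℤ.+ coef ((0ℤ ∷ f) *ₚ G) n                  ≡⟨ ≡.cong₂ ℤ._+_ head (coef-*-reverse f (a ∷ g)) ⟩
  a ℤ.* a ℤ.+ sumSquares f                                        ∎
  where
  open ≡.≡-Reasoning
  n = length f
  G = reverse f ++ a ∷ g
  head : coef ([ a ] *ₚ G) n ≡ a ℤ.* a
  head = ≡.trans (coef-≡ (constant-*ₚ a G) n) (≡.trans (coef-· a G n) (≡.cong (a ℤ.*_)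
    (≡.trans (≡.cong (coef G) (≡.sym (≡.trans (ℕP.+-identityʳ _) (ListP.length-reverse f)))) (coef-++ (reverse f) (a ∷ g) 0))))

length-+ₚ : ∀ f g {n} → length f ≤ n → length g ≤ n → length (f +ₚ g) ≤ n
length-+ₚ []      g       f≤n       g≤n       = g≤n
length-+ₚ (a ∷ f) []      f≤n       g≤n       = f≤n
length-+ₚ (a ∷ f) (b ∷ g) (s≤s f≤n) (s≤s g≤n) = s≤s (length-+ₚ f g f≤n g≤n)

length-*ₚ : ∀ f g {n} → length g ≤ suc n → length (f *ₚ g) ≤ length f ℕ.+ n
length-*ₚ []      g {n} g≤n = z≤n
length-*ₚ (a ∷ f) g {n} g≤n = length-+ₚ (a ·ₚ g) (0ℤ ∷ f *ₚ g)
  (ℕP.≤-trans (ℕP.≤-reflexive (length-·ₚ a g)) (ℕP.≤-trans g≤n (s≤s (ℕP.m≤n+m n (length f))))) (s≤s (length-*ₚ f g g≤n))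

-- If the product is t (q ^ m - 1), its coefficient at m, the sum of squares, is the difference of
-- the coefficients of t at 0 and m. The former vanishes since the product has no constant term; the
-- latter since the product has degree below 2m, which makes t periodic, hence zero, from m on.
∣-self-reverse⇒≋0 : ∀ {m r} → length r ≡ m → 1 ≤ m → X m ∣ₚ (0ℤ ∷ r) *ₚ reverse r → r ≋ []
∣-self-reverse⇒≋0 {m@(suc m′)} {r} len 1≤m (t , tX≋) = sumSquares≡0 r (begin
  sumSquares r                                     ≡⟨ coef-*-reverse r [] ⟨
  coef ((0ℤ ∷ r) *ₚ (reverse r ++ [])) (length r)  ≡⟨ ≡.cong (λ f → coef ((0ℤ ∷ r) *ₚ f) (length r)) (ListP.++-identityʳ (reverse r)) ⟩
  coef ((0ℤ ∷ r) *ₚ reverse r) (length r)          ≡⟨ ≡.cong (coef ((0ℤ ∷ r) *ₚ reverse r)) (≡.trans len (≡.sym (ℕP.+-identityʳ m))) ⟩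
  coef ((0ℤ ∷ r) *ₚ reverse r) (m ℕ.+ 0)           ≡⟨ coef-≡ tX≋ (m ℕ.+ 0) ⟨
  coef (t *ₚ X m) (m ℕ.+ 0)                        ≡⟨ coef-*X-+ m t 0 ⟩
  coef t 0 ℤ.- coef t (m ℕ.+ 0)                    ≡⟨ ≡.cong₂ ℤ._-_ t0≡0 tm≡0 ⟩
  0ℤ                                               ∎)
  where
  open ≡.≡-Reasoning
  bound : length (r *ₚ reverse r) ≤ m ℕ.+ m′
  bound = ℕP.≤-trans (length-*ₚ r (reverse r) {m′} (ℕP.≤-reflexive (≡.trans (ListP.length-reverse r) len)))
    (ℕP.≤-reflexive (≡.cong (ℕ._+ m′) len))
  high : ∀ k → m ≤ k → coef ((0ℤ ∷ r) *ₚ reverse r) (m ℕ.+ k) ≡ 0ℤ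
  high k m≤k = ≡.trans (coef-≡ (0∷-*ₚ r (reverse r)) (m ℕ.+ k)) (coef-beyond (r *ₚ reverse r)
    (ℕP.≤-trans bound (ℕP.≤-trans (ℕP.≤-reflexive (ℕP.+-comm m m′)) (ℕP.+-monoʳ-≤ m′ m≤k))))
  tm≡0 : coef t (m ℕ.+ 0) ≡ 0ℤ
  tm≡0 = periodic⇒0 m t m 1≤m (λ k m≤k → ≡.sym (ℤP.i-j≡0⇒i≡j _ _
    (≡.trans (≡.sym (coef-*X-+ m t k)) (≡.trans (coef-≡ tX≋ (m ℕ.+ k)) (high k m≤k))))) (m ℕ.+ 0) (ℕP.m≤m+n m 0)
  t0≡0 : coef t 0 ≡ 0ℤ
  t0≡0 = ≡.trans (lem (coef t 0)) (≡.cong ℤ.-_ (≡.trans (≡.sym (coef-*X m t 0))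
    (≡.trans (coef-≡ tX≋ 0) (coef-≡ (0∷-*ₚ r (reverse r)) 0))))
    where
    lem : ∀ a → a ≡ ℤ.- (0ℤ ℤ.- a)
    lem = solve-∀

-- The involution f ↦ f(q⁻¹) of ℤ[q]/(q ^ m - 1), with q⁻¹ = q ^ (m - 1).
module Involution (m′ : ℕ) where
  m = suc m′
  open CommutativeRing (quotientRing polyRing (X m))
  open SemiringSolver (CommutativeRing.commutativeSemiring (quotientRing polyRing (X m))) using (solve; _:=_; _:+_; _:*_)
  open SetoidReasoning setoid
  infix 4 _≈ₘ_
  _≈ₘ_ = _≈_

  q⁻¹ : Poly
  q⁻¹ = q ^^ m′

  infix 9 _⋆
  _⋆ : Poly → Poly
  f ⋆ = compose q⁻¹ f

  *-congᶠ : ∀ h {f g} → f ≈ₘ g → h *ₚ f ≈ₘ h *ₚ g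
  *-congᶠ h f≈g = *-cong (refl {h}) f≈g

  lift : ∀ {f g} → f ≋ g → f ≈ₘ g
  lift = ≈⇒≈mod polyRing (X m)

  ^^-cong : ∀ {f g} n → f ≈ₘ g → f ^^ n ≈ₘ g ^^ n
  ^^-cong zero    f≈g = refl
  ^^-cong (suc n) f≈g = *-cong f≈g (^^-cong n f≈g)

  X≈0 : X m ≈ₘ []
  X≈0 = congruent 1ₚ (≋-sym (*ₚ-identityˡ (X m)))

  q*q⁻¹ : q *ₚ q⁻¹ ≈ₘ 1ₚ
  q*q⁻¹ = trans (lift (≋-sym (Cyclotomic.X+1 polyRing q m))) (trans (+-congʳ X≈0) (+-identityˡ 1ₚ))

  q^m≈1 : q ^^ m ≈ₘ 1ₚ
  q^m≈1 = q*q⁻¹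

  q⁻¹^m≈1 : q⁻¹ ^^ m ≈ₘ 1ₚ
  q⁻¹^m≈1 = begin
    (q ^^ m′) ^^ m        ≈⟨ lift (Exp.^-assocʳ (CommutativeRing.commutativeSemiring polyRing) q m′ m) ⟩
    q ^^ (m′ ℕ.* m)        ≡⟨ ≡.cong (q ^^_) (ℕP.*-comm m′ m) ⟩
    q ^^ (m ℕ.* m′)        ≈⟨ lift (Exp.^-assocʳ (CommutativeRing.commutativeSemiring polyRing) q m m′) ⟨
    (q ^^ m) ^^ m′        ≈⟨ ^^-cong m′ q^m≈1 ⟩
    1ₚ ^^ m′               ≈⟨ one m′ ⟩
    1ₚ                      ∎
    where
    one : ∀ n → 1ₚ ^^ n ≈ₘ 1ₚ
    one zero    = refl
    one (suc n) = trans (*-identityˡ _) (one n)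

  q⁻¹⋆≈q : q⁻¹ ⋆ ≈ₘ q
  q⁻¹⋆≈q = begin
    q⁻¹ ⋆                              ≈⟨ lift (compose-^ q⁻¹ q m′) ⟩
    (q ⋆) ^^ m′                       ≈⟨ ^^-cong m′ (lift (compose-q q⁻¹)) ⟩
    q⁻¹ ^^ m′                         ≈⟨ *-identityˡ _ ⟨
    1ₚ *ₚ (q⁻¹ ^^ m′)                 ≈⟨ *-congʳ q*q⁻¹ ⟨
    q *ₚ q⁻¹ *ₚ (q⁻¹ ^^ m′)           ≈⟨ *-assoc q q⁻¹ _ ⟩
    q *ₚ (q⁻¹ ^^ m)                   ≈⟨ *-congᶠ q q⁻¹^m≈1 ⟩
    q *ₚ 1ₚ                            ≈⟨ *-identityʳ q ⟩
    q                                  ∎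

  fromCoefs : ∀ a f → a ∷ f ≈ₘ [ a ] +ₚ q *ₚ f
  fromCoefs a f = lift (≋-trans (≋-sym (constant+ₚ a f)) (+ₚ-cong (≋-refl {[ a ]}) (≋-sym (q*-≋ f))))

  ⋆-involutive : ∀ f → (f ⋆) ⋆ ≈ₘ f
  ⋆-involutive []      = refl
  ⋆-involutive (a ∷ f) = begin
    ([ a ] +ₚ q⁻¹ *ₚ f ⋆) ⋆          ≈⟨ lift (compose-+ q⁻¹ [ a ] (q⁻¹ *ₚ f ⋆)) ⟩
    [ a ] ⋆ +ₚ (q⁻¹ *ₚ f ⋆) ⋆        ≈⟨ +-cong (lift (compose-const q⁻¹ a)) (lift (compose-* q⁻¹ q⁻¹ (f ⋆))) ⟩
    [ a ] +ₚ q⁻¹ ⋆ *ₚ (f ⋆) ⋆        ≈⟨ +-congˡ (*-cong q⁻¹⋆≈q (⋆-involutive f)) ⟩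
    [ a ] +ₚ q *ₚ f                  ≈⟨ fromCoefs a f ⟨
    a ∷ f                            ∎

  X⋆≈0 : X m ⋆ ≈ₘ []
  X⋆≈0 = begin
    X m ⋆                                       ≈⟨ lift (compose-+ q⁻¹ (q ^^ m) (ℤ.- 1ℤ ·ₚ 1ₚ)) ⟩
    (q ^^ m) ⋆ +ₚ (ℤ.- 1ℤ ·ₚ 1ₚ) ⋆              ≈⟨ +-cong (lift (compose-^ q⁻¹ q m)) (lift (compose-const q⁻¹ (ℤ.- 1ℤ))) ⟩
    ((q ⋆) ^^ m) +ₚ (ℤ.- 1ℤ ·ₚ 1ₚ)             ≈⟨ +-congʳ (trans (^^-cong m (lift (compose-q q⁻¹))) q⁻¹^m≈1) ⟩
    1ₚ +ₚ (ℤ.- 1ℤ ·ₚ 1ₚ)                        ≈⟨ -‿inverseʳ 1ₚ ⟩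
    []                                          ∎

  ⋆-cong : ∀ {f g} → f ≈ₘ g → f ⋆ ≈ₘ g ⋆
  ⋆-cong {f} {g} (congruent k eq) = begin
    f ⋆                          ≈⟨ lift (compose-cong q⁻¹ eq) ⟩
    (g +ₚ k *ₚ X m) ⋆            ≈⟨ lift (compose-+ q⁻¹ g (k *ₚ X m)) ⟩
    g ⋆ +ₚ (k *ₚ X m) ⋆          ≈⟨ +-congˡ (trans (lift (compose-* q⁻¹ k (X m))) (trans (*-congᶠ (k ⋆) X⋆≈0) (zeroʳ (k ⋆)))) ⟩
    g ⋆ +ₚ []                    ≈⟨ +-identityʳ _ ⟩
    g ⋆                          ∎

  -- Reversal is f(q⁻¹) times q ^ (length f - 1); one more factor q on both sides avoids the
  -- subtraction for the empty list.
  reverse-⋆ : ∀ f → (q ^^ length f) *ₚ f ⋆ ≈ₘ q *ₚ reverse f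
  reverse-⋆ []      = trans (*-identityˡ []) (sym (zeroʳ q))
  reverse-⋆ (a ∷ f) = begin
    q *ₚ (q ^^ n) *ₚ ([ a ] +ₚ q⁻¹ *ₚ f ⋆)
      ≈⟨ solve 5 (λ q p a y F → q :* p :* (a :+ y :* F) := (q :* y) :* (p :* F) :+ q :* (a :* p)) refl q (q ^^ n) [ a ] q⁻¹ (f ⋆) ⟩
    q *ₚ q⁻¹ *ₚ ((q ^^ n) *ₚ f ⋆) +ₚ q *ₚ ([ a ] *ₚ (q ^^ n))
      ≈⟨ +-congʳ (trans (*-cong q*q⁻¹ (reverse-⋆ f)) (*-identityˡ _)) ⟩
    q *ₚ reverse f +ₚ q *ₚ ([ a ] *ₚ (q ^^ n))
      ≈⟨ distribˡ q (reverse f) _ ⟨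
    q *ₚ (reverse f +ₚ [ a ] *ₚ (q ^^ n))
      ≡⟨ ≡.cong (λ j → q *ₚ (reverse f +ₚ [ a ] *ₚ (q ^^ j))) (≡.sym (ListP.length-reverse f)) ⟩
    q *ₚ (reverse f +ₚ [ a ] *ₚ (q ^^ length (reverse f)))
      ≈⟨ *-congᶠ q (+-cong (refl {reverse f}) (lift (constant-*ₚ a (q ^^ length (reverse f))))) ⟩
    q *ₚ (reverse f +ₚ (a ·ₚ (q ^^ length (reverse f))))
      ≈⟨ *-congᶠ q (lift (≋-sym (∷ʳ-≋ (reverse f) a))) ⟩
    q *ₚ (reverse f ∷ʳ a)
      ≡⟨ ≡.cong (q *ₚ_) (ListP.unfold-reverse a f) ⟨
    q *ₚ reverse (a ∷ f) ∎
    where n = length f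

  ≈0⇒∣ : ∀ {f} → f ≈ₘ [] → X m ∣ₚ f
  ≈0⇒∣ (congruent k eq) = k , ≋-sym eq

  ∣⇒≈0 : ∀ {f} → X m ∣ₚ f → f ≈ₘ []
  ∣⇒≈0 (k , eq) = congruent k (≋-sym eq)

  -- Definiteness of the form f ↦ f f⋆: with r the remainder of f, the product r r⋆ is q r times the
  -- reversal of r, one of whose coefficients is the sum of the squares of the coefficients of r.
  *⋆≈0⇒≈0 : ∀ f → f *ₚ f ⋆ ≈ₘ [] → f ≈ₘ []
  *⋆≈0⇒≈0 f ff⋆≈0 = trans f≈r (lift r≋0)
    where
    open Division (divide m′ f) renaming (rem to r)
    f≈r : f ≈ₘ r
    f≈r = congruent quot (≋-trans f≋ (+ₚ-comm _ r))
    r≋0 : r ≋ []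
    r≋0 = ∣-self-reverse⇒≋0 length-rem (s≤s z≤n) (≈0⇒∣ (begin
      (0ℤ ∷ r) *ₚ reverse r             ≈⟨ *-congʳ (lift (≋-sym (q*-≋ r))) ⟩
      q *ₚ r *ₚ reverse r               ≈⟨ solve 3 (λ q r s → q :* r :* s := r :* (q :* s)) refl q r (reverse r) ⟩
      r *ₚ (q *ₚ reverse r)             ≈⟨ *-congᶠ r (reverse-⋆ r) ⟨
      r *ₚ ((q ^^ length r) *ₚ r ⋆)    ≡⟨ ≡.cong (λ n → r *ₚ ((q ^^ n) *ₚ r ⋆)) length-rem ⟩
      r *ₚ ((q ^^ m) *ₚ r ⋆)           ≈⟨ *-congᶠ r (trans (*-cong q^m≈1 (refl {r ⋆})) (*-identityˡ (r ⋆))) ⟩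
      r *ₚ r ⋆                          ≈⟨ *-cong f≈r (⋆-cong f≈r) ⟨
      f *ₚ f ⋆                          ≈⟨ ff⋆≈0 ⟩
      []                                ∎))

  -- With g = f f⋆ = g⋆, nilpotency of f gives g g⋆ = 0, hence g = 0 and f = 0.
  square≈0⇒≈0 : ∀ f → f *ₚ f ≈ₘ [] → f ≈ₘ []
  square≈0⇒≈0 f ff≈0 = *⋆≈0⇒≈0 f (*⋆≈0⇒≈0 (f *ₚ f ⋆) (begin
    f *ₚ f ⋆ *ₚ (f *ₚ f ⋆) ⋆              ≈⟨ *-congᶠ (f *ₚ f ⋆) (lift (compose-* q⁻¹ f (f ⋆))) ⟩
    f *ₚ f ⋆ *ₚ (f ⋆ *ₚ (f ⋆) ⋆)          ≈⟨ *-congᶠ (f *ₚ f ⋆) (*-congᶠ (f ⋆) (⋆-involutive f)) ⟩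
    f *ₚ f ⋆ *ₚ (f ⋆ *ₚ f)                ≈⟨ solve 2 (λ f g → f :* g :* (g :* f) := f :* f :* (g :* g)) refl f (f ⋆) ⟩
    f *ₚ f *ₚ (f ⋆ *ₚ f ⋆)                ≈⟨ *-congʳ ff≈0 ⟩
    [] *ₚ (f ⋆ *ₚ f ⋆)                    ≈⟨ zeroˡ (f ⋆ *ₚ f ⋆) ⟩
    []                                    ∎))

X-reduced : ∀ {m} f → 1 ≤ m → X m ∣ₚ f *ₚ f → X m ∣ₚ f
X-reduced {suc m} f _ X∣ff = ≈0⇒∣ (square≈0⇒≈0 f (∣⇒≈0 X∣ff))
  where open Involution m

-- Finite sums, counting and the divisor sum of the totient.

∑ : ℕ → (ℕ → ℕ) → ℕ
∑ zero    F = 0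
∑ (suc n) F = ∑ n F ℕ.+ F (suc n)

∑-cong : ∀ n {F G} → (∀ k → 1 ≤ k → k ≤ n → F k ≡ G k) → ∑ n F ≡ ∑ n G
∑-cong zero    eq = ≡.refl
∑-cong (suc n) eq = ≡.cong₂ ℕ._+_ (∑-cong n (λ k 1≤k k≤n → eq k 1≤k (ℕP.m≤n⇒m≤1+n k≤n))) (eq (suc n) (s≤s z≤n) ℕP.≤-refl)

∑-0 : ∀ n {F} → (∀ k → 1 ≤ k → k ≤ n → F k ≡ 0) → ∑ n F ≡ 0
∑-0 zero    eq = ≡.refl
∑-0 (suc n) eq = ≡.cong₂ ℕ._+_ (∑-0 n (λ k 1≤k k≤n → eq k 1≤k (ℕP.m≤n⇒m≤1+n k≤n))) (eq (suc n) (s≤s z≤n) ℕP.≤-refl)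

∑-+ : ∀ n F G → ∑ n (λ k → F k ℕ.+ G k) ≡ ∑ n F ℕ.+ ∑ n G
∑-+ zero    F G = ≡.refl
∑-+ (suc n) F G = ≡.trans (≡.cong (ℕ._+ (F (suc n) ℕ.+ G (suc n))) (∑-+ n F G)) (lem (∑ n F) (∑ n G) (F (suc n)) (G (suc n)))
  where
  lem : ∀ a b c d → a ℕ.+ b ℕ.+ (c ℕ.+ d) ≡ a ℕ.+ c ℕ.+ (b ℕ.+ d)
  lem = ℕR.solve-∀

∑-at : ∀ {m} n → 1 ≤ m → m ≤ n → ∑ n (1 at m) ≡ 1
∑-at {m} zero    1≤m m≤0 = contradiction m≤0 (ℕP.<⇒≱ 1≤m)
∑-at {m} (suc n) 1≤m m≤1+n with ℕP.m≤n⇒m<n∨m≡n m≤1+n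
... | inj₁ (s≤s m≤n) = ≡.cong₂ ℕ._+_ (∑-at n 1≤m m≤n) (at-other 1 (ℕP.>⇒≢ (s≤s m≤n)))
... | inj₂ ≡.refl    = ≡.cong₂ ℕ._+_ (∑-0 n (λ k _ k≤n → at-other 1 (ℕP.<⇒≢ (s≤s k≤n)))) (at-self 1 (suc n))

bit : Bool → ℕ
bit b = if b then 1 else 0

countBelow-cong : ∀ n {P Q} → (∀ k → k < n → P k ≡ Q k) → countBelow n P ≡ countBelow n Q
countBelow-cong zero    eq = ≡.refl
countBelow-cong (suc n) eq = ≡.cong₂ (λ c b → c ℕ.+ bit b) (countBelow-cong n (λ k k<n → eq k (ℕP.m<n⇒m<1+n k<n))) (eq n ℕP.≤-refl)

countBelow-false : ∀ n {P} → (∀ k → k < n → P k ≡ false) → countBelow n P ≡ 0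
countBelow-false zero    eq = ≡.refl
countBelow-false (suc n) eq = ≡.cong₂ (λ c b → c ℕ.+ bit b) (countBelow-false n (λ k k<n → eq k (ℕP.m<n⇒m<1+n k<n))) (eq n ℕP.≤-refl)

countBelow-+ : ∀ m n P → countBelow (m ℕ.+ n) P ≡ countBelow m P ℕ.+ countBelow n (λ k → P (m ℕ.+ k))
countBelow-+ m zero    P = ≡.trans (≡.cong (λ k → countBelow k P) (ℕP.+-identityʳ m)) (≡.sym (ℕP.+-identityʳ _))
countBelow-+ m (suc n) P = begin
  countBelow (m ℕ.+ suc n) P                                              ≡⟨ ≡.cong (λ k → countBelow k P) (ℕP.+-suc m n) ⟩
  countBelow (m ℕ.+ n) P ℕ.+ bit (P (m ℕ.+ n))                            ≡⟨ ≡.cong (ℕ._+ bit (P (m ℕ.+ n))) (countBelow-+ m n P) ⟩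
  countBelow m P ℕ.+ countBelow n (λ k → P (m ℕ.+ k)) ℕ.+ bit (P (m ℕ.+ n)) ≡⟨ ℕP.+-assoc (countBelow m P) _ _ ⟩
  countBelow m P ℕ.+ countBelow (suc n) (λ k → P (m ℕ.+ k))               ∎
  where open ≡.≡-Reasoning

countBelow-head : ∀ n {P} → 1 ≤ n → (∀ k → 1 ≤ k → k < n → P k ≡ false) → countBelow n P ≡ bit (P 0)
countBelow-head (suc n) {P} _ eq = ≡.trans (countBelow-+ 1 n P)
  (≡.trans (≡.cong (bit (P 0) ℕ.+_) (countBelow-false n (λ k k<n → eq (suc k) (s≤s z≤n) (s≤s k<n)))) (ℕP.+-identityʳ _))

countBelow-multiples : ∀ k e {P} → 1 ≤ e → (∀ j → P j ≡ true → e ∣ℕ j) →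
  countBelow (k ℕ.* e) P ≡ countBelow k (λ i → P (i ℕ.* e))
countBelow-multiples zero    e 1≤e P⇒ = ≡.refl
countBelow-multiples (suc k) e {P} 1≤e P⇒ = begin
  countBelow (e ℕ.+ k ℕ.* e) P                                              ≡⟨ ≡.cong (λ n → countBelow n P) (ℕP.+-comm e _) ⟩
  countBelow (k ℕ.* e ℕ.+ e) P                                              ≡⟨ countBelow-+ (k ℕ.* e) e P ⟩
  countBelow (k ℕ.* e) P ℕ.+ countBelow e (λ i → P (k ℕ.* e ℕ.+ i))         ≡⟨ ≡.cong₂ ℕ._+_ (countBelow-multiples k e 1≤e P⇒)
                                                                              (countBelow-head e 1≤e not) ⟩
  countBelow k (λ i → P (i ℕ.* e)) ℕ.+ bit (P (k ℕ.* e ℕ.+ 0))              ≡⟨ ≡.cong (λ n → countBelow k (λ i → P (i ℕ.* e)) ℕ.+ bit (P n)) (ℕP.+-identityʳ _) ⟩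
  countBelow k (λ i → P (i ℕ.* e)) ℕ.+ bit (P (k ℕ.* e))                    ∎
  where
  open ≡.≡-Reasoning
  not : ∀ i → 1 ≤ i → i < e → P (k ℕ.* e ℕ.+ i) ≡ false
  not i 1≤i i<e with P (k ℕ.* e ℕ.+ i) in eq
  ... | false = ≡.refl
  ... | true  = contradiction (ℕD.∣⇒≤ {{ℕ.>-nonZero 1≤i}} (ℕD.∣m+n∣m⇒∣n (P⇒ _ eq) (ℕD.n∣m*n k))) (ℕP.<⇒≱ i<e)

totient : ℕ → ℕ
totient k = countBelow k (λ j → does (ℕG.gcd j k ℕ.≟ 1))

-- The residue 1 is counted for k ≥ 2, the residue 0 for k = 1.
totient≥1 : ∀ {k} → 1 ≤ k → 1 ≤ totient k
totient≥1 {suc zero}    _ = ℕP.≤-refl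
totient≥1 {suc (suc k)} _ = ≡.subst (1 ≤_) (≡.sym (≡.trans (countBelow-+ 2 k _) (≡.cong (ℕ._+ countBelow k (λ j → does (ℕG.gcd (2 ℕ.+ j) (2 ℕ.+ k) ℕ.≟ 1)))
  (≡.cong (λ b → bit (does (ℕG.gcd 0 (2 ℕ.+ k) ℕ.≟ 1)) ℕ.+ bit b) (dec-true (ℕG.gcd 1 (2 ℕ.+ k) ℕ.≟ 1) (ℕD.∣1⇒≡1 (ℕG.gcd[m,n]∣m 1 (2 ℕ.+ k))))))))
  (s≤s z≤n)

does-≡ : ∀ {p q} {P : Set p} {Q : Set q} (P? : Dec P) (Q? : Dec Q) → (P → Q) → (Q → P) → does P? ≡ does Q?
does-≡ (yes p) Q? f g = ≡.sym (dec-true Q? (f p))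
does-≡ (no ¬p) Q? f g = ≡.sym (dec-false Q? (λ q → ¬p (g q)))

from-does : ∀ {p} {P : Set p} (P? : Dec P) → does P? ≡ true → P
from-does (yes p) _ = p

-- Sort j < n by the value k = n / gcd j n.
∑-totient : ∀ n → 1 ≤ n → ∑ n (λ k → ⟦ k ∣ n ⟧ ℕ.* totient k) ≡ n
∑-totient n 1≤n = ≡.trans (∑-cong n (λ k 1≤k _ → ≡.sym (class k 1≤k (k ∣? n)))) (swap n)
  where
  P : ℕ → ℕ → Bool
  P k j = does (k ℕ.* ℕG.gcd j n ℕ.≟ n)
  class : ∀ k → 1 ≤ k → (k∣?n : Dec (k ∣ℕ n)) → countBelow n (P k) ≡ indicator k∣?n ℕ.* totient k
  class k 1≤k (no k∤n) = countBelow-false n (λ j _ → dec-false (k ℕ.* ℕG.gcd j n ℕ.≟ n)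
    (λ eq → k∤n (divides (ℕG.gcd j n) (≡.trans (≡.sym eq) (ℕP.*-comm k _)))))
  class k 1≤k (yes (divides e n≡ek)) = begin
    countBelow n (P k)                                ≡⟨ ≡.cong (λ i → countBelow i (P k)) (≡.trans n≡ek (ℕP.*-comm e k)) ⟩
    countBelow (k ℕ.* e) (P k)                        ≡⟨ countBelow-multiples k e 1≤e mult ⟩
    countBelow k (λ i → P k (i ℕ.* e))                ≡⟨ countBelow-cong k (λ i _ → does-≡ (k ℕ.* ℕG.gcd (i ℕ.* e) n ℕ.≟ n) (ℕG.gcd i k ℕ.≟ 1) (to i) (from i)) ⟩
    totient k                                         ≡⟨ ℕP.*-identityˡ _ ⟨
    1 ℕ.* totient k                                   ∎
    where
    open ≡.≡-Reasoning
    1≤e : 1 ≤ e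
    1≤e = ℕP.n≢0⇒n>0 λ { ≡.refl → ℕP.<⇒≢ 1≤n (≡.sym n≡ek) }
    mult : ∀ j → P k j ≡ true → e ∣ℕ j
    mult j eq = ≡.subst (_∣ℕ j) (ℕP.*-cancelˡ-≡ (ℕG.gcd j n) e k {{ℕ.>-nonZero 1≤k}}
      (≡.trans (from-does (k ℕ.* ℕG.gcd j n ℕ.≟ n) eq) (≡.trans n≡ek (ℕP.*-comm e k)))) (ℕG.gcd[m,n]∣m j n)
    gcd≡ : ∀ i → ℕG.gcd (i ℕ.* e) n ≡ e ℕ.* ℕG.gcd i k
    gcd≡ i = ≡.trans (≡.cong₂ ℕG.gcd (ℕP.*-comm i e) n≡ek) (≡.sym (ℕG.c*gcd[m,n]≡gcd[cm,cn] e i k))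
    regroup : ∀ i → k ℕ.* ℕG.gcd (i ℕ.* e) n ≡ ℕG.gcd i k ℕ.* n
    regroup i = ≡.trans (≡.cong (k ℕ.*_) (gcd≡ i)) (≡.trans (lem k e (ℕG.gcd i k)) (≡.cong (ℕG.gcd i k ℕ.*_) (≡.sym n≡ek)))
      where
      lem : ∀ a b c → a ℕ.* (b ℕ.* c) ≡ c ℕ.* (b ℕ.* a)
      lem = ℕR.solve-∀
    to : ∀ i → k ℕ.* ℕG.gcd (i ℕ.* e) n ≡ n → ℕG.gcd i k ≡ 1
    to i eq = ℕP.*-cancelʳ-≡ (ℕG.gcd i k) 1 n {{ℕ.>-nonZero 1≤n}}
      (≡.trans (≡.sym (regroup i)) (≡.trans eq (≡.sym (ℕP.*-identityˡ n))))
    from : ∀ i → ℕG.gcd i k ≡ 1 → k ℕ.* ℕG.gcd (i ℕ.* e) n ≡ n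
    from i eq = ≡.trans (regroup i) (≡.trans (≡.cong (ℕ._* n) eq) (ℕP.*-identityˡ n))
  one : ∀ j → ∑ n (λ k → bit (P k j)) ≡ 1
  one j with ℕG.gcd[m,n]∣n j n
  ... | divides k₀ n≡k₀g = ≡.trans (∑-cong n pointwise) (∑-at n 1≤k₀ (ℕD.∣⇒≤ {{ℕ.>-nonZero 1≤n}} (divides (ℕG.gcd j n) (≡.trans n≡k₀g (ℕP.*-comm k₀ _)))))
    where
    1≤k₀ : 1 ≤ k₀
    1≤k₀ = ℕP.n≢0⇒n>0 λ { ≡.refl → ℕP.<⇒≢ 1≤n (≡.sym n≡k₀g) }
    1≤g : 1 ≤ ℕG.gcd j n
    1≤g = ℕP.n≢0⇒n>0 λ g≡0 → ℕP.<⇒≢ 1≤n (≡.sym (ℕG.gcd[m,n]≡0⇒n≡0 j g≡0))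
    pointwise : ∀ k → 1 ≤ k → k ≤ n → bit (P k j) ≡ (1 at k₀) k
    pointwise k _ _ = ≡.cong bit (does-≡ (k ℕ.* ℕG.gcd j n ℕ.≟ n) (k ℕ.≟ k₀)
      (λ eq → ℕP.*-cancelʳ-≡ k k₀ _ {{ℕ.>-nonZero 1≤g}} (≡.trans eq n≡k₀g))
      (λ { ≡.refl → ≡.sym n≡k₀g }))
  swap : ∀ c → ∑ n (λ k → countBelow c (P k)) ≡ c
  swap zero    = ∑-0 n (λ _ _ _ → ≡.refl)
  swap (suc c) = ≡.trans (∑-+ n _ _) (≡.trans (≡.cong₂ ℕ._+_ (swap c) (one c)) (ℕP.+-comm c 1))

-- Degrees, and the positivity of the degree of Φ n.

-- A relation rather than a function of the list: trailing zeros make the length an unreliable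
-- degree, and the zero polynomial has none.
record Degree (f : Poly) (d : ℕ) : Set where
  field
    leading : coef f d ≢ 0ℤ
    beyond  : ∀ k → d < k → coef f k ≡ 0ℤ
open Degree

coef-*-beyond : ∀ f g {d e} → (∀ k → d < k → coef f k ≡ 0ℤ) → (∀ k → e < k → coef g k ≡ 0ℤ) →
  ∀ k → d ℕ.+ e < k → coef (f *ₚ g) k ≡ 0ℤ
coef-*-beyond []      g         f> g> k       lt = ≡.refl
coef-*-beyond (a ∷ f) g {zero} {e} f> g> (suc k) lt = begin
  coef ((a ∷ f) *ₚ g) (suc k)                      ≡⟨ coef-*-suc a f g k ⟩
  a ℤ.* coef g (suc k) ℤ.+ coef (f *ₚ g) k         ≡⟨ ≡.cong₂ (λ b c → a ℤ.* b ℤ.+ c) (g> (suc k) lt)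
                                                     (coef-≡ (*ₚ-congˡ {f} {[]} g (coefwise λ k → f> (suc k) (s≤s z≤n))) k) ⟩
  a ℤ.* 0ℤ ℤ.+ 0ℤ                                  ≡⟨ ≡.trans (ℤP.+-identityʳ _) (ℤP.*-zeroʳ a) ⟩
  0ℤ                                               ∎
  where open ≡.≡-Reasoning
coef-*-beyond (a ∷ f) g {suc d} {e} f> g> (suc k) (s≤s lt) = begin
  coef ((a ∷ f) *ₚ g) (suc k)                      ≡⟨ coef-*-suc a f g k ⟩
  a ℤ.* coef g (suc k) ℤ.+ coef (f *ₚ g) k         ≡⟨ ≡.cong₂ (λ b c → a ℤ.* b ℤ.+ c)
                                                     (g> (suc k) (ℕP.m<n⇒m<1+n (ℕP.≤-<-trans (ℕP.m≤n+m e d) lt)))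
                                                     (coef-*-beyond f g (λ k d<k → f> (suc k) (s≤s d<k)) g> k lt) ⟩
  a ℤ.* 0ℤ ℤ.+ 0ℤ                                  ≡⟨ ≡.trans (ℤP.+-identityʳ _) (ℤP.*-zeroʳ a) ⟩
  0ℤ                                               ∎
  where open ≡.≡-Reasoning

coef-*-top : ∀ f g {d e} → (∀ k → d < k → coef f k ≡ 0ℤ) → (∀ k → e < k → coef g k ≡ 0ℤ) →
  coef (f *ₚ g) (d ℕ.+ e) ≡ coef f d ℤ.* coef g e
coef-*-top []      g {d} {e} f> g> = ≡.sym (ℤP.*-zeroˡ (coef g e))
coef-*-top (a ∷ f) g {zero} {e} f> g> = begin
  coef ((a ∷ f) *ₚ g) e                            ≡⟨ coef-+ (a ·ₚ g) (0ℤ ∷ f *ₚ g) e ⟩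
  coef (a ·ₚ g) e ℤ.+ coef (0ℤ ∷ f *ₚ g) e         ≡⟨ ≡.cong₂ ℤ._+_ (coef-· a g e) (coef-≡ (≋-trans (∷-cong ≡.refl
                                                     (*ₚ-congˡ {f} {[]} g (coefwise λ k → f> (suc k) (s≤s z≤n)))) 0∷[]≋[]) e) ⟩
  a ℤ.* coef g e ℤ.+ 0ℤ                            ≡⟨ ℤP.+-identityʳ _ ⟩
  a ℤ.* coef g e                                   ∎
  where open ≡.≡-Reasoning
coef-*-top (a ∷ f) g {suc d} {e} f> g> = begin
  coef ((a ∷ f) *ₚ g) (suc (d ℕ.+ e))                          ≡⟨ coef-*-suc a f g (d ℕ.+ e) ⟩
  a ℤ.* coef g (suc (d ℕ.+ e)) ℤ.+ coef (f *ₚ g) (d ℕ.+ e)     ≡⟨ ≡.cong₂ (λ b c → a ℤ.* b ℤ.+ c) (g> _ (s≤s (ℕP.m≤n+m e d)))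
                                                                 (coef-*-top f g (λ k d<k → f> (suc k) (s≤s d<k)) g>) ⟩
  a ℤ.* 0ℤ ℤ.+ coef f d ℤ.* coef g e                           ≡⟨ ≡.trans (≡.cong (ℤ._+ _) (ℤP.*-zeroʳ a)) (ℤP.+-identityˡ _) ⟩
  coef f d ℤ.* coef g e                                        ∎
  where open ≡.≡-Reasoning

degree-* : ∀ {f g d e} → Degree f d → Degree g e → Degree (f *ₚ g) (d ℕ.+ e)
degree-* {f} {g} {d} {e} df dg = record
  { leading = λ eq → case (ℤP.i*j≡0⇒i≡0∨j≡0 (coef f d) (≡.trans (≡.sym (coef-*-top f g (beyond df) (beyond dg))) eq))
  ; beyond  = coef-*-beyond f g (beyond df) (beyond dg)
  }
  where
  case : ¬ (coef f d ≡ 0ℤ ⊎ coef g e ≡ 0ℤ)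
  case (inj₁ eq) = leading df eq
  case (inj₂ eq) = leading dg eq

degree-1 : Degree 1ₚ 0
degree-1 = record { leading = λ () ; beyond = λ { (suc k) _ → ≡.refl } }

degree-cong : ∀ {f g d} → f ≋ g → Degree f d → Degree g d
degree-cong f≋g df = record
  { leading = λ eq → leading df (≡.trans (coef-≡ f≋g _) eq)
  ; beyond  = λ k d<k → ≡.trans (≡.sym (coef-≡ f≋g k)) (beyond df k d<k)
  }

degree-unique : ∀ {f d e} → Degree f d → Degree f e → d ≡ e
degree-unique {f} {d} {e} df df′ with ℕP.<-cmp d e
... | tri< d<e _ _ = contradiction (beyond df e d<e) (leading df′)
... | tri≈ _ d≡e _ = d≡e
... | tri> _ _ e<d = contradiction (beyond df′ d e<d) (leading df)

zero∨degree : ∀ f → f ≋ [] ⊎ ∃ (Degree f)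
zero∨degree []      = inj₁ ≋-refl
zero∨degree (a ∷ f) with zero∨degree f
... | inj₂ (d , df) = inj₂ (suc d , record { leading = leading df ; beyond = λ { (suc k) (s≤s d<k) → beyond df k d<k } })
... | inj₁ f≋0 with a ℤ.≟ 0ℤ
...   | yes a≡0 = inj₁ (≋-trans (∷-cong a≡0 f≋0) 0∷[]≋[])
...   | no  a≢0 = inj₂ (0 , record { leading = a≢0 ; beyond = λ { (suc k) _ → coef-≡ f≋0 k } })

degree-X : ∀ {n} → 1 ≤ n → Degree (X n) n
degree-X {n@(suc n′)} 1≤n = record
  { leading = λ eq → contradiction (≡.trans (≡.sym (coef-X 0)) (≡.trans (≡.cong (coef (X n)) (ℕP.+-identityʳ n)) eq)) (λ ())
  ; beyond  = λ k n<k → ≡.subst (λ k → coef (X n) k ≡ 0ℤ) (ℕP.m+[n∸m]≡n (ℕP.<⇒≤ n<k)) (≡.trans (coef-X (k ℕ.∸ n)) (coef-beyond 1ₚ (ℕP.m<n⇒0<n∸m n<k)))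
  }
  where
  coef-X : ∀ k → coef (X n) (n ℕ.+ k) ≡ coef 1ₚ k
  coef-X k = ≡.trans (≡.sym (coef-≡ (*ₚ-identityˡ (X n)) (n ℕ.+ k))) (≡.trans (coef-*X-+ n 1ₚ k) (ℤP.+-identityʳ _))

module ℤ[q] = CyclotomicQuotients polyRing q X-saturated
open ℤ[q] using (Φ)

nonzero-factor : ∀ {f g} → ¬ (f *ₚ g ≋ []) → ∃ (Degree g)
nonzero-factor {f} {g} fg≢0 with zero∨degree g
... | inj₁ g≋0 = contradiction (≋-trans (*ₚ-congʳ f g≋0) (*ₚ-zeroʳ f)) fg≢0
... | inj₂ dg  = dg

degree⇒≢0 : ∀ {f d} → Degree f d → ¬ (f ≋ [])
degree⇒≢0 df f≋0 = leading df (coef-≡ f≋0 _)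

Φ-degree : ∀ k → 1 ≤ k → ∃ (Degree (Φ k))
Φ-degree k 1≤k with Cyclotomic.Φ∣X polyRing q X-saturated (ℕD.∣-refl {k}) 1≤k 1≤k
... | h , hΦ≋X = nonzero-factor {h} (λ hΦ≋0 → degree⇒≢0 (degree-X 1≤k) (≋-trans (≋-sym hΦ≋X) hΦ≋0))

degΦ : ℕ → ℕ
degΦ zero    = 0
degΦ (suc k) = proj₁ (Φ-degree (suc k) (s≤s z≤n))

degree-Φ : ∀ {k} → 1 ≤ k → Degree (Φ k) (degΦ k)
degree-Φ {suc k} _ = proj₂ (Φ-degree (suc k) (s≤s z≤n))

degree-^ : ∀ {f d} n → Degree f d → Degree (f ^^ n) (n ℕ.* d)
degree-^ zero    df = degree-1
degree-^ (suc n) df = degree-* df (degree-^ n df)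

degree-∏ : ∀ n {F d} → (∀ k → 1 ≤ k → k ≤ n → Degree (F k) (d k)) → Degree (Divisors.∏ polyRing n F) (∑ n d)
degree-∏ zero    dF = degree-1
degree-∏ (suc n) dF = degree-* (degree-∏ n (λ k 1≤k k≤n → dF k 1≤k (ℕP.m≤n⇒m≤1+n k≤n))) (dF (suc n) (s≤s z≤n) ℕP.≤-refl)

∑-degΦ : ∀ n → 1 ≤ n → ∑ n (λ k → ⟦ k ∣ n ⟧ ℕ.* degΦ k) ≡ n
∑-degΦ n 1≤n = degree-unique
  (degree-∏ n (λ k 1≤k _ → degree-^ ⟦ k ∣ n ⟧ (degree-Φ 1≤k)))
  (degree-cong (Cyclotomic.X≈powProd polyRing q X-saturated 1≤n (ℕP.≤-refl {n})) (degree-X 1≤n))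

-- Both functions have divisor sum n, so strong induction leaves only the terms at n itself to be
-- compared.
degΦ≡totient : ∀ n → 1 ≤ n → degΦ n ≡ totient n
degΦ≡totient = <-rec (λ n → 1 ≤ n → degΦ n ≡ totient n) step
  where
  step : ∀ n → (∀ {k} → k < n → 1 ≤ k → degΦ k ≡ totient k) → 1 ≤ n → degΦ n ≡ totient n
  step (suc n) ih 1≤n = begin
    degΦ (suc n)                                    ≡⟨ ℕP.*-identityˡ _ ⟨
    1 ℕ.* degΦ (suc n)                              ≡⟨ ≡.cong (ℕ._* degΦ (suc n)) self ⟨
    ⟦ suc n ∣ suc n ⟧ ℕ.* degΦ (suc n)              ≡⟨ ℕP.+-cancelˡ-≡ (∑ n (λ k → ⟦ k ∣ suc n ⟧ ℕ.* totient k)) _ _ sums ⟩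
    ⟦ suc n ∣ suc n ⟧ ℕ.* totient (suc n)           ≡⟨ ≡.cong (ℕ._* totient (suc n)) self ⟩
    1 ℕ.* totient (suc n)                           ≡⟨ ℕP.*-identityˡ _ ⟩
    totient (suc n)                                 ∎
    where
    open ≡.≡-Reasoning
    self : ⟦ suc n ∣ suc n ⟧ ≡ 1
    self = indicator-yes (suc n ∣? suc n) ℕD.∣-refl
    sums : ∑ n (λ k → ⟦ k ∣ suc n ⟧ ℕ.* totient k) ℕ.+ ⟦ suc n ∣ suc n ⟧ ℕ.* degΦ (suc n)
         ≡ ∑ n (λ k → ⟦ k ∣ suc n ⟧ ℕ.* totient k) ℕ.+ ⟦ suc n ∣ suc n ⟧ ℕ.* totient (suc n)
    sums = ≡.trans (≡.cong (ℕ._+ (⟦ suc n ∣ suc n ⟧ ℕ.* degΦ (suc n)))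
        (∑-cong n (λ k 1≤k k≤n → ≡.cong (⟦ k ∣ suc n ⟧ ℕ.*_) (≡.sym (ih (s≤s k≤n) 1≤k)))))
      (≡.trans (∑-degΦ (suc n) 1≤n) (≡.sym (∑-totient (suc n) 1≤n)))

-- As a cofactor Φ n might a priori be constant; the totient excludes this.
degΦ≥1 : ∀ {n} → 1 ≤ n → 1 ≤ degΦ n
degΦ≥1 {n} 1≤n = ≡.subst (1 ≤_) (≡.sym (degΦ≡totient n 1≤n)) (totient≥1 1≤n)

∑≥ : ∀ n {d} → (∀ k → 1 ≤ d k) → n ≤ ∑ n d
∑≥ zero    1≤d = z≤n
∑≥ (suc n) {d} 1≤d = ℕP.≤-trans (ℕP.≤-reflexive (ℕP.+-comm 1 n)) (ℕP.+-mono-≤ (∑≥ n 1≤d) (1≤d (suc n)))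

-- If C had degree d, the product of d + 1 pairwise coprime Φ's, each of degree at least 1, would
-- divide it.
infinitelyManyΦ∣⇒≋0 : ∀ C (σ : ℕ → ℕ) → (∀ k → 1 ≤ σ k) → (∀ j k → j < k → σ j ≢ σ k) →
  (∀ k → Φ (σ k) ∣ₚ C) → C ≋ []
infinitelyManyΦ∣⇒≋0 C σ 1≤σ σ-inj div with zero∨degree C
... | inj₁ C≋0 = C≋0
... | inj₂ (d , dC) = contradiction (go (ℤ[q].∏Φ∣ (suc d) σ 1≤σ σ-inj div)) ℕP.1+n≰n
  where
  P : Poly
  P = Divisors.∏ polyRing (suc d) (λ k → Φ (σ k))
  go : P ∣ₚ C → suc d ≤ d
  go (h , hP≋C) = begin
    suc d                                   ≤⟨ ∑≥ (suc d) (λ k → degΦ≥1 (1≤σ k)) ⟩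
    ∑ (suc d) (λ k → degΦ (σ k))            ≤⟨ ℕP.m≤m+n _ (proj₁ dh) ⟩
    ∑ (suc d) (λ k → degΦ (σ k)) ℕ.+ proj₁ dh ≡⟨ degree-unique (degree-cong Ph≋C (degree-* dP (proj₂ dh))) dC ⟩
    d                                       ∎
    where
    open ℕP.≤-Reasoning
    Ph≋C : P *ₚ h ≋ C
    Ph≋C = ≋-trans (*ₚ-comm P h) hP≋C
    dP : Degree P (∑ (suc d) (λ k → degΦ (σ k)))
    dP = degree-∏ (suc d) (λ k _ _ → degree-Φ (1≤σ k))
    dh : ∃ (Degree h)
    dh = nonzero-factor {P} (λ Ph≋0 → degree⇒≢0 dC (≋-trans (≋-sym Ph≋C) Ph≋0))

-- The cyclotomic factorisation of q-Pochhammer symbols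

open Divisibility *-commutativeSemigroup using () renaming (_∥_ to _∥ₚ_)
open ℤ[q] using (powΦ)

∥-resp : ∀ {f g h} → f ≋ g → g ∥ₚ h → f ∥ₚ h
∥-resp f≋g (g∣h , h∣g) = ∣ʳ-respˡ-≈ (≋-sym f≋g) g∣h , ∣ʳ-respʳ-≈ (≋-sym f≋g) h∣g
  where open Divisibility *-commutativeSemigroup using (∣ʳ-respˡ-≈; ∣ʳ-respʳ-≈)

oneMinusQ∥X : ∀ z → proj₂ (oneMinusQ z) ∥ₚ X ℤ.∣ z ∣
oneMinusQ∥X (+ k)    = ∥-resp (+ₚ-cong (≋-refl {1ₚ}) (·ₚ-cong (ℤ.- 1ℤ) (≋-sym (q^≋qPow k)))) (ℤ[q].neg-∥ neg)
  where
  neg : ℤ.- 1ℤ ·ₚ (1ₚ -ₚ (q ^^ k)) ≋ X k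
  neg = ≋-trans (≋-sym (-‿+-comm 1ₚ (ℤ.- 1ℤ ·ₚ (q ^^ k)))) (≋-trans (+ₚ-comm (ℤ.- 1ℤ ·ₚ 1ₚ) _) (+ₚ-cong (-‿involutive (q ^^ k)) ≋-refl))
    where open RingProperties (CommutativeRing.ring polyRing) using (-‿+-comm; -‿involutive)
oneMinusQ∥X -[1+ k ] = ∥-resp (+ₚ-cong (≋-sym (q^≋qPow (suc k))) (≋-refl {ℤ.- 1ℤ ·ₚ 1ₚ})) ∥-refl
  where open MonoidDivisibility (CommutativeRing.*-monoid polyRing) using (∥-refl)

term : ℤ → ℤ → ℕ → ℤ
term r s k = r ℤ.+ s ℤ.* + k

-- The exponent of Φ m in (q ^ r; q ^ s)_n, which is determined up to sign and a power of q.
hits : ℤ → ℤ → ℕ → ℕ → ℕ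
hits r s m n = countBelow n (λ k → does (m ∣? ℤ.∣ term r s k ∣))

totalHits : (v : ℕ) → (r s : Fin v → ℤ) → ℕ → ℕ → ℕ
totalHits v r s m n = sumFin v (λ i → hits (r i) (s i) m n)

qPoch∥powΦ : ∀ r s M n → (∀ k → term r s k ≢ 0ℤ) → (∀ k → k < n → ℤ.∣ term r s k ∣ ≤ M) →
  proj₂ (qPoch r s n) ∥ₚ powΦ M (λ m → hits r s m n)
qPoch∥powΦ r s M zero    ≢0 ≤M = ℤ[q].powΦ-0-∥ M
qPoch∥powΦ r s M (suc n) ≢0 ≤M = ℤ[q].powΦ-+-∥ M (λ m → hits r s m n) (λ m → ⟦ m ∣ ℤ.∣ term r s n ∣ ⟧)
  (qPoch∥powΦ r s M n ≢0 (λ k k<n → ≤M k (ℕP.m<n⇒m<1+n k<n)))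
  (∥-trans (oneMinusQ∥X (term r s n))
    (ℤ[q].X∥powΦ (ℕP.n≢0⇒n>0 (λ eq → ≢0 n (ℤP.∣i∣≡0⇒i≡0 eq))) (≤M n ℕP.≤-refl)))
  where open Divisibility *-commutativeSemigroup using (∥-trans)

QNum∥powΦ : ∀ v r s M n → (∀ i k → term (r i) (s i) k ≢ 0ℤ) →
  (∀ i k → k < n → ℤ.∣ term (r i) (s i) k ∣ ≤ M) →
  proj₂ (QNum v r s n) ∥ₚ powΦ M (λ m → totalHits v r s m n)
QNum∥powΦ zero    r s M n ≢0 ≤M = ℤ[q].powΦ-0-∥ M
QNum∥powΦ (suc v) r s M n ≢0 ≤M = ℤ[q].powΦ-+-∥ M (λ m → hits (r Fin.zero) (s Fin.zero) m n)
  (λ m → totalHits v (λ i → r (Fin.suc i)) (λ i → s (Fin.suc i)) m n)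
  (qPoch∥powΦ (r Fin.zero) (s Fin.zero) M n (≢0 Fin.zero) (≤M Fin.zero))
  (QNum∥powΦ v _ _ M n (λ i → ≢0 (Fin.suc i)) (λ i → ≤M (Fin.suc i)))

boundBelow : ∀ (f : ℕ → ℕ) n → ∃ λ M → ∀ k → k < n → f k ≤ M
boundBelow f zero    = 0 , λ _ ()
boundBelow f (suc n) with boundBelow f n
... | M , f≤M = M ℕ.⊔ f n , bound
  where
  bound : ∀ k → k < suc n → f k ≤ M ℕ.⊔ f n
  bound k (s≤s k≤n) with ℕP.m≤n⇒m<n∨m≡n k≤n
  ... | inj₁ k<n    = ℕP.≤-trans (f≤M k k<n) (ℕP.m≤m⊔n M (f n))
  ... | inj₂ ≡.refl = ℕP.m≤n⊔m M (f n)

boundFin : ∀ v {P : Fin v → ℕ → Set} → (∀ i {M M′} → M ≤ M′ → P i M → P i M′) →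
  (∀ i → ∃ (P i)) → ∃ λ M → ∀ i → P i M
boundFin zero    mono ex = 0 , λ ()
boundFin (suc v) {P} mono ex with ex Fin.zero | boundFin v {λ i → P (Fin.suc i)} (λ i → mono (Fin.suc i)) (λ i → ex (Fin.suc i))
... | M , p | M′ , p′ = M ℕ.⊔ M′ , λ
  { Fin.zero    → mono Fin.zero (ℕP.m≤m⊔n M M′) p
  ; (Fin.suc i) → mono (Fin.suc i) (ℕP.m≤n⊔m M M′) (p′ i) }

termBound : ∀ v (r s : Fin v → ℤ) n → ∃ λ M → ∀ i k → k < n → ℤ.∣ term (r i) (s i) k ∣ ≤ M
termBound v r s n = boundFin v (λ i M≤M′ b k k<n → ℕP.≤-trans (b k k<n) M≤M′) (λ i → boundBelow _ n)

countBelow≤ : ∀ n P → countBelow n P ≤ n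
countBelow≤ zero    P = z≤n
countBelow≤ (suc n) P = ℕP.≤-trans (ℕP.+-mono-≤ (countBelow≤ n P) (bit≤1 (P n))) (ℕP.≤-reflexive (ℕP.+-comm n 1))
  where
  bit≤1 : ∀ b → bit b ≤ 1
  bit≤1 true  = ℕP.≤-refl
  bit≤1 false = z≤n

sumFin≤ : ∀ v {f : Fin v → ℕ} n → (∀ i → f i ≤ n) → sumFin v f ≤ v ℕ.* n
sumFin≤ zero    n f≤n = z≤n
sumFin≤ (suc v) n f≤n = ℕP.+-mono-≤ (f≤n Fin.zero) (sumFin≤ v n (λ i → f≤n (Fin.suc i)))

^ₚ≡^^ : ∀ f n → f ^ₚ n ≡ f ^^ n
^ₚ≡^^ f zero    = ≡.refl
^ₚ≡^^ f (suc n) = ≡.cong (f *ₚ_) (^ₚ≡^^ f n)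

-- The exponent e of the denominator q ^ e of 1 - q ^ z is max 0 (- z).
oneMinusQ-exponent : ∀ r s k → 0ℤ ℤ.≤ s → proj₁ (oneMinusQ (term r s k)) ≤ ℤ.∣ r ∣
oneMinusQ-exponent r s k 0≤s = go (term r s k) r≤
  where
  r≤ : r ℤ.≤ term r s k
  r≤ = ℤP.≤-trans (ℤP.≤-reflexive (≡.sym (ℤP.+-identityʳ r)))
    (ℤP.+-monoʳ-≤ r (ℤP.≤-trans (ℤP.≤-reflexive (≡.sym (ℤP.*-zeroˡ (+ k)))) (ℤP.*-monoʳ-≤-nonNeg (+ k) 0≤s)))
  go : ∀ {r} z → r ℤ.≤ z → proj₁ (oneMinusQ z) ≤ ℤ.∣ r ∣
  go (+ _)    _ = z≤n
  go -[1+ _ ] (ℤ.-≤- n≤m) = s≤s n≤m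

qPoch-exponent : ∀ r s n → 0ℤ ℤ.≤ s → proj₁ (qPoch r s n) ≤ ℤ.∣ r ∣ ℕ.* n
qPoch-exponent r s zero    0≤s = z≤n
qPoch-exponent r s (suc n) 0≤s = ℕP.≤-trans (ℕP.+-mono-≤ (qPoch-exponent r s n 0≤s) (oneMinusQ-exponent r s n 0≤s))
  (ℕP.≤-reflexive (≡.trans (ℕP.+-comm _ ℤ.∣ r ∣) (≡.sym (ℕP.*-suc ℤ.∣ r ∣ n))))

-- For s ≥ 0 no exponent r + s k lies below r, so the power of q to be cleared grows only linearly
-- in n and one fixed power of q in C suffices.
QNum-exponent : ∀ v r s n → (∀ i → 0ℤ ℤ.≤ s i) → proj₁ (QNum v r s n) ≤ sumFin v (λ i → ℤ.∣ r i ∣) ℕ.* n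
QNum-exponent zero    r s n 0≤s = z≤n
QNum-exponent (suc v) r s n 0≤s = ℕP.≤-trans
  (ℕP.+-mono-≤ (qPoch-exponent (r Fin.zero) (s Fin.zero) n (0≤s Fin.zero)) (QNum-exponent v _ _ n (λ i → 0≤s (Fin.suc i))))
  (ℕP.≤-reflexive (≡.sym (ℕP.*-distribʳ-+ n ℤ.∣ r Fin.zero ∣ _)))

module _ (v w : ℕ) (r s : Fin v → ℤ) (t u : Fin w → ℤ)
  (num≢0 : ∀ i k → term (r i) (s i) k ≢ 0ℤ) (den≢0 : ∀ j k → term (t j) (u j) k ≢ 0ℤ) where

  private
    bound : ∀ n M₀ → ∃ λ M → M₀ ≤ M × (∀ i k → k < n → ℤ.∣ term (r i) (s i) k ∣ ≤ M) × (∀ j k → k < n → ℤ.∣ term (t j) (u j) k ∣ ≤ M)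
    bound n M₀ = M₀ ℕ.⊔ (A ℕ.⊔ B) , ℕP.m≤m⊔n M₀ _
      , (λ i k k<n → ℕP.≤-trans (proj₂ (termBound v r s n) i k k<n) (ℕP.≤-trans (ℕP.m≤m⊔n A B) (ℕP.m≤n⊔m M₀ _)))
      , (λ j k k<n → ℕP.≤-trans (proj₂ (termBound w t u n) j k k<n) (ℕP.≤-trans (ℕP.m≤n⊔m A B) (ℕP.m≤n⊔m M₀ _)))
      where
      A = proj₁ (termBound v r s n)
      B = proj₁ (termBound w t u n)

  qIntegral⇒Φ∣ : ((C , _) : QIntegral (QNum v r s) (QNum w t u)) →
    ∀ m n → 1 ≤ m → totalHits v r s m n < totalHits w t u m n → Φ m ∣ₚ C
  qIntegral⇒Φ∣ (C , _ , clear) m n 1≤m deficit with bound n m | clear n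
  ... | M , m≤M , boundN , boundD | P , eq = ℤ[q].deficit⇒Φ∣ X-reduced C (proj₁ D) n
      (λ m → totalHits v r s m n) (λ m → totalHits w t u m n)
      (QNum∥powΦ v r s M n num≢0 boundN) (QNum∥powΦ w t u M n den≢0 boundD) 1≤m m≤M deficit
      (qPow (proj₁ N) *ₚ P , ≋-trans (≋-sym (≈ₚ⇒≋ eq))
        (*ₚ-congˡ (proj₂ N) (≋-trans (*ₚ-congˡ (C ^ₚ n) (≋-sym (q^≋qPow (proj₁ D))))
          (*ₚ-congʳ (q ^^ proj₁ D) (≡.subst (C ^ₚ n ≋_) (^ₚ≡^^ C n) ≋-refl)))))
    where
    N = QNum v r s n
    D = QNum w t u n

  -- In C the power q ^ κ clears the negative powers of q in the numerator. The exponent w suits the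
  -- small Φ's because each of the w symbols in the denominator contributes at most n hits.
  hits≤⇒qIntegral : (∀ i → 0ℤ ℤ.≤ s i) →
    ∀ M₀ → (∀ m n → M₀ < m → totalHits w t u m n ≤ totalHits v r s m n) →
    QIntegral (QNum v r s) (QNum w t u)
  hits≤⇒qIntegral 0≤s M₀ surplus = C , (λ C≡0 → degree⇒≢0 C-degree (IsZero⇒≋ C≡0)) , clear
    where
    κ : ℕ
    κ = sumFin v (λ i → ℤ.∣ r i ∣)
    C₀ C : Poly
    C₀ = powΦ M₀ (λ _ → w)
    C = (q ^^ κ) *ₚ C₀
    C-degree : Degree C (κ ℕ.* 1 ℕ.+ ∑ M₀ (λ k → w ℕ.* degΦ k))
    C-degree = degree-* (degree-^ κ degree-q) (degree-∏ M₀ (λ k 1≤k _ → degree-^ w (degree-Φ 1≤k)))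
      where
      degree-q : Degree q 1
      degree-q = record { leading = λ () ; beyond = λ { (suc (suc k)) _ → ≡.refl ; (suc zero) (s≤s ()) } }
    clear : ∀ n → Σ Poly λ P → (qPow (proj₁ (QNum w t u n)) *ₚ (C ^ₚ n) *ₚ proj₂ (QNum v r s n))
                             ≈ₚ (qPow (proj₁ (QNum v r s n)) *ₚ P *ₚ proj₂ (QNum w t u n))
    clear n = go (bound n M₀)
      where
      N = proj₂ (QNum v r s n)
      D = proj₂ (QNum w t u n)
      eN = proj₁ (QNum v r s n)
      eD = proj₁ (QNum w t u n)
      eN≤ : eN ≤ κ ℕ.* n
      eN≤ = QNum-exponent v r s n 0≤s
      quotient : D ∣ₚ (C₀ ^^ n) *ₚ N → Σ Poly λ P → (qPow eD *ₚ (C ^ₚ n) *ₚ N) ≈ₚ (qPow eN *ₚ P *ₚ D)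
      quotient (h , hD≋) = P , ≋⇒≈ₚ (begin
        qPow eD *ₚ (C ^ₚ n) *ₚ N                                         ≡⟨ ≡.cong (λ f → qPow eD *ₚ f *ₚ N) (^ₚ≡^^ C n) ⟩
        qPow eD *ₚ (C ^^ n) *ₚ N                                         ≈⟨ *ₚ-congˡ N (*ₚ-congʳ (qPow eD) C^n) ⟩
        qPow eD *ₚ (qPow eN *ₚ (q ^^ rest) *ₚ (C₀ ^^ n)) *ₚ N            ≈⟨ solve 5 (λ e f k c n → e :* (f :* k :* c) :* n := f :* (e :* k) :* (c :* n))
                                                                         ≋-refl (qPow eD) (qPow eN) (q ^^ rest) (C₀ ^^ n) N ⟩
        qPow eN *ₚ (qPow eD *ₚ (q ^^ rest)) *ₚ ((C₀ ^^ n) *ₚ N)          ≈⟨ *ₚ-congʳ (qPow eN *ₚ (qPow eD *ₚ (q ^^ rest))) (≋-sym hD≋) ⟩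
        qPow eN *ₚ (qPow eD *ₚ (q ^^ rest)) *ₚ (h *ₚ D)                  ≈⟨ solve 5 (λ f e k h d → f :* (e :* k) :* (h :* d) := f :* (e :* k :* h) :* d)
                                                                         ≋-refl (qPow eN) (qPow eD) (q ^^ rest) h D ⟩
        qPow eN *ₚ P *ₚ D                                                ∎)
        where
        open SetoidReasoning ≋-setoid
        open SemiringSolver commutativeSemiring using (solve; _:=_; _:*_)
        -- `C ^^ n` contains q ^ (κ n); eN of these factors match the denominator of the numerator
        -- symbols, and the remaining ones are absorbed into P together with q ^ eD.
        rest : ℕ
        rest = κ ℕ.* n ℕ.∸ eN
        P : Poly
        P = qPow eD *ₚ (q ^^ rest) *ₚ h
        C^n : C ^^ n ≋ qPow eN *ₚ (q ^^ rest) *ₚ (C₀ ^^ n)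
        C^n = begin
          C ^^ n                                          ≈⟨ Exp.^-distrib-* commutativeSemiring (q ^^ κ) C₀ n ⟩
          ((q ^^ κ) ^^ n) *ₚ (C₀ ^^ n)                    ≈⟨ *ₚ-congˡ (C₀ ^^ n) (begin
            (q ^^ κ) ^^ n                                   ≈⟨ Exp.^-assocʳ commutativeSemiring q κ n ⟩
            q ^^ (κ ℕ.* n)                                  ≡⟨ ≡.cong (q ^^_) (ℕP.m+[n∸m]≡n eN≤) ⟨
            q ^^ (eN ℕ.+ rest)                              ≈⟨ Exp.^-homo-* commutativeSemiring q eN rest ⟩
            (q ^^ eN) *ₚ (q ^^ rest)                        ≈⟨ *ₚ-congˡ (q ^^ rest) (q^≋qPow eN) ⟩
            qPow eN *ₚ (q ^^ rest)                          ∎) ⟩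
          qPow eN *ₚ (q ^^ rest) *ₚ (C₀ ^^ n)             ∎
      go : (∃ λ M → M₀ ≤ M × (∀ i k → k < n → ℤ.∣ term (r i) (s i) k ∣ ≤ M) × (∀ j k → k < n → ℤ.∣ term (t j) (u j) k ∣ ≤ M)) →
        Σ Poly λ P → (qPow eD *ₚ (C ^ₚ n) *ₚ N) ≈ₚ (qPow eN *ₚ P *ₚ D)
      go (M , M₀≤M , boundN , boundD) = quotient (ℤ[q].surplus⇒∣ M₀ w n
        (λ m → totalHits v r s m n) (λ m → totalHits w t u m n)
        (QNum∥powΦ v r s M n num≢0 boundN) (QNum∥powΦ w t u M n den≢0 boundD) M₀≤M
        (λ m → ℕP.≤-trans (sumFin≤ w n (λ j → countBelow≤ n _)) (ℕP.≤-reflexive (ℕP.*-comm w n)))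
        (λ m M₀<m _ → surplus m n M₀<m))

-- Fractions with explicit denominators; a ÷ d is a / (d + 1).

infixl 8 _÷_
_÷_ : ℤ → ℕ → ℚ
a ÷ d = a ℚ./ suc d

toℚᵘ-÷ : ∀ a d → toℚᵘ (a ÷ d) ℚᵘ.≃ mkℚᵘ a d
toℚᵘ-÷ a d = ℚP.toℚᵘ-fromℚᵘ (mkℚᵘ a d)

÷-≡ : ∀ a b d e → a ℤ.* + suc e ≡ b ℤ.* + suc d → a ÷ d ≡ b ÷ e
÷-≡ a b d e eq = ℚP.fromℚᵘ-cong {mkℚᵘ a d} {mkℚᵘ b e} (*≡* eq)

÷-injective : ∀ {a b} d → a ÷ d ≡ b ÷ d → a ≡ b
÷-injective {a} {b} d eq = ℤP.*-cancelʳ-≡ a b (+ suc d) (ℚᵘP.drop-*≡* (ℚᵘP.≃-trans (ℚᵘP.≃-sym (toℚᵘ-÷ a d))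
  (ℚᵘP.≃-trans (ℚP.toℚᵘ-cong eq) (toℚᵘ-÷ b d))))

÷-+ : ∀ a d b e → a ÷ d ℚ.+ b ÷ e ≡ (a ℤ.* + suc e ℤ.+ b ℤ.* + suc d) ÷ (e ℕ.+ d ℕ.* suc e)
÷-+ a d b e = ℚP.toℚᵘ-injective (ℚᵘP.≃-trans (ℚP.toℚᵘ-homo-+ (a ÷ d) (b ÷ e))
  (ℚᵘP.≃-trans (ℚᵘP.+-cong (toℚᵘ-÷ a d) (toℚᵘ-÷ b e)) (ℚᵘP.≃-sym (toℚᵘ-÷ _ (e ℕ.+ d ℕ.* suc e)))))

÷-* : ∀ a d b e → a ÷ d ℚ.* b ÷ e ≡ (a ℤ.* b) ÷ (e ℕ.+ d ℕ.* suc e)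
÷-* a d b e = ℚP.toℚᵘ-injective (ℚᵘP.≃-trans (ℚP.toℚᵘ-homo-* (a ÷ d) (b ÷ e))
  (ℚᵘP.≃-trans (ℚᵘP.*-cong (toℚᵘ-÷ a d) (toℚᵘ-÷ b e)) (ℚᵘP.≃-sym (toℚᵘ-÷ _ (e ℕ.+ d ℕ.* suc e)))))

-‿÷ : ∀ a d → ℚ.- (a ÷ d) ≡ (ℤ.- a) ÷ d
-‿÷ a d = ℚP.toℚᵘ-injective (ℚᵘP.≃-trans (ℚP.toℚᵘ-homo‿- (a ÷ d))
  (ℚᵘP.≃-trans (ℚᵘP.-‿cong (toℚᵘ-÷ a d)) (ℚᵘP.≃-sym (toℚᵘ-÷ (ℤ.- a) d))))

÷-≤ : ∀ {a b} d → a ℤ.≤ b → a ÷ d ℚ.≤ b ÷ d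
÷-≤ {a} {b} d a≤b = ℚP.toℚᵘ-cancel-≤ (ℚᵘP.≤-respˡ-≃ (ℚᵘP.≃-sym (toℚᵘ-÷ a d))
  (ℚᵘP.≤-respʳ-≃ (ℚᵘP.≃-sym (toℚᵘ-÷ b d)) (*≤* (ℤP.*-monoʳ-≤-nonNeg (+ suc d) a≤b))))

÷-< : ∀ {a b} d → a ℤ.< b → a ÷ d ℚ.< b ÷ d
÷-< {a} {b} d a<b = ℚP.toℚᵘ-cancel-< (ℚᵘP.<-respˡ-≃ (ℚᵘP.≃-sym (toℚᵘ-÷ a d))
  (ℚᵘP.<-respʳ-≃ (ℚᵘP.≃-sym (toℚᵘ-÷ b d)) (*<* (ℤP.*-monoʳ-<-pos (+ suc d) a<b))))

÷-+-integer : ∀ a d n → a ÷ d ℚ.+ n ÷ 0 ≡ (a ℤ.+ n ℤ.* + suc d) ÷ d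
÷-+-integer a d n = ≡.trans (÷-+ a d n 0) (÷-≡ (a ℤ.* 1ℤ ℤ.+ n ℤ.* + suc d) (a ℤ.+ n ℤ.* + suc d) (d ℕ.* 1) d (≡.cong₂ ℤ._*_ (≡.cong (ℤ._+ n ℤ.* + suc d) (ℤP.*-identityʳ a))
  (≡.cong (λ k → + suc k) (≡.sym (ℕP.*-identityʳ d)))))

÷---integer : ∀ a d n → a ÷ d ℚ.- n ÷ 0 ≡ (a ℤ.- n ℤ.* + suc d) ÷ d
÷---integer a d n = ≡.trans (≡.cong (a ÷ d ℚ.+_) (-‿÷ n 0)) (≡.trans (÷-+-integer a d (ℤ.- n))
  (≡.cong (λ k → (a ℤ.+ k) ÷ d) (≡.sym (ℤP.neg-distribˡ-* n (+ suc d)))))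

-- `floor` computes with the reduced fraction, so the integer quotient must be shown to agree on
-- fractions equal by cross multiplication.
floor-÷ : ∀ a d → floor (a ÷ d) ≡ a ℤ./ℕ suc d
floor-÷ a d = go (a ÷ d) (toℚᵘ-÷ a d)
  where
  below : ∀ N D n d → N ℤ.* + suc d ≡ n ℤ.* + suc D → N ℤ./ℕ suc D ℤ.≤ n ℤ./ℕ suc d
  below N D n d eq = ℤP.≤-trans (ℤP.i<j⇒i≤pred[j] F<sG) (ℤP.≤-reflexive (ℤP.pred-suc G))
    where
    F = N ℤ./ℕ suc D
    G = n ℤ./ℕ suc d
    F<sG : F ℤ.< ℤ.suc G
    F<sG = ℤP.*-cancelʳ-<-nonNeg (+ suc D) (ℤP.*-cancelʳ-<-nonNeg (+ suc d) (begin-strict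
      F ℤ.* + suc D ℤ.* + suc d             ≤⟨ ℤP.*-monoʳ-≤-nonNeg (+ suc d) (ℤD.[n/ℕd]*d≤n N (suc D)) ⟩
      N ℤ.* + suc d                         ≡⟨ eq ⟩
      n ℤ.* + suc D                         <⟨ ℤP.*-monoʳ-<-pos (+ suc D) (ℤD.n<s[n/ℕd]*d n (suc d)) ⟩
      ℤ.suc G ℤ.* + suc d ℤ.* + suc D       ≡⟨ swap (ℤ.suc G) (+ suc d) (+ suc D) ⟩
      ℤ.suc G ℤ.* + suc D ℤ.* + suc d       ∎))
      where
      open ℤP.≤-Reasoning
      swap : ∀ a b c → a ℤ.* b ℤ.* c ≡ a ℤ.* c ℤ.* b
      swap = solve-∀
  go : ∀ p → toℚᵘ p ℚᵘ.≃ mkℚᵘ a d → floor p ≡ a ℤ./ℕ suc d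
  go (mkℚ N D _) (*≡* eq) = ≡.trans (ℤD.div-pos-is-/ℕ N (suc D))
    (ℤP.≤-antisym (below N D a d eq) (below a d N D (≡.sym eq)))

/ℕ-unique : ∀ n d k r → r < suc d → n ≡ + r ℤ.+ k ℤ.* + suc d → n ℤ./ℕ suc d ≡ k
/ℕ-unique n d k r r<d eq = ℤP.≤-antisym
  (bound (n ℤ./ℕ suc d) k (ℤP.≤-<-trans (ℤD.[n/ℕd]*d≤n n (suc d)) (≡.subst (ℤ._< ℤ.suc k ℤ.* + suc d) (≡.sym eq) top)))
  (bound k (n ℤ./ℕ suc d) (ℤP.≤-<-trans (≡.subst (k ℤ.* + suc d ℤ.≤_) (≡.sym eq) (ℤP.i≤j⇒i≤k+j (+ r) ℤP.≤-refl)) (ℤD.n<s[n/ℕd]*d n (suc d))))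
  where
  top : + r ℤ.+ k ℤ.* + suc d ℤ.< ℤ.suc k ℤ.* + suc d
  top = ≡.subst (+ r ℤ.+ k ℤ.* + suc d ℤ.<_) (≡.sym (ℤP.suc-* k (+ suc d))) (ℤP.+-monoˡ-< (k ℤ.* + suc d) (ℤ.+<+ r<d))
  bound : ∀ i j → i ℤ.* + suc d ℤ.< ℤ.suc j ℤ.* + suc d → i ℤ.≤ j
  bound i j lt = ℤP.≤-trans (ℤP.i<j⇒i≤pred[j] (ℤP.*-cancelʳ-<-nonNeg {i} {ℤ.suc j} (+ suc d) lt)) (ℤP.≤-reflexive (ℤP.pred-suc j))

/ℕ-+-multiple : ∀ n d j → (n ℤ.+ j ℤ.* + suc d) ℤ./ℕ suc d ≡ n ℤ./ℕ suc d ℤ.+ j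
/ℕ-+-multiple n d j = /ℕ-unique (n ℤ.+ j ℤ.* + suc d) d (n ℤ./ℕ suc d ℤ.+ j) (n ℤ.%ℕ suc d) (ℤD.n%ℕd<d n (suc d)) (≡.trans
  (≡.cong (ℤ._+ j ℤ.* + suc d) (ℤD.a≡a%ℕn+[a/ℕn]*n n (suc d))) (lem (+ (n ℤ.%ℕ suc d)) (n ℤ./ℕ suc d) j (+ suc d)))
  where
  lem : ∀ r k j d → r ℤ.+ k ℤ.* d ℤ.+ j ℤ.* d ≡ r ℤ.+ (k ℤ.+ j) ℤ.* d
  lem = solve-∀

frac-integer : ∀ x → x ℚ.- floor x ÷ 0 ≡ 0ℚ → frac x ≡ 1ℚ
frac-integer x eq with (x ℚ.- (floor x ℚ./ 1)) ℚP.≟ 0ℚ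
... | yes _ = ≡.refl
... | no ≢0 = contradiction eq ≢0

frac-noninteger : ∀ x → x ℚ.- floor x ÷ 0 ≢ 0ℚ → frac x ≡ x ℚ.- floor x ÷ 0
frac-noninteger x ≢0 with (x ℚ.- (floor x ℚ./ 1)) ℚP.≟ 0ℚ
... | yes eq = contradiction eq ≢0
... | no _   = ≡.refl

-- The range of p mirrors the values of ⟨x⟩ in (0, 1]. The end point p = d + 1 is the integer case,
-- where the floor is g + 1 instead of g and `frac` returns 1.
frac-÷ : ∀ d p g → 1 ≤ p → p ≤ suc d → frac ((+ p ℤ.+ g ℤ.* + suc d) ÷ d) ≡ (+ p) ÷ d
frac-÷ d p g 1≤p p≤d with ℕP.m≤n⇒m<n∨m≡n p≤d
... | inj₁ p<d = ≡.trans (frac-noninteger x (λ eq → contradiction (÷-injective {+ p} {0ℤ} d (≡.trans (≡.trans (≡.sym x-g) eq) (÷-≡ 0ℤ 0ℤ 0 d ≡.refl))) (λ +p≡0 → ℕP.<⇒≢ 1≤p (≡.sym (ℤP.+-injective +p≡0))))) x-g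
  where
  n : ℤ
  n = + p ℤ.+ g ℤ.* + suc d
  x : ℚ
  x = n ÷ d
  x-g : x ℚ.- floor x ÷ 0 ≡ (+ p) ÷ d
  x-g = ≡.trans (≡.cong (λ k → x ℚ.- k ÷ 0) (≡.trans (floor-÷ n d) (/ℕ-unique n d g p p<d ≡.refl)))
    (≡.trans (÷---integer n d g) (≡.cong (_÷ d) (lem (+ p) (g ℤ.* + suc d))))
    where
    lem : ∀ a b → a ℤ.+ b ℤ.- b ≡ a
    lem = solve-∀
... | inj₂ ≡.refl = ≡.trans (frac-integer x x-g) (÷-≡ 1ℤ (+ suc d) 0 d (≡.trans (ℤP.*-identityˡ (+ suc d)) (≡.sym (ℤP.*-identityʳ (+ suc d)))))
  where
  n : ℤ
  n = + p ℤ.+ g ℤ.* + suc d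
  x : ℚ
  x = n ÷ d
  regroup : ∀ e g → e ℤ.+ g ℤ.* e ≡ 0ℤ ℤ.+ (1ℤ ℤ.+ g) ℤ.* e
  regroup = solve-∀
  x-g : x ℚ.- floor x ÷ 0 ≡ 0ℚ
  x-g = ≡.trans (≡.cong (λ k → x ℚ.- k ÷ 0) (≡.trans (floor-÷ n d) (/ℕ-unique n d (1ℤ ℤ.+ g) 0 (s≤s z≤n) (regroup (+ suc d) g))))
    (≡.trans (÷---integer n d (1ℤ ℤ.+ g)) (≡.trans (≡.cong (_÷ d) (lem (+ suc d) g)) (÷-≡ 0ℤ 0ℤ d 0 ≡.refl)))
    where
    lem : ∀ e g → e ℤ.+ g ℤ.* e ℤ.- (1ℤ ℤ.+ g) ℤ.* e ≡ 0ℤ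
    lem = solve-∀

≼-trans : ∀ {x y z} → x ≼ y → y ≼ z → x ≼ z
≼-trans (inj₁ x<y)         (inj₁ y<z)         = inj₁ (ℚP.<-trans x<y y<z)
≼-trans {x} (inj₁ x<y)     (inj₂ (y≡z , _))   = inj₁ (≡.subst (frac x ℚ.<_) y≡z x<y)
≼-trans {z = z} (inj₂ (x≡y , _)) (inj₁ y<z)   = inj₁ (≡.subst (ℚ._< frac z) (≡.sym x≡y) y<z)
≼-trans (inj₂ (x≡y , y≤x)) (inj₂ (y≡z , z≤y)) = inj₂ (≡.trans x≡y y≡z , ℚP.≤-trans z≤y y≤x)

i≤∣i∣ : ∀ i → i ℤ.≤ + ℤ.∣ i ∣
i≤∣i∣ (+ n)    = ℤP.≤-refl
i≤∣i∣ -[1+ n ] = ℤ.-≤+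

-- A solution k of m ∣ r + s k with 0 ≤ k < m, together with its Christol point; here α = A / d with
-- d = d′ + 1, and p = (k + α) / m = P / d lies in (0, 1].
record Located (d′ m a B : ℕ) (e : ℕ × ℚ) : Set where
  constructor located
  k = proj₁ e
  d = suc d′
  field
    P    : ℕ
    A    : ℤ
    1≤P  : 1 ≤ P
    P≤d  : P ≤ d
    kd+A : + m ℤ.* + P ≡ + k ℤ.* + d ℤ.+ A
    ∣A∣≤ : ℤ.∣ A ∣ ≤ B
  -- The floor of 1 - a α, with α written as A / d.
  F : ℤ
  F = (+ d ℤ.- + a ℤ.* A) ℤD./ℕ d
  field
    point≡ : proj₂ e ≡ (+ P ℤ.+ (ℤ.- F) ℤ.* + d) ÷ d′

module _ {d′ m a B : ℕ} (1≤a : 1 ≤ a) (2B<m : B ℕ.+ B < m) where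

  private
    d = suc d′

    frac-point : ∀ {e} (l : Located d′ m a B e) → frac (proj₂ e) ≡ (+ Located.P l) ÷ d′
    frac-point l = ≡.trans (≡.cong frac point≡) (frac-÷ d′ P (ℤ.- F) 1≤P P≤d)
      where open Located l

    A′<A+m : ∀ {A A′} → ℤ.∣ A ∣ ≤ B → ℤ.∣ A′ ∣ ≤ B → A′ ℤ.< A ℤ.+ + m
    A′<A+m {A} {A′} A≤ A′≤ = begin-strict
      A′                              ≤⟨ i≤∣i∣ A′ ⟩
      + ℤ.∣ A′ ∣                      ≤⟨ ℤ.+≤+ A′≤ ⟩
      + B                             ≡⟨ lem (+ B) ⟩
      ℤ.- (+ B) ℤ.+ (+ B ℤ.+ + B)     <⟨ ℤP.+-monoʳ-< (ℤ.- (+ B)) (ℤ.+<+ 2B<m) ⟩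
      ℤ.- (+ B) ℤ.+ + m               ≤⟨ ℤP.+-monoˡ-≤ (+ m) (ℤP.neg-mono-≤ (ℤ.+≤+ A≤)) ⟩
      ℤ.- (+ ℤ.∣ A ∣) ℤ.+ + m         ≤⟨ ℤP.+-monoˡ-≤ (+ m) (-∣i∣≤i A) ⟩
      A ℤ.+ + m                       ∎
      where
      open ℤP.≤-Reasoning
      lem : ∀ b → b ≡ ℤ.- b ℤ.+ (b ℤ.+ b)
      lem = solve-∀
      -∣i∣≤i : ∀ i → ℤ.- (+ ℤ.∣ i ∣) ℤ.≤ i
      -∣i∣≤i i = ≡.subst (ℤ.- (+ ℤ.∣ i ∣) ℤ.≤_) (ℤP.neg-involutive i)
        (ℤP.neg-mono-≤ (≡.subst (ℤ.- i ℤ.≤_) (≡.cong +_ (ℤP.∣-i∣≡∣i∣ i)) (i≤∣i∣ (ℤ.- i))))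

    -- The difference (k′ - k) d equals m (P′ - P) - (A′ - A), where the first term is at least m
    -- and A′ - A is at most 2B. This is the sense in which m has to be large.
    P<⇒k< : ∀ {e e′} (l : Located d′ m a B e) (l′ : Located d′ m a B e′) → Located.P l < Located.P l′ → proj₁ e < proj₁ e′
    P<⇒k< {k , _} {k′ , _} l l′ P<P′ = ℤP.drop‿+<+ (ℤP.*-cancelʳ-<-nonNeg {+ k} {+ k′} (+ d) (ℤP.≰⇒> λ k′d≤kd → ℤP.<⇒≱ (A′<A+m {L.A} {L′.A} L.∣A∣≤ L′.∣A∣≤) (begin
      L.A ℤ.+ + m                               ≡⟨ lem (+ k ℤ.* + d) L.A (+ m) ⟩
      (+ k ℤ.* + d ℤ.+ L.A) ℤ.+ + m ℤ.- + k ℤ.* + d   ≡⟨ ≡.cong (λ z → z ℤ.+ + m ℤ.- + k ℤ.* + d) L.kd+A ⟨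
      + m ℤ.* + L.P ℤ.+ + m ℤ.- + k ℤ.* + d     ≡⟨ ≡.cong (ℤ._- + k ℤ.* + d) (lem₂ (+ m) (+ L.P)) ⟩
      + m ℤ.* + suc L.P ℤ.- + k ℤ.* + d         ≤⟨ ℤP.+-monoˡ-≤ (ℤ.- (+ k ℤ.* + d)) (ℤP.*-monoˡ-≤-nonNeg (+ m) (ℤ.+≤+ P<P′)) ⟩
      + m ℤ.* + L′.P ℤ.- + k ℤ.* + d            ≡⟨ ≡.cong (ℤ._- + k ℤ.* + d) L′.kd+A ⟩
      + k′ ℤ.* + d ℤ.+ L′.A ℤ.- + k ℤ.* + d     ≤⟨ ℤP.+-monoˡ-≤ (ℤ.- (+ k ℤ.* + d)) (ℤP.+-monoˡ-≤ L′.A k′d≤kd) ⟩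
      + k ℤ.* + d ℤ.+ L′.A ℤ.- + k ℤ.* + d      ≡⟨ lem₃ (+ k ℤ.* + d) L′.A ⟩
      L′.A                                      ∎)))
      where
      open ℤP.≤-Reasoning
      module L = Located l
      module L′ = Located l′
      lem : ∀ x a m → a ℤ.+ m ≡ x ℤ.+ a ℤ.+ m ℤ.- x
      lem = solve-∀
      lem₂ : ∀ m p → m ℤ.* p ℤ.+ m ≡ m ℤ.* (1ℤ ℤ.+ p)
      lem₂ = solve-∀
      lem₃ : ∀ x a → x ℤ.+ a ℤ.- x ≡ a
      lem₃ = solve-∀

    -- If P = P′ then the α's differ by the integer k′ - k, and the floors by a (k′ - k).
    F-difference : ∀ {e e′} (l : Located d′ m a B e) (l′ : Located d′ m a B e′) → Located.P l ≡ Located.P l′ →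
      Located.F l′ ≡ Located.F l ℤ.+ + a ℤ.* (+ proj₁ e′ ℤ.- + proj₁ e)
    F-difference {k , _} {k′ , _} l l′ P≡P′ = ≡.trans (≡.cong (ℤD._/ℕ d) n′≡) (/ℕ-+-multiple (+ d ℤ.- + a ℤ.* L.A) d′ (+ a ℤ.* (+ k′ ℤ.- + k)))
      where
      module L = Located l
      module L′ = Located l′
      A′≡ : L′.A ≡ L.A ℤ.- (+ k′ ℤ.- + k) ℤ.* + d
      A′≡ = ≡.trans (lem₁ (+ k′ ℤ.* + d) L′.A) (≡.trans (≡.cong (ℤ._- + k′ ℤ.* + d)
        (≡.trans (≡.sym L′.kd+A) (≡.trans (≡.cong (λ p → + m ℤ.* + p) (≡.sym P≡P′)) L.kd+A))) (lem₂ (+ k) (+ k′) (+ d) L.A))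
        where
        lem₁ : ∀ x a → a ≡ x ℤ.+ a ℤ.- x
        lem₁ = solve-∀
        lem₂ : ∀ k k′ d A → k ℤ.* d ℤ.+ A ℤ.- k′ ℤ.* d ≡ A ℤ.- (k′ ℤ.- k) ℤ.* d
        lem₂ = solve-∀
      n′≡ : + d ℤ.- + a ℤ.* L′.A ≡ + d ℤ.- + a ℤ.* L.A ℤ.+ + a ℤ.* (+ k′ ℤ.- + k) ℤ.* + d
      n′≡ = ≡.trans (≡.cong (λ A → + d ℤ.- + a ℤ.* A) A′≡) (lem (+ d) (+ a) L.A (+ k′ ℤ.- + k))
        where
        lem : ∀ d a A j → d ℤ.- a ℤ.* (A ℤ.- j ℤ.* d) ≡ d ℤ.- a ℤ.* A ℤ.+ a ℤ.* j ℤ.* d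
        lem = solve-∀

    numerator : ℤ → ℕ → ℤ
    numerator F P = + P ℤ.+ (ℤ.- F) ℤ.* + d

    numerator-≤ : ∀ P {F F′} → F ℤ.≤ F′ → numerator F′ P ℤ.≤ numerator F P
    numerator-≤ P F≤F′ = ℤP.+-monoʳ-≤ (+ P) (ℤP.*-monoʳ-≤-nonNeg (+ d) (ℤP.neg-mono-≤ F≤F′))

    numerator-< : ∀ P {F F′} → F ℤ.< F′ → numerator F′ P ℤ.< numerator F P
    numerator-< P F<F′ = ℤP.+-monoʳ-< (+ P) (ℤP.*-monoʳ-<-pos (+ d) (ℤP.neg-mono-< F<F′))

  -- Different P's are ordered as the k's. For equal P's a larger k means a smaller α, hence a
  -- larger floor of 1 - a α and a smaller point, which the Christol order places later.
  k≤⇒≼ : ∀ {e e′} → Located d′ m a B e → Located d′ m a B e′ → proj₁ e ≤ proj₁ e′ → proj₂ e ≼ proj₂ e′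
  k≤⇒≼ {k , _} {k′ , _} l l′ k≤k′ with ℕP.<-cmp (Located.P l) (Located.P l′)
  ... | tri< P<P′ _ _ = inj₁ (≡.subst₂ ℚ._<_ (≡.sym (frac-point l)) (≡.sym (frac-point l′)) (÷-< d′ (ℤ.+<+ P<P′)))
  ... | tri> _ _ P′<P = contradiction k≤k′ (ℕP.<⇒≱ (P<⇒k< l′ l P′<P))
  ... | tri≈ _ P≡P′ _ = inj₂ (≡.trans (frac-point l) (≡.trans (≡.cong (λ p → (+ p) ÷ d′) P≡P′) (≡.sym (frac-point l′))) ,
      ≡.subst₂ ℚ._≤_ (≡.sym (≡.trans L′.point≡ (≡.cong (λ p → numerator L′.F p ÷ d′) (≡.sym P≡P′)))) (≡.sym L.point≡)
        (÷-≤ d′ (numerator-≤ L.P F≤F′)))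
      where
      module L = Located l
      module L′ = Located l′
      F≤F′ : L.F ℤ.≤ L′.F
      F≤F′ = ≡.subst (L.F ℤ.≤_) (≡.sym (F-difference l l′ P≡P′)) (≡.subst (ℤ._≤ L.F ℤ.+ + a ℤ.* (+ k′ ℤ.- + k)) (ℤP.+-identityʳ L.F)
        (ℤP.+-monoʳ-≤ L.F (≡.subst (ℤ._≤ + a ℤ.* (+ k′ ℤ.- + k)) (ℤP.*-zeroʳ (+ a))
          (ℤP.*-monoˡ-≤-nonNeg (+ a) (ℤP.i≤j⇒0≤j-i (ℤ.+≤+ k≤k′))))))

  -- For equal P's, a ≥ 1 makes the floor strictly increasing in k, so the points of different k's
  -- stay distinct and their order determines that of the k's.
  ≼⇒k≤ : ∀ {e e′} → Located d′ m a B e → Located d′ m a B e′ → proj₂ e ≼ proj₂ e′ → proj₁ e ≤ proj₁ e′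
  ≼⇒k≤ {k , _} {k′ , _} l l′ (inj₁ frac<) = ℕP.<⇒≤ (P<⇒k< l l′ (ℕP.≰⇒> λ P′≤P →
    ℚP.<-irrefl ≡.refl (ℚP.<-≤-trans (≡.subst₂ ℚ._<_ (frac-point l) (frac-point l′) frac<) (÷-≤ d′ (ℤ.+≤+ P′≤P)))))
  ≼⇒k≤ {k , _} {k′ , _} l l′ (inj₂ (frac≡ , pt′≤pt)) = ℕP.≮⇒≥ λ k′<k →
    ℚP.<-irrefl ≡.refl (ℚP.<-≤-trans (÷-< d′ (numerator-< L.P (F′<F k′<k)))
      (≡.subst₂ ℚ._≤_ (≡.trans L′.point≡ (≡.cong (λ p → numerator L′.F p ÷ d′) (≡.sym P≡P′))) L.point≡ pt′≤pt))
    where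
    module L = Located l
    module L′ = Located l′
    P≡P′ : L.P ≡ L′.P
    P≡P′ = ℤP.+-injective (÷-injective d′ (≡.trans (≡.sym (frac-point l)) (≡.trans frac≡ (frac-point l′))))
    F′<F : k′ < k → L′.F ℤ.< L.F
    F′<F k′<k = ≡.subst (L′.F ℤ.<_) (≡.sym (F-difference l′ l (≡.sym P≡P′))) (≡.subst (ℤ._< L′.F ℤ.+ + a ℤ.* (+ k ℤ.- + k′)) (ℤP.+-identityʳ L′.F)
        (ℤP.+-monoʳ-< L′.F (≡.subst (ℤ._< + a ℤ.* (+ k ℤ.- + k′)) (ℤP.*-zeroʳ (+ a))
          (ℤP.*-monoˡ-<-pos (+ a) {{ℤ.positive (ℤ.+<+ 1≤a)}} (≡.subst (ℤ._< + k ℤ.- + k′) (ℤP.+-inverseʳ (+ k′)) (ℤP.+-monoˡ-< (ℤ.- (+ k′)) (ℤ.+<+ k′<k)))))))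

-- Comparison of counts along the two orders.

count : ∀ {A : Set} → (A → Bool) → List A → ℕ
count P []      = 0
count P (x ∷ l) = count P l ℕ.+ bit (P x)

count-cong : ∀ {A : Set} {P Q : A → Bool} {l} → All (λ x → P x ≡ Q x) l → count P l ≡ count Q l
count-cong []         = ≡.refl
count-cong (eq ∷ eqs) = ≡.cong₂ (λ c b → c ℕ.+ bit b) (count-cong eqs) eq

count-false : ∀ {A : Set} {P : A → Bool} {l} → All (λ x → P x ≡ false) l → count P l ≡ 0
count-false []         = ≡.refl
count-false (eq ∷ eqs) = ≡.cong₂ (λ c b → c ℕ.+ bit b) (count-false eqs) eq

count-++ : ∀ {A : Set} (P : A → Bool) l l′ → count P (l ++ l′) ≡ count P l ℕ.+ count P l′
count-++ P []      l′ = ≡.refl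
count-++ P (x ∷ l) l′ = ≡.trans (≡.cong (ℕ._+ bit (P x)) (count-++ P l l′)) (lem (count P l) (count P l′) (bit (P x)))
  where
  lem : ∀ a b c → a ℕ.+ b ℕ.+ c ≡ a ℕ.+ c ℕ.+ b
  lem = ℕR.solve-∀

count-applyDownFrom : ∀ {A : Set} (P : A → Bool) f n → count P (applyDownFrom f n) ≡ countBelow n (λ i → P (f i))
count-applyDownFrom P f zero    = ≡.refl
count-applyDownFrom P f (suc n) = ≡.cong (ℕ._+ bit (P (f n))) (count-applyDownFrom P f n)

collect : ∀ {A : Set} v → (Fin v → List A) → List A
collect zero    F = []
collect (suc v) F = F Fin.zero ++ collect v (λ i → F (Fin.suc i))

count-collect : ∀ {A : Set} (P : A → Bool) v F → count P (collect v F) ≡ sumFin v (λ i → count P (F i))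
count-collect P zero    F = ≡.refl
count-collect P (suc v) F = ≡.trans (count-++ P (F Fin.zero) _) (≡.cong (count P (F Fin.zero) ℕ.+_) (count-collect P v _))

All-collect : ∀ {A : Set} {Q : A → Set} v {F : Fin v → List A} → (∀ i → All Q (F i)) → All Q (collect v F)
All-collect zero    allF = []
All-collect (suc v) allF = AllP.++⁺ (allF Fin.zero) (All-collect v (λ i → allF (Fin.suc i)))

maximum∨none : ∀ {A : Set} {Q : A → Set} (f : A → ℕ) (P : A → Bool) {l} → All Q l →
  All (λ x → P x ≡ false) l ⊎ (∃ λ x → Q x × P x ≡ true × All (λ y → P y ≡ true → f y ≤ f x) l)
maximum∨none f P [] = inj₁ []
maximum∨none {Q = Q} f P {x ∷ l} (qx ∷ ql) = go (P x) ≡.refl (maximum∨none f P ql)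
  where
  go : ∀ b → P x ≡ b → All (λ x → P x ≡ false) l ⊎ (∃ λ z → Q z × P z ≡ true × All (λ y → P y ≡ true → f y ≤ f z) l) →
    All (λ x → P x ≡ false) (x ∷ l) ⊎ (∃ λ z → Q z × P z ≡ true × All (λ y → P y ≡ true → f y ≤ f z) (x ∷ l))
  go false Px (inj₁ none) = inj₁ (Px ∷ none)
  go true  Px (inj₁ none) = inj₂ (x , qx , Px , (λ _ → ℕP.≤-refl) ∷
    All.map (λ Py≡false Py≡true → contradiction (≡.trans (≡.sym Py≡true) Py≡false) λ ()) none)
  go false Px (inj₂ (z , qz , Pz , max)) = inj₂ (z , qz , Pz , (λ Px≡true → contradiction (≡.trans (≡.sym Px≡true) Px) λ ()) ∷ max)
  go true  Px (inj₂ (z , qz , Pz , max)) with ℕP.≤-total (f x) (f z)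
  ... | inj₁ fx≤fz = inj₂ (z , qz , Pz , (λ _ → fx≤fz) ∷ max)
  ... | inj₂ fz≤fx = inj₂ (x , qx , Px , (λ _ → ℕP.≤-refl) ∷ All.map (λ le Py → ℕP.≤-trans (le Py) fz≤fx) max)

module _ {d′ m a B : ℕ} (1≤a : 1 ≤ a) (2B<m : B ℕ.+ B < m) {N D : List (ℕ × ℚ)}
  (locN : All (Located d′ m a B) N) (locD : All (Located d′ m a B) D) where

  private
    countK : ℕ → List (ℕ × ℚ) → ℕ
    countK n = count (λ e → does (proj₁ e ℕ.<? n))
    countX : ℚ → List (ℕ × ℚ) → ℕ
    countX x = count (λ e → does (proj₂ e ≼? x))

  -- The entries with point at or before x are an initial segment for k. If it is nonempty, its
  -- largest k, taken over both lists at once, gives a common threshold n = k + 1.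
  countK≥⇒countX≥ : (∀ n → countK n D ≤ countK n N) → ∀ x → countX x D ≤ countX x N
  countK≥⇒countX≥ h x with maximum∨none proj₁ (λ e → does (proj₂ e ≼? x)) (AllP.++⁺ locN locD)
  ... | inj₁ none = ℕP.≤-trans (ℕP.≤-reflexive (count-false (AllP.++⁻ʳ N none))) z≤n
  ... | inj₂ (e₀ , l₀ , e₀≼x , max) = ≡.subst₂ _≤_ (same locD (AllP.++⁻ʳ N max)) (same locN (AllP.++⁻ˡ N max)) (h (suc (proj₁ e₀)))
    where
    same : ∀ {L} → All (Located d′ m a B) L → All (λ e → does (proj₂ e ≼? x) ≡ true → proj₁ e ≤ proj₁ e₀) L → countK (suc (proj₁ e₀)) L ≡ countX x L
    same loc mx = count-cong (All.zipWith (λ {e} (l , le) → does-≡ (proj₁ e ℕ.<? suc (proj₁ e₀)) (proj₂ e ≼? x)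
      (λ { (s≤s k≤k₀) → ≼-trans {proj₂ e} {proj₂ e₀} {x} (k≤⇒≼ 1≤a 2B<m l l₀ k≤k₀) (from-does (proj₂ e₀ ≼? x) e₀≼x) })
      (λ e≼x → s≤s (le (dec-true (proj₂ e ≼? x) e≼x)))) (loc , mx))

  -- Conversely, the entries with k < n are those whose point comes no later than the point of the
  -- last such entry, so the points themselves serve as test values x.
  countX≥⇒countK≥ : (∀ x → countX x D ≤ countX x N) → ∀ n → countK n D ≤ countK n N
  countX≥⇒countK≥ h n with maximum∨none proj₁ (λ e → does (proj₁ e ℕ.<? n)) (AllP.++⁺ locN locD)
  ... | inj₁ none = ℕP.≤-trans (ℕP.≤-reflexive (count-false (AllP.++⁻ʳ N none))) z≤n
  ... | inj₂ (e₀ , l₀ , k₀<n , max) = ≡.subst₂ _≤_ (same locD (AllP.++⁻ʳ N max)) (same locN (AllP.++⁻ˡ N max)) (h (proj₂ e₀))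
    where
    same : ∀ {L} → All (Located d′ m a B) L → All (λ e → does (proj₁ e ℕ.<? n) ≡ true → proj₁ e ≤ proj₁ e₀) L → countX (proj₂ e₀) L ≡ countK n L
    same loc mx = count-cong (All.zipWith (λ {e} (l , le) → does-≡ (proj₂ e ≼? proj₂ e₀) (proj₁ e ℕ.<? n)
      (λ e≼e₀ → ℕP.≤-<-trans (≼⇒k≤ 1≤a 2B<m l l₀ e≼e₀) (from-does (proj₁ e₀ ℕ.<? n) k₀<n))
      (λ k<n → k≤⇒≼ 1≤a 2B<m l l₀ (le (dec-true (proj₁ e ℕ.<? n) k<n)))) (loc , mx))

-- Bounded search and the solution e of b e ≡ c modulo s.

-- Positivity is recorded for failed searches as well, whose default value is 1; this provides a ≥
-- 1.
record SearchResult (P : ℕ → Bool) (k m x : ℕ) : Set where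
  constructor searchResult
  field
    positive : 1 ≤ x
    finds    : (∃ λ e → k ≤ e × e < k ℕ.+ m × P e ≡ true) → P x ≡ true

found : ∀ {P k m} → 1 ≤ k → P k ≡ true → SearchResult P k m k
found 1≤k Pk = searchResult 1≤k λ _ → Pk

skip : ∀ {P k m x} → P k ≡ false → SearchResult P (suc k) m x → SearchResult P k (suc m) x
skip {P} {k} {m} ¬Pk (searchResult 1≤x Px) = searchResult 1≤x λ where
  (e , k≤e , e<k+m , Pe) → Px (e , ℕP.≤∧≢⇒< k≤e (λ { ≡.refl → contradiction (≡.trans (≡.sym ¬Pk) Pe) λ () }) ,
    ≡.subst (e <_) (ℕP.+-suc k m) e<k+m , Pe)

empty : ∀ {P k} → SearchResult P k 0 1
empty {P} {k} = searchResult (s≤s z≤n) λ { (e , k≤e , e<k , _) → contradiction k≤e (ℕP.<⇒≱ (≡.subst (e <_) (ℕP.+-identityʳ k) e<k)) }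

-- The search loop is local to firstUpTo; the underscore in the type of search names it.
mutual
  search : ∀ n (P : ℕ → Bool) m k → 1 ≤ k → SearchResult P k m _

  firstUpTo-tail : ∀ n P → P 1 ≡ false → 1 ≤ 2 → SearchResult P 2 n (firstUpTo (suc n) P)
  firstUpTo-tail n P ¬P1 rewrite ¬P1 with suc n | 2
  ... | n′ | k = search n′ P n k

  search n P zero    k 1≤k = empty
  search n P (suc m) k 1≤k with P k in eq
  ... | true  = found {P} 1≤k eq
  ... | false = skip {P} eq (search n P m (suc k) (s≤s z≤n))

firstUpTo-result : ∀ n P → SearchResult P 1 n (firstUpTo n P)
firstUpTo-result zero    P = empty
firstUpTo-result (suc n) P with P 1 in eq | firstUpTo-tail n P
... | true  | _    = found {P} ℕP.≤-refl eq
... | false | tail = skip {P} eq (tail ≡.refl (s≤s z≤n))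

firstUpTo-finds : ∀ n P → (∃ λ e → 1 ≤ e × e ≤ n × P e ≡ true) → P (firstUpTo n P) ≡ true
firstUpTo-finds n P (e , 1≤e , e≤n , Pe) = SearchResult.finds (firstUpTo-result n P) (e , 1≤e , s≤s e≤n , Pe)

mod-difference : ∀ x y s′ → x % suc s′ ≡ y % suc s′ → ∃ λ G → + x ≡ + y ℤ.+ G ℤ.* + suc s′
mod-difference x y s′ eq = + x/s ℤ.- + y/s , (begin
    + x                                                        ≡⟨ split x ⟩
    + (x % s) ℤ.+ + x/s ℤ.* + s                                ≡⟨ ≡.cong (λ k → + k ℤ.+ + x/s ℤ.* + s) eq ⟩
    + (y % s) ℤ.+ + x/s ℤ.* + s                                ≡⟨ lem (+ (y % s)) (+ x/s) (+ y/s) (+ s) ⟩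
    + (y % s) ℤ.+ + y/s ℤ.* + s ℤ.+ (+ x/s ℤ.- + y/s) ℤ.* + s  ≡⟨ ≡.cong (λ k → k ℤ.+ (+ x/s ℤ.- + y/s) ℤ.* + s) (split y) ⟨
    + y ℤ.+ (+ x/s ℤ.- + y/s) ℤ.* + s                          ∎)
  where
  open ≡.≡-Reasoning
  s = suc s′
  x/s = x ℕM./ s
  y/s = y ℕM./ s
  split : ∀ x → + x ≡ + (x % s) ℤ.+ + (x ℕM./ s) ℤ.* + s
  split x = ≡.trans (≡.cong +_ (ℕM.m≡m%n+[m/n]*n x s)) (≡.cong (λ k → + (x % s) ℤ.+ k) (ℤP.pos-* (x ℕM./ s) s))
  lem : ∀ y u v s → y ℤ.+ u ℤ.* s ≡ y ℤ.+ v ℤ.* s ℤ.+ (u ℤ.- v) ℤ.* s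
  lem = solve-∀

modular-bezout : ∀ s′ b → ∃ λ e → 1 ≤ e × e ≤ suc s′ × (b ℕ.* e) % suc s′ ≡ ℕG.gcd (suc s′) b % suc s′
modular-bezout s′ b = reduce (any (ℕG.Bézout.identity (ℕG.gcd-GCD s b)))
  where
  open ≡.≡-Reasoning
  s = suc s′
  c = ℕG.gcd s b
  any : ℕG.Bézout.Identity c s b → ∃ λ e → (b ℕ.* e) % s ≡ c % s
  any (ℕG.Bézout.-+ x y eq) = y , (begin
    (b ℕ.* y) % s         ≡⟨ ≡.cong (_% s) (≡.trans (ℕP.*-comm b y) (≡.sym eq)) ⟩
    (c ℕ.+ x ℕ.* s) % s   ≡⟨ ℕM.[m+kn]%n≡m%n c x s ⟩
    c % s                 ∎)
  -- The coefficient of b would be - y; it is replaced by y (s - 1), which is congruent to it modulo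
  -- s.
  any (ℕG.Bézout.+- x y eq) = y ℕ.* s′ , (begin
    (b ℕ.* (y ℕ.* s′)) % s                              ≡⟨ ℕM.[m+kn]%n≡m%n (b ℕ.* (y ℕ.* s′)) x s ⟨
    (b ℕ.* (y ℕ.* s′) ℕ.+ x ℕ.* s) % s                  ≡⟨ ≡.cong (λ k → (b ℕ.* (y ℕ.* s′) ℕ.+ k) % s) eq ⟨
    (b ℕ.* (y ℕ.* s′) ℕ.+ (c ℕ.+ y ℕ.* b)) % s          ≡⟨ ≡.cong (_% s) (lem b y s′ c) ⟩
    (c ℕ.+ y ℕ.* b ℕ.* suc s′) % s                      ≡⟨ ℕM.[m+kn]%n≡m%n c (y ℕ.* b) s ⟩
    c % s                                               ∎)
    where
    lem : ∀ b y s c → b ℕ.* (y ℕ.* s) ℕ.+ (c ℕ.+ y ℕ.* b) ≡ c ℕ.+ y ℕ.* b ℕ.* (1 ℕ.+ s)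
    lem = ℕR.solve-∀
  reduce : (∃ λ e → (b ℕ.* e) % s ≡ c % s) → ∃ λ e → 1 ≤ e × e ≤ s × (b ℕ.* e) % s ≡ c % s
  -- Adding s - 1 before the reduction and 1 after it yields a representative in 1, ..., s instead
  -- of 0, ..., s - 1.
  reduce (e , eq) = suc ((e ℕ.+ s′) % s) , s≤s z≤n , ℕM.m%n<n (e ℕ.+ s′) s , (begin
    (b ℕ.* suc ((e ℕ.+ s′) % s)) % s                    ≡⟨ ℕM.[m+kn]%n≡m%n (b ℕ.* suc ((e ℕ.+ s′) % s)) (b ℕ.* k) s ⟨
    (b ℕ.* suc ((e ℕ.+ s′) % s) ℕ.+ b ℕ.* k ℕ.* s) % s  ≡⟨ ≡.cong (_% s) (lem b ((e ℕ.+ s′) % s) k s) ⟩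
    (b ℕ.* suc ((e ℕ.+ s′) % s ℕ.+ k ℕ.* s)) % s        ≡⟨ ≡.cong (λ i → (b ℕ.* suc i) % s) (ℕM.m≡m%n+[m/n]*n (e ℕ.+ s′) s) ⟨
    (b ℕ.* suc (e ℕ.+ s′)) % s                          ≡⟨ ≡.cong (_% s) (lem₂ b e s′) ⟩
    (b ℕ.* e ℕ.+ b ℕ.* s) % s                           ≡⟨ ℕM.[m+kn]%n≡m%n (b ℕ.* e) b s ⟩
    (b ℕ.* e) % s                                       ≡⟨ eq ⟩
    c % s                                               ∎)
    where
    k = (e ℕ.+ s′) ℕM./ s
    lem : ∀ b x k s → b ℕ.* (1 ℕ.+ x) ℕ.+ b ℕ.* k ℕ.* s ≡ b ℕ.* (1 ℕ.+ (x ℕ.+ k ℕ.* s))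
    lem = ℕR.solve-∀
    lem₂ : ∀ b e s → b ℕ.* (1 ℕ.+ (e ℕ.+ s)) ≡ b ℕ.* e ℕ.+ b ℕ.* (1 ℕ.+ s)
    lem₂ = ℕR.solve-∀

eOf-spec : ∀ r s′ b → ℕG.gcd (suc s′) b ≡ cOf r (+ suc s′) b →
  ∃ λ G → + b ℤ.* + eOf r (+ suc s′) b ≡ + cOf r (+ suc s′) b ℤ.+ G ℤ.* + suc s′
eOf-spec r s′ b g≡c = proj₁ diff , ≡.trans (≡.sym (ℤP.pos-* b _)) (proj₂ diff)
  where
  c = cOf r (+ suc s′) b
  test : ℕ → Bool
  test e = modEqᵇ (b ℕ.* e) c (suc s′)
  found-e : test (eOf r (+ suc s′) b) ≡ true
  found-e = firstUpTo-finds (suc s′) test (let (e , 1≤e , e≤s , eq) = modular-bezout s′ b in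
    e , 1≤e , e≤s , dec-true ((b ℕ.* e) % suc s′ ℕ.≟ c % suc s′) (≡.trans eq (≡.cong (_% suc s′) g≡c)))
  diff = mod-difference (b ℕ.* eOf r (+ suc s′) b) c s′ (from-does ((b ℕ.* eOf r (+ suc s′) b) % suc s′ ℕ.≟ c % suc s′) found-e)

-- The Christol points over the common denominator d.

integer-* : ∀ n a d → n ÷ 0 ℚ.* a ÷ d ≡ (n ℤ.* a) ÷ d
integer-* n a d = ≡.trans (÷-* n 0 a d) (≡.cong ((n ℤ.* a) ÷_) (ℕP.+-identityʳ d))

floor-1- : ∀ a r s′ d′ w → suc d′ ≡ suc s′ ℕ.* w →
  floor (1ℚ ℚ.- (+ a) ÷ 0 ℚ.* r ÷ s′) ≡ (+ suc d′ ℤ.- + a ℤ.* (r ℤ.* + w)) ℤD./ℕ suc d′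
floor-1- a r s′ d′ w d≡sw = ≡.trans (≡.cong floor value) (floor-÷ n d′)
  where
  n = + suc d′ ℤ.- + a ℤ.* (r ℤ.* + w)
  value : 1ℚ ℚ.- (+ a) ÷ 0 ℚ.* r ÷ s′ ≡ n ÷ d′
  value = begin
    1ℚ ℚ.- (+ a) ÷ 0 ℚ.* r ÷ s′                            ≡⟨ ≡.cong (λ y → 1ℚ ℚ.- y) (integer-* (+ a) r s′) ⟩
    1ℚ ℚ.- (+ a ℤ.* r) ÷ s′                                ≡⟨ ℚP.+-comm 1ℚ (ℚ.- ((+ a ℤ.* r) ÷ s′)) ⟩
    ℚ.- ((+ a ℤ.* r) ÷ s′) ℚ.+ 1ℤ ÷ 0                      ≡⟨ ≡.cong (ℚ._+ 1ℤ ÷ 0) (-‿÷ (+ a ℤ.* r) s′) ⟩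
    (ℤ.- (+ a ℤ.* r)) ÷ s′ ℚ.+ 1ℤ ÷ 0                      ≡⟨ ÷-+-integer (ℤ.- (+ a ℤ.* r)) s′ 1ℤ ⟩
    (ℤ.- (+ a ℤ.* r) ℤ.+ 1ℤ ℤ.* + suc s′) ÷ s′             ≡⟨ ÷-≡ (ℤ.- (+ a ℤ.* r) ℤ.+ 1ℤ ℤ.* + suc s′) n s′ d′ cross ⟩
    n ÷ d′                                                 ∎
    where
    open ≡.≡-Reasoning
    lem : ∀ a r s w → (ℤ.- (a ℤ.* r) ℤ.+ 1ℤ ℤ.* s) ℤ.* (s ℤ.* w) ≡ (s ℤ.* w ℤ.- a ℤ.* (r ℤ.* w)) ℤ.* s
    lem = solve-∀
    d≡ : + suc d′ ≡ + suc s′ ℤ.* + w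
    d≡ = ≡.trans (≡.cong +_ d≡sw) (ℤP.pos-* (suc s′) w)
    cross : (ℤ.- (+ a ℤ.* r) ℤ.+ 1ℤ ℤ.* + suc s′) ℤ.* + suc d′ ≡ n ℤ.* + suc s′
    cross = ≡.trans (≡.cong ((ℤ.- (+ a ℤ.* r) ℤ.+ 1ℤ ℤ.* + suc s′) ℤ.*_) d≡) (≡.trans (lem (+ a) r (+ suc s′) (+ w))
      (≡.cong (λ d → (d ℤ.- + a ℤ.* (r ℤ.* + w)) ℤ.* + suc s′) (≡.sym d≡)))

-- With r = r₁ c and s = s₁ c the fractional part of e r / s is ρ₀ / s₁. Adding z and dividing by c
-- gives (ρ₀ + z s₁) / s, and w expands the denominator from s to d.
point-value : ∀ {e c′ r s′ s₁ r₁ ρ₀ T d′ w} a z →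
  suc s′ ≡ s₁ ℕ.* suc c′ → r ≡ r₁ ℤ.* + suc c′ → + e ℤ.* r₁ ≡ + ρ₀ ℤ.+ T ℤ.* + s₁ → 1 ≤ ρ₀ → ρ₀ ≤ s₁ →
  suc d′ ≡ suc s′ ℕ.* w →
  divℕ (frac ((+ e) ÷ 0 ℚ.* r ÷ s′) ℚ.+ (+ z) ÷ 0) (suc c′) ℚ.- floor (1ℚ ℚ.- (+ a) ÷ 0 ℚ.* r ÷ s′) ÷ 0
    ≡ (+ ((ρ₀ ℕ.+ z ℕ.* s₁) ℕ.* w) ℤ.+ (ℤ.- ((+ suc d′ ℤ.- + a ℤ.* (r ℤ.* + w)) ℤD./ℕ suc d′)) ℤ.* + suc d′) ÷ d′
point-value {e} {c′} {r} {s′} {s₁} {r₁} {ρ₀} {T} {d′} {w} a z s≡ r≡ er₁≡ 1≤ρ₀ ρ₀≤s₁ d≡ = begin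
  divℕ (frac ((+ e) ÷ 0 ℚ.* r ÷ s′) ℚ.+ (+ z) ÷ 0) c ℚ.- floor (1ℚ ℚ.- (+ a) ÷ 0 ℚ.* r ÷ s′) ÷ 0
    ≡⟨ ≡.cong₂ (λ f g → divℕ (f ℚ.+ (+ z) ÷ 0) c ℚ.- g ÷ 0) frac≡ (floor-1- a r s′ d′ w d≡) ⟩
  divℕ ((+ (c ℕ.* ρ₀)) ÷ s′ ℚ.+ (+ z) ÷ 0) c ℚ.- F ÷ 0
    ≡⟨ ≡.cong (λ f → divℕ f c ℚ.- F ÷ 0) (÷-+-integer (+ (c ℕ.* ρ₀)) s′ (+ z)) ⟩
  divℕ (n ÷ s′) c ℚ.- F ÷ 0
    ≡⟨ ≡.cong (ℚ._- F ÷ 0) (≡.trans (÷-* n s′ 1ℤ c′) (÷-≡ (n ℤ.* 1ℤ) (+ P) (c′ ℕ.+ s′ ℕ.* suc c′) d′ cross)) ⟩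
  (+ P) ÷ d′ ℚ.- F ÷ 0
    ≡⟨ ÷---integer (+ P) d′ F ⟩
  (+ P ℤ.- F ℤ.* + suc d′) ÷ d′
    ≡⟨ ≡.cong (λ k → (+ P ℤ.+ k) ÷ d′) (ℤP.neg-distribˡ-* F (+ suc d′)) ⟩
  (+ P ℤ.+ (ℤ.- F) ℤ.* + suc d′) ÷ d′ ∎
  where
  open ≡.≡-Reasoning
  c = suc c′
  P = (ρ₀ ℕ.+ z ℕ.* s₁) ℕ.* w
  F = (+ suc d′ ℤ.- + a ℤ.* (r ℤ.* + w)) ℤD./ℕ suc d′
  n = + (c ℕ.* ρ₀) ℤ.+ + z ℤ.* + suc s′
  er≡ : + e ℤ.* r ≡ + (c ℕ.* ρ₀) ℤ.+ T ℤ.* + suc s′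
  er≡ = begin
    + e ℤ.* r                                   ≡⟨ ≡.cong (+ e ℤ.*_) r≡ ⟩
    + e ℤ.* (r₁ ℤ.* + c)                        ≡⟨ ℤP.*-assoc (+ e) r₁ (+ c) ⟨
    + e ℤ.* r₁ ℤ.* + c                          ≡⟨ ≡.cong (ℤ._* + c) er₁≡ ⟩
    (+ ρ₀ ℤ.+ T ℤ.* + s₁) ℤ.* + c               ≡⟨ lem (+ ρ₀) T (+ s₁) (+ c) ⟩
    + c ℤ.* + ρ₀ ℤ.+ T ℤ.* (+ s₁ ℤ.* + c)       ≡⟨ ≡.cong₂ (λ x y → x ℤ.+ T ℤ.* y) (ℤP.pos-* c ρ₀) (≡.trans (≡.cong +_ s≡) (ℤP.pos-* s₁ c)) ⟨
    + (c ℕ.* ρ₀) ℤ.+ T ℤ.* + suc s′             ∎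
    where
    lem : ∀ p T s c → (p ℤ.+ T ℤ.* s) ℤ.* c ≡ c ℤ.* p ℤ.+ T ℤ.* (s ℤ.* c)
    lem = solve-∀
  frac≡ : frac ((+ e) ÷ 0 ℚ.* r ÷ s′) ≡ (+ (c ℕ.* ρ₀)) ÷ s′
  frac≡ = ≡.trans (≡.cong frac (≡.trans (integer-* (+ e) r s′) (≡.cong (_÷ s′) er≡)))
    (frac-÷ s′ (c ℕ.* ρ₀) T (ℕP.*-mono-≤ (s≤s (z≤n {c′})) 1≤ρ₀)
      (ℕP.≤-trans (ℕP.*-monoʳ-≤ c ρ₀≤s₁) (ℕP.≤-reflexive (≡.trans (ℕP.*-comm c s₁) (≡.sym s≡)))))
  cross : n ℤ.* 1ℤ ℤ.* + suc d′ ≡ + P ℤ.* + (suc s′ ℕ.* c)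
  cross = begin
    n ℤ.* 1ℤ ℤ.* + suc d′                               ≡⟨ ≡.cong₂ ℤ._*_ (≡.trans (ℤP.*-identityʳ n) (≡.cong₂ ℤ._+_ (≡.refl {x = + (c ℕ.* ρ₀)}) (≡.sym (ℤP.pos-* z (suc s′))))) (≡.cong +_ d≡) ⟩
    + (c ℕ.* ρ₀ ℕ.+ z ℕ.* suc s′) ℤ.* + (suc s′ ℕ.* w)  ≡⟨ ℤP.pos-* (c ℕ.* ρ₀ ℕ.+ z ℕ.* suc s′) (suc s′ ℕ.* w) ⟨
    + ((c ℕ.* ρ₀ ℕ.+ z ℕ.* suc s′) ℕ.* (suc s′ ℕ.* w))  ≡⟨ ≡.cong (λ s → + ((c ℕ.* ρ₀ ℕ.+ z ℕ.* s) ℕ.* (suc s′ ℕ.* w))) s≡ ⟩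
    + ((c ℕ.* ρ₀ ℕ.+ z ℕ.* (s₁ ℕ.* c)) ℕ.* (suc s′ ℕ.* w)) ≡⟨ ≡.cong +_ (lem c ρ₀ z s₁ (suc s′) w) ⟩
    + (P ℕ.* (suc s′ ℕ.* c))                            ≡⟨ ℤP.pos-* P (suc s′ ℕ.* c) ⟩
    + P ℤ.* + (suc s′ ℕ.* c)                            ∎
    where
    lem : ∀ c p z s t w → (c ℕ.* p ℕ.+ z ℕ.* (s ℕ.* c)) ℕ.* (t ℕ.* w) ≡ (p ℕ.+ z ℕ.* s) ℕ.* w ℕ.* (t ℕ.* c)
    lem = ℕR.solve-∀

-- Solutions k of m ∣ r + s k within one period.

countBelow-point : ∀ n k₀ {P} → (∀ k → k < n → P k ≡ does (k ℕ.≟ k₀)) → countBelow n P ≡ bit (does (k₀ ℕ.<? n))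
countBelow-point zero    k₀ P≡ = ≡.refl
countBelow-point (suc n) k₀ {P} P≡ = ≡.trans
  (≡.cong₂ (λ c b → c ℕ.+ bit b) (countBelow-point n k₀ (λ k k<n → P≡ k (ℕP.m<n⇒m<1+n k<n))) (P≡ n ℕP.≤-refl))
  (step (ℕP.<-cmp k₀ n))
  where
  step : _ → bit (does (k₀ ℕ.<? n)) ℕ.+ bit (does (n ℕ.≟ k₀)) ≡ bit (does (k₀ ℕ.<? suc n))
  step (tri< k₀<n _ _) = ≡.trans (≡.cong₂ (λ x y → bit x ℕ.+ bit y) (dec-true (k₀ ℕ.<? n) k₀<n) (dec-false (n ℕ.≟ k₀) (ℕP.>⇒≢ k₀<n)))
    (≡.cong bit (≡.sym (dec-true (k₀ ℕ.<? suc n) (ℕP.m<n⇒m<1+n k₀<n))))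
  step (tri≈ k₀≮n k₀≡n _) = ≡.trans (≡.cong₂ (λ x y → bit x ℕ.+ bit y) (dec-false (k₀ ℕ.<? n) k₀≮n) (dec-true (n ℕ.≟ k₀) (≡.sym k₀≡n)))
    (≡.cong bit (≡.sym (dec-true (k₀ ℕ.<? suc n) (s≤s (ℕP.≤-reflexive k₀≡n)))))
  step (tri> k₀≮n _ n<k₀) = ≡.trans (≡.cong₂ (λ x y → bit x ℕ.+ bit y) (dec-false (k₀ ℕ.<? n) k₀≮n) (dec-false (n ℕ.≟ k₀) (ℕP.<⇒≢ n<k₀)))
    (≡.cong bit (≡.sym (dec-false (k₀ ℕ.<? suc n) (ℕP.<⇒≱ (s≤s n<k₀)))))

countBelow-progression : ∀ c m k₀ P → k₀ < m → (∀ z k → k < m → P (z ℕ.* m ℕ.+ k) ≡ does (k ℕ.≟ k₀)) →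
  ∀ n → n ≤ c ℕ.* m → countBelow n P ≡ countBelow c (λ z → does (k₀ ℕ.+ z ℕ.* m ℕ.<? n))
countBelow-progression zero    m k₀ P k₀<m P≡ zero n≤ = ≡.refl
countBelow-progression (suc c) m k₀ P k₀<m P≡ n n≤ with ℕP.≤-total n (c ℕ.* m)
... | inj₁ n≤cm = ≡.trans (countBelow-progression c m k₀ P k₀<m P≡ n n≤cm) (≡.trans (≡.sym (ℕP.+-identityʳ _))
  (≡.cong (λ b → countBelow c (λ z → does (k₀ ℕ.+ z ℕ.* m ℕ.<? n)) ℕ.+ bit b)
    (≡.sym (dec-false (k₀ ℕ.+ c ℕ.* m ℕ.<? n) (ℕP.≤⇒≯ (ℕP.≤-trans n≤cm (ℕP.m≤n+m (c ℕ.* m) k₀)))))))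
... | inj₂ cm≤n = begin
  countBelow n P                                                         ≡⟨ ≡.cong (λ n → countBelow n P) n≡ ⟩
  countBelow (c ℕ.* m ℕ.+ j) P                                           ≡⟨ countBelow-+ (c ℕ.* m) j P ⟩
  countBelow (c ℕ.* m) P ℕ.+ countBelow j (λ k → P (c ℕ.* m ℕ.+ k))      ≡⟨ ≡.cong₂ ℕ._+_ left right ⟩
  countBelow c Q ℕ.+ bit (Q c)                                           ∎
  where
  open ≡.≡-Reasoning
  j = n ℕ.∸ c ℕ.* m
  Q : ℕ → Bool
  Q z = does (k₀ ℕ.+ z ℕ.* m ℕ.<? n)
  n≡ : n ≡ c ℕ.* m ℕ.+ j
  n≡ = ≡.sym (ℕP.m+[n∸m]≡n cm≤n)
  j≤m : j ≤ m
  j≤m = ℕP.+-cancelˡ-≤ (c ℕ.* m) j m (ℕP.≤-trans (ℕP.≤-reflexive (≡.sym n≡)) (ℕP.≤-trans n≤ (ℕP.≤-reflexive (ℕP.+-comm m (c ℕ.* m)))))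
  kz<cm : ∀ z → z < c → k₀ ℕ.+ z ℕ.* m < c ℕ.* m
  kz<cm z z<c = ℕP.<-≤-trans (ℕP.+-monoˡ-< (z ℕ.* m) k₀<m) (ℕP.*-monoˡ-≤ m z<c)
  left : countBelow (c ℕ.* m) P ≡ countBelow c Q
  left = ≡.trans (countBelow-progression c m k₀ P k₀<m P≡ (c ℕ.* m) ℕP.≤-refl) (countBelow-cong c (λ z z<c → ≡.trans
    (dec-true (k₀ ℕ.+ z ℕ.* m ℕ.<? c ℕ.* m) (kz<cm z z<c)) (≡.sym (dec-true (k₀ ℕ.+ z ℕ.* m ℕ.<? n) (ℕP.<-≤-trans (kz<cm z z<c) cm≤n)))))
  right : countBelow j (λ k → P (c ℕ.* m ℕ.+ k)) ≡ bit (Q c)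
  right = ≡.trans (countBelow-point j k₀ (λ k k<j → P≡ c k (ℕP.<-≤-trans k<j j≤m))) (≡.cong bit (does-≡ (k₀ ℕ.<? j) (k₀ ℕ.+ c ℕ.* m ℕ.<? n)
    (λ k₀<j → ≡.subst (k₀ ℕ.+ c ℕ.* m <_) (≡.trans (ℕP.+-comm j (c ℕ.* m)) (≡.sym n≡)) (ℕP.+-monoˡ-< (c ℕ.* m) k₀<j))
    (λ lt → ℕP.+-cancelʳ-< (c ℕ.* m) k₀ j (≡.subst (k₀ ℕ.+ c ℕ.* m <_) (≡.trans n≡ (ℕP.+-comm (c ℕ.* m) j)) lt))))

hits-+-period : ∀ r s m n → hits r s m (m ℕ.+ n) ≡ hits r s m m ℕ.+ hits r s m n
hits-+-period r s m n = ≡.trans (countBelow-+ m n _) (≡.cong (hits r s m m ℕ.+_) (countBelow-cong n (λ k _ →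
  does-≡ (m ∣? ℤ.∣ term r s (m ℕ.+ k) ∣) (m ∣? ℤ.∣ term r s k ∣)
    (λ m∣ → ℤS.∣⇒∣ᵤ (ℤS.∣m+n∣m⇒∣n (≡.subst (+ m ℤS.∣_) (shift-term k) (ℤS.∣ᵤ⇒∣ m∣)) (ℤS.divides s ≡.refl)))
    (λ m∣ → ℤS.∣⇒∣ᵤ (≡.subst (+ m ℤS.∣_) (≡.sym (shift-term k)) (ℤS.∣m∣n⇒∣m+n (ℤS.divides s ≡.refl) (ℤS.∣ᵤ⇒∣ m∣)))))))
  where
  shift-term : ∀ k → term r s (m ℕ.+ k) ≡ s ℤ.* + m ℤ.+ term r s k
  shift-term k = lem r s (+ m) (+ k)
    where
    lem : ∀ r s m k → r ℤ.+ s ℤ.* (m ℤ.+ k) ≡ s ℤ.* m ℤ.+ (r ℤ.+ s ℤ.* k)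
    lem = solve-∀

+-cancelʳ-≤ : ∀ {i j} k → i ℤ.+ k ℤ.≤ j ℤ.+ k → i ℤ.≤ j
+-cancelʳ-≤ k le = ℤP.≮⇒≥ λ j<i → ℤP.<⇒≱ (ℤP.+-monoˡ-< k j<i) le

+-cancelʳ-< : ∀ {i j} k → i ℤ.+ k ℤ.< j ℤ.+ k → i ℤ.< j
+-cancelʳ-< k lt = ℤP.≰⇒> λ j≤i → ℤP.<⇒≱ lt (ℤP.+-monoˡ-≤ k j≤i)

-- The solution of m₁ ∣ r₁ + s₁ k with 0 ≤ k < m₁. Its quotient ρ₀ is determined modulo s₁, where e
-- is the inverse of m₁, and so agrees with e r₁; normalised to 1, ..., s₁ it is the numerator of ⟨e
-- α⟩.
record FirstSolution (r₁ : ℤ) (s₁ m₁ e : ℕ) : Set where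
  field
    ρ₀ k₀ : ℕ
    T     : ℤ
    1≤ρ₀  : 1 ≤ ρ₀
    ρ₀≤s₁ : ρ₀ ≤ s₁
    er₁≡  : + e ℤ.* r₁ ≡ + ρ₀ ℤ.+ T ℤ.* + s₁
    k₀<m₁ : k₀ < m₁
    k₀s₁≡ : + k₀ ℤ.* + s₁ ℤ.+ r₁ ≡ + m₁ ℤ.* + ρ₀

-- The equation K s₁ = m₁ ρ₀ - r₁ together with 1 ≤ ρ₀ ≤ s₁ and |r₁| < m₁ confines K to 0, ..., m₁ -
-- 1, except that ρ₀ = s₁ needs a separate argument for the upper bound.
firstSolution : ∀ r₁ s₁′ m₁ e G → + m₁ ℤ.* + e ≡ 1ℤ ℤ.+ G ℤ.* + suc s₁′ → ℤ.∣ r₁ ∣ < m₁ →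
  (∀ (k : ℕ) → r₁ ≢ ℤ.- (+ k ℤ.* + suc s₁′)) → FirstSolution r₁ (suc s₁′) m₁ e
firstSolution r₁ s₁′ m₁ e G m₁e≡ ∣r₁∣<m₁ r₁≢ = record
  { ρ₀ = ρ₀ ; k₀ = ℤ.∣ K ∣ ; T = T ; 1≤ρ₀ = s≤s z≤n ; ρ₀≤s₁ = ρ₀≤s₁ ; er₁≡ = er₁≡
  ; k₀<m₁ = ℤP.drop‿+<+ (≡.subst (ℤ._< + m₁) (≡.sym +∣K∣≡K) K<m₁)
  ; k₀s₁≡ = ≡.trans (≡.cong (λ k → k ℤ.* + s₁ ℤ.+ r₁) +∣K∣≡K) Ks₁≡ }
  where
  s₁ = suc s₁′
  -- Subtracting 1 before the division and adding it back afterwards puts ρ₀ into 1, ..., s₁, as the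
  -- convention ⟨x⟩ = 1 at integers demands.
  x = + e ℤ.* r₁ ℤ.- 1ℤ
  ρ₀ = suc (x ℤ.%ℕ s₁)
  T = x ℤ./ℕ s₁
  -- Found by multiplying e r₁ = ρ₀ + T s₁ by m₁ and replacing m₁ e by 1 + G s₁.
  K = G ℤ.* r₁ ℤ.- + m₁ ℤ.* T
  ρ₀≤s₁ : ρ₀ ≤ s₁
  ρ₀≤s₁ = ℤD.n%ℕd<d x s₁
  er₁≡ : + e ℤ.* r₁ ≡ + ρ₀ ℤ.+ T ℤ.* + s₁
  er₁≡ = ≡.trans (lem (+ e ℤ.* r₁)) (≡.trans (≡.cong (λ y → 1ℤ ℤ.+ y) (ℤD.a≡a%ℕn+[a/ℕn]*n x s₁)) (≡.sym (ℤP.+-assoc 1ℤ (+ (x ℤ.%ℕ s₁)) (T ℤ.* + s₁))))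
    where
    lem : ∀ y → y ≡ 1ℤ ℤ.+ (y ℤ.- 1ℤ)
    lem = solve-∀
  Ks₁≡ : K ℤ.* + s₁ ℤ.+ r₁ ≡ + m₁ ℤ.* + ρ₀
  Ks₁≡ = begin
    K ℤ.* + s₁ ℤ.+ r₁                                     ≡⟨ lem₁ G r₁ (+ m₁) T (+ s₁) ⟩
    (1ℤ ℤ.+ G ℤ.* + s₁) ℤ.* r₁ ℤ.- + m₁ ℤ.* (T ℤ.* + s₁)  ≡⟨ ≡.cong (λ y → y ℤ.* r₁ ℤ.- + m₁ ℤ.* (T ℤ.* + s₁)) m₁e≡ ⟨
    + m₁ ℤ.* + e ℤ.* r₁ ℤ.- + m₁ ℤ.* (T ℤ.* + s₁)         ≡⟨ lem₂ (+ m₁) (+ e) r₁ (T ℤ.* + s₁) ⟩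
    + m₁ ℤ.* (+ e ℤ.* r₁ ℤ.- T ℤ.* + s₁)                  ≡⟨ ≡.cong (λ y → + m₁ ℤ.* (y ℤ.- T ℤ.* + s₁)) er₁≡ ⟩
    + m₁ ℤ.* (+ ρ₀ ℤ.+ T ℤ.* + s₁ ℤ.- T ℤ.* + s₁)         ≡⟨ ≡.cong (+ m₁ ℤ.*_) (lem₃ (+ ρ₀) (T ℤ.* + s₁)) ⟩
    + m₁ ℤ.* + ρ₀                                         ∎
    where
    open ≡.≡-Reasoning
    lem₁ : ∀ G r m T s → (G ℤ.* r ℤ.- m ℤ.* T) ℤ.* s ℤ.+ r ≡ (1ℤ ℤ.+ G ℤ.* s) ℤ.* r ℤ.- m ℤ.* (T ℤ.* s)
    lem₁ = solve-∀
    lem₂ : ∀ m e r y → m ℤ.* e ℤ.* r ℤ.- m ℤ.* y ≡ m ℤ.* (e ℤ.* r ℤ.- y)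
    lem₂ = solve-∀
    lem₃ : ∀ p y → p ℤ.+ y ℤ.- y ≡ p
    lem₃ = solve-∀
  r₁<m₁ : r₁ ℤ.< + m₁
  r₁<m₁ = ℤP.≤-<-trans (i≤∣i∣ r₁) (ℤ.+<+ ∣r₁∣<m₁)
  -r₁<m₁ : ℤ.- r₁ ℤ.< + m₁
  -r₁<m₁ = ℤP.≤-<-trans (i≤∣i∣ (ℤ.- r₁)) (ℤ.+<+ (≡.subst (_< m₁) (≡.sym (ℤP.∣-i∣≡∣i∣ r₁)) ∣r₁∣<m₁))
  0≤K : 0ℤ ℤ.≤ K
  0≤K = ℤP.*-cancelʳ-≤-pos 0ℤ K (+ s₁) (+-cancelʳ-≤ r₁ (begin
    0ℤ ℤ.* + s₁ ℤ.+ r₁        ≡⟨ ≡.cong (ℤ._+ r₁) (ℤP.*-zeroˡ (+ s₁)) ⟩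
    0ℤ ℤ.+ r₁                 ≡⟨ ℤP.+-identityˡ r₁ ⟩
    r₁                        ≤⟨ ℤP.<⇒≤ r₁<m₁ ⟩
    + m₁                      ≡⟨ ℤP.*-identityʳ (+ m₁) ⟨
    + m₁ ℤ.* 1ℤ               ≤⟨ ℤP.*-monoˡ-≤-nonNeg (+ m₁) (ℤ.+≤+ (s≤s z≤n)) ⟩
    + m₁ ℤ.* + ρ₀             ≡⟨ Ks₁≡ ⟨
    K ℤ.* + s₁ ℤ.+ r₁         ∎))
    where open ℤP.≤-Reasoning
  +∣K∣≡K : + ℤ.∣ K ∣ ≡ K
  +∣K∣≡K = ℤP.0≤i⇒+∣i∣≡i 0≤K
  K<m₁ : K ℤ.< + m₁
  K<m₁ with ℕP.m≤n⇒m<n∨m≡n ρ₀≤s₁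
  ... | inj₁ ρ₀<s₁ = ℤP.*-cancelʳ-<-nonNeg {K} {+ m₁} (+ s₁) (+-cancelʳ-< (+ m₁) (begin-strict
    K ℤ.* + s₁ ℤ.+ + m₁                         ≡⟨ lem₁ (K ℤ.* + s₁) r₁ (+ m₁) ⟩
    K ℤ.* + s₁ ℤ.+ r₁ ℤ.- r₁ ℤ.+ + m₁           ≡⟨ ≡.cong (λ y → y ℤ.- r₁ ℤ.+ + m₁) Ks₁≡ ⟩
    + m₁ ℤ.* + ρ₀ ℤ.- r₁ ℤ.+ + m₁               ≡⟨ lem₂ (+ m₁) (+ ρ₀) r₁ ⟩
    ℤ.- r₁ ℤ.+ + m₁ ℤ.* (1ℤ ℤ.+ + ρ₀)           <⟨ ℤP.+-monoˡ-< (+ m₁ ℤ.* (1ℤ ℤ.+ + ρ₀)) -r₁<m₁ ⟩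
    + m₁ ℤ.+ + m₁ ℤ.* + suc ρ₀                  ≤⟨ ℤP.+-monoʳ-≤ (+ m₁) (ℤP.*-monoˡ-≤-nonNeg (+ m₁) (ℤ.+≤+ ρ₀<s₁)) ⟩
    + m₁ ℤ.+ + m₁ ℤ.* + s₁                      ≡⟨ ℤP.+-comm (+ m₁) (+ m₁ ℤ.* + s₁) ⟩
    + m₁ ℤ.* + s₁ ℤ.+ + m₁                      ∎))
    where
    open ℤP.≤-Reasoning
    lem₁ : ∀ y r m → y ℤ.+ m ≡ y ℤ.+ r ℤ.- r ℤ.+ m
    lem₁ = solve-∀
    lem₂ : ∀ m p r → m ℤ.* p ℤ.- r ℤ.+ m ≡ ℤ.- r ℤ.+ m ℤ.* (1ℤ ℤ.+ p)
    lem₂ = solve-∀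
  -- Otherwise r₁ = (m₁ - K) s₁ is a multiple of s₁, positive because α ∉ ℤ≤0.
  ... | inj₂ ρ₀≡s₁ = ℤP.≰⇒> λ m₁≤K → r₁≢ ℤ.∣ K ℤ.- + m₁ ∣ (begin
    r₁                                         ≡⟨ lem₁ (K ℤ.* + s₁) r₁ ⟩
    K ℤ.* + s₁ ℤ.+ r₁ ℤ.- K ℤ.* + s₁           ≡⟨ ≡.cong (ℤ._- K ℤ.* + s₁) (≡.trans Ks₁≡ (≡.cong (λ p → + m₁ ℤ.* + p) ρ₀≡s₁)) ⟩
    + m₁ ℤ.* + s₁ ℤ.- K ℤ.* + s₁               ≡⟨ lem₂ (+ m₁) K (+ s₁) ⟩
    ℤ.- ((K ℤ.- + m₁) ℤ.* + s₁)                ≡⟨ ≡.cong (λ k → ℤ.- (k ℤ.* + s₁)) (ℤP.0≤i⇒+∣i∣≡i (ℤP.i≤j⇒0≤j-i m₁≤K)) ⟨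
    ℤ.- (+ ℤ.∣ K ℤ.- + m₁ ∣ ℤ.* + s₁)          ∎)
    where
    open ≡.≡-Reasoning
    lem₁ : ∀ y r → r ≡ y ℤ.+ r ℤ.- y
    lem₁ = solve-∀
    lem₂ : ∀ m K s → m ℤ.* s ℤ.- K ℤ.* s ≡ ℤ.- ((K ℤ.- m) ℤ.* s)
    lem₂ = solve-∀

-- me≡ makes s₁ invertible modulo m₁, so the solutions of m ∣ r + s k are the class of k₀ modulo m₁ = m / c.
module Solutions {r₁ s₁ m₁ e} (first : FirstSolution r₁ s₁ m₁ e) {G : ℤ} (me≡ : + m₁ ℤ.* + e ≡ 1ℤ ℤ.+ G ℤ.* + s₁)
  {r : ℤ} {s c m : ℕ} .{{_ : NonZero s}} .{{_ : NonZero c}} (r≡ : r ≡ r₁ ℤ.* + c) (s≡ : s ≡ s₁ ℕ.* c) (m≡ : m ≡ m₁ ℕ.* c) where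
  open FirstSolution first

  k-at ρ-at : ℕ → ℕ
  k-at z = k₀ ℕ.+ z ℕ.* m₁
  ρ-at z = ρ₀ ℕ.+ z ℕ.* s₁
  solution : ∀ z → + k-at z ℤ.* + s₁ ℤ.+ r₁ ≡ + m₁ ℤ.* + ρ-at z
  solution z = begin
    + k-at z ℤ.* + s₁ ℤ.+ r₁                                ≡⟨ ≡.cong (λ y → (+ k₀ ℤ.+ y) ℤ.* + s₁ ℤ.+ r₁) (ℤP.pos-* z m₁) ⟩
    (+ k₀ ℤ.+ + z ℤ.* + m₁) ℤ.* + s₁ ℤ.+ r₁                 ≡⟨ lem₁ (+ k₀) (+ z) (+ m₁) (+ s₁) r₁ ⟩
    + k₀ ℤ.* + s₁ ℤ.+ r₁ ℤ.+ + m₁ ℤ.* (+ z ℤ.* + s₁)        ≡⟨ ≡.cong₂ (λ x y → x ℤ.+ + m₁ ℤ.* y) k₀s₁≡ (≡.sym (ℤP.pos-* z s₁)) ⟩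
    + m₁ ℤ.* + ρ₀ ℤ.+ + m₁ ℤ.* + (z ℕ.* s₁)                 ≡⟨ ℤP.*-distribˡ-+ (+ m₁) (+ ρ₀) (+ (z ℕ.* s₁)) ⟨
    + m₁ ℤ.* + ρ-at z                                       ∎
    where
    open ≡.≡-Reasoning
    lem₁ : ∀ k z m s r → (k ℤ.+ z ℤ.* m) ℤ.* s ℤ.+ r ≡ k ℤ.* s ℤ.+ r ℤ.+ m ℤ.* (z ℤ.* s)
    lem₁ = solve-∀

  private
    term≡ : ∀ k → term r (+ s) k ≡ term r₁ (+ s₁) k ℤ.* + c
    term≡ k = ≡.trans (≡.cong₂ (λ x y → x ℤ.+ y ℤ.* + k) r≡ (≡.trans (≡.cong +_ s≡) (ℤP.pos-* s₁ c))) (lem r₁ (+ c) (+ s₁) (+ k))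
      where
      lem : ∀ r c s k → r ℤ.* c ℤ.+ s ℤ.* c ℤ.* k ≡ (r ℤ.+ s ℤ.* k) ℤ.* c
      lem = solve-∀
    ∣term∣≡ : ∀ k → ℤ.∣ term r (+ s) k ∣ ≡ ℤ.∣ term r₁ (+ s₁) k ∣ ℕ.* c
    ∣term∣≡ k = ≡.trans (≡.cong ℤ.∣_∣ (term≡ k)) (ℤP.∣i*j∣≡∣i∣*∣j∣ (term r₁ (+ s₁) k) (+ c))
    m₁∣s₁x⇒m₁∣x : ∀ x → + m₁ ℤS.∣ + s₁ ℤ.* x → + m₁ ℤS.∣ x
    m₁∣s₁x⇒m₁∣x x m₁∣ = ≡.subst (+ m₁ ℤS.∣_) (≡.trans (≡.cong (λ y → y ℤ.* x ℤ.- G ℤ.* (+ s₁ ℤ.* x)) me≡) (lem₁ G (+ s₁) x))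
      (ℤS.∣m∣n⇒∣m-n (ℤS.divides (+ e ℤ.* x) (lem₂ (+ m₁) (+ e) x)) (ℤS.∣n⇒∣m*n G m₁∣))
      where
      lem₁ : ∀ G s x → (1ℤ ℤ.+ G ℤ.* s) ℤ.* x ℤ.- G ℤ.* (s ℤ.* x) ≡ x
      lem₁ = solve-∀
      lem₂ : ∀ m e x → m ℤ.* e ℤ.* x ≡ e ℤ.* x ℤ.* m
      lem₂ = solve-∀
    hit : ∀ z k → k < m₁ → does (m ∣? ℤ.∣ term r (+ s) (z ℕ.* m₁ ℕ.+ k) ∣) ≡ does (k ℕ.≟ k₀)
    hit z k k<m₁ = does-≡ (m ∣? ℤ.∣ term r (+ s) (z ℕ.* m₁ ℕ.+ k) ∣) (k ℕ.≟ k₀) hit⇒≡ ≡⇒hit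
      where
      at-k₀ : term r₁ (+ s₁) (z ℕ.* m₁ ℕ.+ k₀) ≡ + ρ-at z ℤ.* + m₁
      at-k₀ = ≡.trans (≡.cong (λ k → r₁ ℤ.+ + s₁ ℤ.* + k) (ℕP.+-comm (z ℕ.* m₁) k₀))
        (≡.trans (lem r₁ (+ s₁) (+ k-at z)) (≡.trans (solution z) (ℤP.*-comm (+ m₁) (+ ρ-at z))))
        where
        lem : ∀ r s k → r ℤ.+ s ℤ.* k ≡ k ℤ.* s ℤ.+ r
        lem = solve-∀
      ≡⇒hit : k ≡ k₀ → m ∣ℕ ℤ.∣ term r (+ s) (z ℕ.* m₁ ℕ.+ k) ∣
      ≡⇒hit ≡.refl = ≡.subst₂ _∣ℕ_ (≡.sym m≡) (≡.sym (∣term∣≡ (z ℕ.* m₁ ℕ.+ k₀)))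
        (ℕD.*-monoˡ-∣ c (ℤS.∣⇒∣ᵤ (ℤS.divides (+ ρ-at z) at-k₀)))
      hit⇒≡ : m ∣ℕ ℤ.∣ term r (+ s) (z ℕ.* m₁ ℕ.+ k) ∣ → k ≡ k₀
      hit⇒≡ m∣ = ℤP.+-injective (ℤP.i-j≡0⇒i≡j (+ k) (+ k₀) (ℤP.∣i∣≡0⇒i≡0 (small ℤ.∣ + k ℤ.- + k₀ ∣ (ℤS.∣⇒∣ᵤ m₁∣k-k₀) abs<)))
        where
        m₁∣term : + m₁ ℤS.∣ term r₁ (+ s₁) (z ℕ.* m₁ ℕ.+ k)
        m₁∣term = ℤS.∣ᵤ⇒∣ (ℕD.*-cancelʳ-∣ c (≡.subst₂ _∣ℕ_ m≡ (∣term∣≡ (z ℕ.* m₁ ℕ.+ k)) m∣))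
        difference : term r₁ (+ s₁) (z ℕ.* m₁ ℕ.+ k) ℤ.- term r₁ (+ s₁) (z ℕ.* m₁ ℕ.+ k₀) ≡ + s₁ ℤ.* (+ k ℤ.- + k₀)
        difference = lem r₁ (+ s₁) (+ (z ℕ.* m₁)) (+ k) (+ k₀)
          where
          lem : ∀ r s y k k₀ → r ℤ.+ s ℤ.* (y ℤ.+ k) ℤ.- (r ℤ.+ s ℤ.* (y ℤ.+ k₀)) ≡ s ℤ.* (k ℤ.- k₀)
          lem = solve-∀
        m₁∣k-k₀ : + m₁ ℤS.∣ + k ℤ.- + k₀
        m₁∣k-k₀ = m₁∣s₁x⇒m₁∣x (+ k ℤ.- + k₀) (≡.subst (+ m₁ ℤS.∣_) difference
          (ℤS.∣m∣n⇒∣m-n m₁∣term (ℤS.divides (+ ρ-at z) at-k₀)))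
        abs< : ℤ.∣ + k ℤ.- + k₀ ∣ < m₁
        abs< = ℕP.≤-<-trans (≡.subst (λ y → ℤ.∣ y ∣ ≤ k ℕ.⊔ k₀) (≡.sym (ℤP.m-n≡m⊖n k k₀)) (ℤP.∣m⊝n∣≤m⊔n k k₀)) (ℕP.⊔-lub k<m₁ k₀<m₁)
        small : ∀ n → m₁ ∣ℕ n → n < m₁ → n ≡ 0
        small zero    _   _   = ≡.refl
        small (suc n) m∣n n<m = contradiction n<m (ℕP.≤⇒≯ (ℕD.∣⇒≤ m∣n))
    k-at<m : ∀ z → z < c → k-at z < m
    k-at<m z z<c = ℕP.<-≤-trans (ℕP.+-monoˡ-< (z ℕ.* m₁) k₀<m₁) (ℕP.≤-trans (ℕP.*-monoˡ-≤ m₁ z<c)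
      (ℕP.≤-reflexive (≡.trans (ℕP.*-comm c m₁) (≡.sym m≡))))

  count-k : ∀ n → countBelow c (λ z → does (k-at z ℕ.<? n)) ≡ hits r (+ s) m (n ℕ.⊓ m)
  count-k n = ≡.sym (≡.trans (countBelow-progression c m₁ k₀ (λ k → does (m ∣? ℤ.∣ term r (+ s) k ∣)) k₀<m₁ hit (n ℕ.⊓ m)
      (ℕP.≤-trans (ℕP.m⊓n≤n n m) (ℕP.≤-reflexive (≡.trans m≡ (ℕP.*-comm m₁ c)))))
    (countBelow-cong c (λ z z<c → does-≡ (k-at z ℕ.<? n ℕ.⊓ m) (k-at z ℕ.<? n)
      (λ lt → ℕP.<-≤-trans lt (ℕP.m⊓n≤m n m)) (λ lt → ℕP.⊓-glb lt (k-at<m z z<c)))))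

  located-at : ∀ {d′ w a B y} z → z < c → suc d′ ≡ s ℕ.* w → 1 ≤ w → ℤ.∣ r ∣ ℕ.* suc d′ ≤ B →
    y ≡ (+ (ρ-at z ℕ.* w) ℤ.+ (ℤ.- ((+ suc d′ ℤ.- + a ℤ.* (r ℤ.* + w)) ℤD./ℕ suc d′)) ℤ.* + suc d′) ÷ d′ →
    Located d′ m a B (k-at z , y)
  located-at {d′} {w} z z<c d≡ 1≤w rd≤B value = located (ρ-at z ℕ.* w) (r ℤ.* + w) (ℕP.*-mono-≤ (ℕP.≤-trans 1≤ρ₀ (ℕP.m≤m+n ρ₀ _)) 1≤w)
    (≡.subst (ρ-at z ℕ.* w ≤_) (≡.sym (≡.trans d≡ (≡.cong (ℕ._* w) (≡.trans s≡ (ℕP.*-comm s₁ c)))))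
      (ℕP.*-monoˡ-≤ w (ℕP.≤-trans (ℕP.+-monoˡ-≤ (z ℕ.* s₁) ρ₀≤s₁) (ℕP.*-monoˡ-≤ s₁ z<c))))
    scaled
    (ℕP.≤-trans (ℕP.≤-reflexive (ℤP.∣i*j∣≡∣i∣*∣j∣ r (+ w))) (ℕP.≤-trans (ℕP.*-monoʳ-≤ ℤ.∣ r ∣ w≤d) rd≤B))
    value
    where
    d = suc d′
    w≤d : w ≤ d
    w≤d = ℕP.≤-trans (ℕP.m≤n*m w s) (ℕP.≤-reflexive (≡.sym d≡))
    +d≡ : + d ≡ + s₁ ℤ.* + c ℤ.* + w
    +d≡ = ≡.trans (≡.cong +_ d≡) (≡.trans (ℤP.pos-* s w) (≡.cong (ℤ._* + w) (≡.trans (≡.cong +_ s≡) (ℤP.pos-* s₁ c))))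
    scaled : + m ℤ.* + (ρ-at z ℕ.* w) ≡ + k-at z ℤ.* + d ℤ.+ r ℤ.* + w
    scaled = begin
      + m ℤ.* + (ρ-at z ℕ.* w)                              ≡⟨ ≡.cong₂ ℤ._*_ (≡.trans (≡.cong +_ m≡) (ℤP.pos-* m₁ c)) (ℤP.pos-* (ρ-at z) w) ⟩
      + m₁ ℤ.* + c ℤ.* (+ ρ-at z ℤ.* + w)                   ≡⟨ lem₁ (+ m₁) (+ c) (+ ρ-at z) (+ w) ⟩
      + m₁ ℤ.* + ρ-at z ℤ.* (+ c ℤ.* + w)                   ≡⟨ ≡.cong (ℤ._* (+ c ℤ.* + w)) (solution z) ⟨
      (+ k-at z ℤ.* + s₁ ℤ.+ r₁) ℤ.* (+ c ℤ.* + w)          ≡⟨ lem₂ (+ k-at z) (+ s₁) r₁ (+ c) (+ w) ⟩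
      + k-at z ℤ.* (+ s₁ ℤ.* + c ℤ.* + w) ℤ.+ r₁ ℤ.* + c ℤ.* + w ≡⟨ ≡.cong₂ (λ x y → + k-at z ℤ.* x ℤ.+ y ℤ.* + w) +d≡ r≡ ⟨
      + k-at z ℤ.* + d ℤ.+ r ℤ.* + w                        ∎
      where
      open ≡.≡-Reasoning
      lem₁ : ∀ m c p w → m ℤ.* c ℤ.* (p ℤ.* w) ≡ m ℤ.* p ℤ.* (c ℤ.* w)
      lem₁ = solve-∀
      lem₂ : ∀ k s r c w → (k ℤ.* s ℤ.+ r) ℤ.* (c ℤ.* w) ≡ k ℤ.* (s ℤ.* c ℤ.* w) ℤ.+ r ℤ.* c ℤ.* w
      lem₂ = solve-∀

-- Solutions paired with their Christol points.

pointCount : (r s : ℤ) (b a : ℕ) → ℚ → ℕ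
pointCount r s b a x = if inVᵇ r s b then countBelow (cOf r s b) (λ k → does (point r s b a k ≼? x)) else 0

point-at : ∀ {c′ r s′ b s₁ r₁ ρ₀ T d′ w} a z → cOf r (+ suc s′) b ≡ suc c′ →
  suc s′ ≡ s₁ ℕ.* suc c′ → r ≡ r₁ ℤ.* + suc c′ → + eOf r (+ suc s′) b ℤ.* r₁ ≡ + ρ₀ ℤ.+ T ℤ.* + s₁ → 1 ≤ ρ₀ → ρ₀ ≤ s₁ →
  suc d′ ≡ suc s′ ℕ.* w →
  point r (+ suc s′) b a z ≡ (+ ((ρ₀ ℕ.+ z ℕ.* s₁) ℕ.* w) ℤ.+ (ℤ.- ((+ suc d′ ℤ.- + a ℤ.* (r ℤ.* + w)) ℤD./ℕ suc d′)) ℤ.* + suc d′) ÷ d′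
point-at {c′} {r} {s′} {b} {s₁} {r₁} {ρ₀} {T} {d′} {w} a z c≡ s≡ r≡ er₁≡ 1≤ρ₀ ρ₀≤s₁ d≡ = go (eOf r (+ suc s′) b) (cOf r (+ suc s′) b) c≡ er₁≡
  where
  go : ∀ e c → c ≡ suc c′ → + e ℤ.* r₁ ≡ + ρ₀ ℤ.+ T ℤ.* + s₁ →
    divℕ (frac ((+ e) ÷ 0 ℚ.* r ÷ s′) ℚ.+ (+ z) ÷ 0) c ℚ.- floor (1ℚ ℚ.- (+ a) ÷ 0 ℚ.* r ÷ s′) ÷ 0
    ≡ (+ ((ρ₀ ℕ.+ z ℕ.* s₁) ℕ.* w) ℤ.+ (ℤ.- ((+ suc d′ ℤ.- + a ℤ.* (r ℤ.* + w)) ℤD./ℕ suc d′)) ℤ.* + suc d′) ÷ d′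
  go e _ ≡.refl er≡ = point-value {e} {c′} {r} {s′} {s₁} {r₁} {ρ₀} {T} {d′} {w} a z s≡ r≡ er≡ 1≤ρ₀ ρ₀≤s₁ d≡

count-point : ∀ {r s b c a} → ℕG.gcd ℤ.∣ s ∣ b ≡ cOf r s b → cOf r s b ≡ c →
  ∀ x → pointCount r s b a x ≡ countBelow c (λ z → does (point r s b a z ≼? x))
count-point {r} {s} {b} {c} {a} g≡ c≡ x = ≡.trans (if-true (dec-true (ℕG.gcd ℤ.∣ s ∣ b ℕ.≟ cOf r s b) g≡)) (≡.cong (λ c → countBelow c (λ z → does (point r s b a z ≼? x))) c≡)
  where
  if-true : ∀ {A : Set} {i} {x y : A} → i ≡ true → (if i then x else y) ≡ x
  if-true ≡.refl = ≡.refl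

-- One list carries both statistics: counted by k it gives the hits in the first period, counted by
-- point the contribution to Ξ.
Entries : (r s : ℤ) (b d′ m a B : ℕ) → Set
Entries r s b d′ m a B = ∃ λ entries → All (Located d′ m a B) entries ×
  (∀ n → count (λ e → does (proj₁ e ℕ.<? n)) entries ≡ hits r s m (n ℕ.⊓ m)) ×
  (∀ x → count (λ e → does (proj₂ e ≼? x)) entries ≡ pointCount r s b a x)

-- Dividing b e ≡ c modulo s by c gives b₁ e ≡ 1 modulo s₁. Replacing b₁ by m₁ changes it by a
-- multiple of s₁, so the e found from b inverts m₁ as well.
reduced-solution : ∀ {r s b c s₁′ r₁ b₁ e G} h .{{_ : NonZero c}} → + b ℤ.* + e ≡ + c ℤ.+ G ℤ.* + s →
  s ≡ suc s₁′ ℕ.* c → r ≡ r₁ ℤ.* + c → b ≡ b₁ ℕ.* c → ℤ.∣ r ∣ < (b₁ ℕ.+ h ℕ.* suc s₁′) ℕ.* c →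
  (∀ (k : ℕ) → r ≢ ℤ.- (+ k ℤ.* + s)) →
  FirstSolution r₁ (suc s₁′) (b₁ ℕ.+ h ℕ.* suc s₁′) e ×
  ∃ λ G′ → + (b₁ ℕ.+ h ℕ.* suc s₁′) ℤ.* + e ≡ 1ℤ ℤ.+ G′ ℤ.* + suc s₁′
reduced-solution {r} {s} {b} {c} {s₁′} {r₁} {b₁} {e} {G} h be≡c s≡ r≡ b≡ ∣r∣<m r≢ = first , G′ , me≡
  where
  s₁ m₁ : ℕ
  s₁ = suc s₁′
  m₁ = b₁ ℕ.+ h ℕ.* s₁
  be≡ : + b₁ ℤ.* + e ≡ 1ℤ ℤ.+ G ℤ.* + s₁
  be≡ = ℤP.*-cancelʳ-≡ (+ b₁ ℤ.* + e) (1ℤ ℤ.+ G ℤ.* + s₁) (+ c) (begin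
    + b₁ ℤ.* + e ℤ.* + c                  ≡⟨ lem₁ (+ b₁) (+ e) (+ c) ⟩
    + b₁ ℤ.* + c ℤ.* + e                  ≡⟨ ≡.cong (ℤ._* + e) (≡.trans (≡.cong +_ b≡) (ℤP.pos-* b₁ c)) ⟨
    + b ℤ.* + e                           ≡⟨ be≡c ⟩
    + c ℤ.+ G ℤ.* + s         ≡⟨ ≡.cong (λ y → + c ℤ.+ G ℤ.* y) (≡.trans (≡.cong +_ s≡) (ℤP.pos-* s₁ c)) ⟩
    + c ℤ.+ G ℤ.* (+ s₁ ℤ.* + c)          ≡⟨ lem₂ (+ c) G (+ s₁) ⟩
    (1ℤ ℤ.+ G ℤ.* + s₁) ℤ.* + c           ∎)
    where
    open ≡.≡-Reasoning
    lem₁ : ∀ b e c → b ℤ.* e ℤ.* c ≡ b ℤ.* c ℤ.* e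
    lem₁ = solve-∀
    lem₂ : ∀ c G s → c ℤ.+ G ℤ.* (s ℤ.* c) ≡ (1ℤ ℤ.+ G ℤ.* s) ℤ.* c
    lem₂ = solve-∀
  G′ : ℤ
  G′ = G ℤ.+ + h ℤ.* + e
  me≡ : + m₁ ℤ.* + e ≡ 1ℤ ℤ.+ G′ ℤ.* + s₁
  me≡ = begin
    + m₁ ℤ.* + e                                            ≡⟨ ≡.cong (λ y → (+ b₁ ℤ.+ y) ℤ.* + e) (ℤP.pos-* h s₁) ⟩
    (+ b₁ ℤ.+ + h ℤ.* + s₁) ℤ.* + e                 ≡⟨ lem₁ (+ b₁) (+ h) (+ s₁) (+ e) ⟩
    + b₁ ℤ.* + e ℤ.+ + h ℤ.* + e ℤ.* + s₁           ≡⟨ ≡.cong (ℤ._+ + h ℤ.* + e ℤ.* + s₁) be≡ ⟩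
    1ℤ ℤ.+ G ℤ.* + s₁ ℤ.+ + h ℤ.* + e ℤ.* + s₁      ≡⟨ lem₂ G (+ h ℤ.* + e) (+ s₁) ⟩
    1ℤ ℤ.+ G′ ℤ.* + s₁                                      ∎
    where
    open ≡.≡-Reasoning
    lem₁ : ∀ b h s e → (b ℤ.+ h ℤ.* s) ℤ.* e ≡ b ℤ.* e ℤ.+ h ℤ.* e ℤ.* s
    lem₁ = solve-∀
    lem₂ : ∀ G h s → 1ℤ ℤ.+ G ℤ.* s ℤ.+ h ℤ.* s ≡ 1ℤ ℤ.+ (G ℤ.+ h) ℤ.* s
    lem₂ = solve-∀
  ∣r∣≡ : ℤ.∣ r ∣ ≡ ℤ.∣ r₁ ∣ ℕ.* c
  ∣r∣≡ = ≡.trans (≡.cong ℤ.∣_∣ r≡) (ℤP.∣i*j∣≡∣i∣*∣j∣ r₁ (+ c))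
  ∣r₁∣<m₁ : ℤ.∣ r₁ ∣ < m₁
  ∣r₁∣<m₁ = ℕP.*-cancelʳ-< c ℤ.∣ r₁ ∣ m₁ (≡.subst (λ n → n < m₁ ℕ.* c) ∣r∣≡ ∣r∣<m)
  first : FirstSolution r₁ s₁ m₁ e
  first = firstSolution r₁ s₁′ m₁ e G′ me≡ ∣r₁∣<m₁ λ k r₁≡ → r≢ k (≡.trans r≡ (≡.trans (≡.cong (ℤ._* + c) r₁≡)
    (≡.trans (lem (+ k) (+ s₁) (+ c)) (≡.cong (λ y → ℤ.- (+ k ℤ.* y)) (≡.sym (≡.trans (≡.cong +_ s≡) (ℤP.pos-* s₁ c)))))))
    where
    lem : ∀ k s c → ℤ.- (k ℤ.* s) ℤ.* c ≡ ℤ.- (k ℤ.* (s ℤ.* c))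
    lem = solve-∀

solution-entries : ∀ {r s′ b w d′ a B c s₁ r₁ m₁ m G} .{{_ : NonZero c}} → ℕG.gcd (suc s′) b ≡ cOf r (+ suc s′) b → cOf r (+ suc s′) b ≡ c →
  FirstSolution r₁ s₁ m₁ (eOf r (+ suc s′) b) → + m₁ ℤ.* + eOf r (+ suc s′) b ≡ 1ℤ ℤ.+ G ℤ.* + s₁ →
  suc s′ ≡ s₁ ℕ.* c → r ≡ r₁ ℤ.* + c → m ≡ m₁ ℕ.* c → suc d′ ≡ suc s′ ℕ.* w → ℤ.∣ r ∣ ℕ.* suc d′ ≤ B →
  Entries r (+ suc s′) b d′ m a B
solution-entries {r} {s′} {b} {w} {a = a} {c = suc c′} {G = G} g≡ c≡ first me≡ s≡ r≡ m≡ d≡ rd≤B =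
  applyDownFrom entry (suc c′) ,
  AllP.applyDownFrom⁺₁ entry (suc c′) (λ {z} z<c → located-at {a = a} z z<c d≡ 1≤w rd≤B (point-at {T = T} a z c≡ s≡ r≡ er₁≡ 1≤ρ₀ ρ₀≤s₁ d≡)) ,
  (λ n → ≡.trans (count-applyDownFrom (λ e → does (proj₁ e ℕ.<? n)) entry (suc c′)) (count-k n)) ,
  (λ x → ≡.trans (count-applyDownFrom (λ e → does (proj₂ e ≼? x)) entry (suc c′)) (≡.sym (count-point {r} {+ suc s′} {a = a} g≡ c≡ x)))
  where
  1≤w : 1 ≤ w
  1≤w = ℕP.n≢0⇒n>0 λ { ≡.refl → contradiction (≡.trans d≡ (ℕP.*-zeroʳ (suc s′))) λ () }
  open FirstSolution first using (T; er₁≡; 1≤ρ₀; ρ₀≤s₁)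
  open Solutions first {G} me≡ {s = suc s′} {suc c′} r≡ s≡ m≡
  entry : ℕ → ℕ × ℚ
  entry z = k-at z , point r (+ suc s′) b a z

-- Since s ∣ d, the number g = gcd s b divides m. A hit would make g divide r and hence equal c, so
-- for g ≠ c both counts are zero.
no-entries : ∀ {r s′ b h d′ a B} → ℕG.gcd (suc s′) b ≢ cOf r (+ suc s′) b → suc s′ ∣ℕ suc d′ →
  Entries r (+ suc s′) b d′ (b ℕ.+ h ℕ.* suc d′) a B
no-entries {r} {s′} {b} {h} {d′} {a} g≢c s∣d =
  [] , [] ,
  (λ n → ≡.sym (countBelow-false (n ℕ.⊓ m) (λ k _ → dec-false (m ∣? ℤ.∣ term r (+ s) k ∣) (g≢c ∘ hit⇒≡ k)))) ,
  (λ x → ≡.sym (if-false (dec-false (ℕG.gcd s b ℕ.≟ cOf r (+ s) b) g≢c)))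
  where
  s m g : ℕ
  s = suc s′
  m = b ℕ.+ h ℕ.* suc d′
  g = ℕG.gcd s b
  if-false : ∀ {i x} → i ≡ false → (if i then x else 0) ≡ 0
  if-false ≡.refl = ≡.refl
  g∣m : g ∣ℕ m
  g∣m = ℕD.∣m∣n⇒∣m+n (ℕG.gcd[m,n]∣n s b) (ℕD.∣n⇒∣m*n h (ℕD.∣-trans (ℕG.gcd[m,n]∣m s b) s∣d))
  hit⇒≡ : ∀ k → m ∣ℕ ℤ.∣ term r (+ s) k ∣ → g ≡ cOf r (+ s) b
  hit⇒≡ k m∣ = ℕD.∣-antisym (ℕG.gcd-greatest (ℕG.gcd-greatest g∣r (ℕG.gcd[m,n]∣m s b)) (ℕG.gcd[m,n]∣n s b))
    (ℕG.gcd-greatest (ℕD.∣-trans (ℕG.gcd[m,n]∣m (ℕG.gcd ℤ.∣ r ∣ s) b) (ℕG.gcd[m,n]∣n ℤ.∣ r ∣ s)) (ℕG.gcd[m,n]∣n (ℕG.gcd ℤ.∣ r ∣ s) b))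
    where
    g∣r : g ∣ℕ ℤ.∣ r ∣
    g∣r = ℤS.∣⇒∣ᵤ {+ g} {r} (ℤS.∣m+n∣n⇒∣m {+ g} {r} {+ s ℤ.* + k} (ℤS.∣ᵤ⇒∣ {+ g} {term r (+ s) k} (ℕD.∣-trans g∣m m∣))
      (ℤS.∣m⇒∣m*n {+ g} {+ s} (+ k) (ℤS.∣ᵤ⇒∣ {+ g} {+ s} (ℕG.gcd[m,n]∣m s b))))

positive-entries : ∀ {r s′ b d′ B} h a → suc s′ ∣ℕ suc d′ → ℤ.∣ r ∣ ℕ.* suc d′ ≤ B → B < b ℕ.+ h ℕ.* suc d′ →
  (∀ (k : ℕ) → r ≢ ℤ.- (+ k ℤ.* + suc s′)) → Entries r (+ suc s′) b d′ (b ℕ.+ h ℕ.* suc d′) a B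
positive-entries {r} {s′} {b} {d′} {B} h a s∣d@(divides w d≡) rd≤B B<m r≢ = decide (ℕG.gcd (suc s′) b ℕ.≟ cOf r (+ suc s′) b)
  where
  go : ℕG.gcd (suc s′) b ≡ cOf r (+ suc s′) b → ∀ c → cOf r (+ suc s′) b ≡ c → c ∣ℕ suc s′ → + c ℤS.∣ r → c ∣ℕ b →
    (∃ λ G → + b ℤ.* + eOf r (+ suc s′) b ≡ + cOf r (+ suc s′) b ℤ.+ G ℤ.* + suc s′) → Entries r (+ suc s′) b d′ (b ℕ.+ h ℕ.* suc d′) a B
  go g≡c zero    c≡ (divides s₁ s≡) _ _ _ = contradiction (≡.trans s≡ (ℕP.*-zeroʳ s₁)) λ ()
  go g≡c (suc c′) c≡ (divides (suc s₁′) s≡) (ℤS.divides r₁ r≡) (divides b₁ b≡) (G , be≡) =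
    finish (reduced-solution {G = G} (h ℕ.* w) (≡.trans be≡ (≡.cong (λ c → + c ℤ.+ G ℤ.* + suc s′) c≡)) s≡ r≡ b≡
      (≡.subst (ℤ.∣ r ∣ <_) m≡ (ℕP.≤-<-trans (ℕP.≤-trans (ℕP.m≤m*n ℤ.∣ r ∣ (suc d′)) rd≤B) B<m)) r≢)
    where
    m≡ : b ℕ.+ h ℕ.* suc d′ ≡ (b₁ ℕ.+ h ℕ.* w ℕ.* suc s₁′) ℕ.* suc c′
    m≡ = ≡.trans (≡.cong₂ (λ x y → x ℕ.+ h ℕ.* y) b≡ (≡.trans d≡ (≡.cong (w ℕ.*_) s≡))) (lem b₁ (suc c′) h (suc s₁′) w)
      where
      lem : ∀ b c h s w → b ℕ.* c ℕ.+ h ℕ.* (w ℕ.* (s ℕ.* c)) ≡ (b ℕ.+ h ℕ.* w ℕ.* s) ℕ.* c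
      lem = ℕR.solve-∀
    finish : FirstSolution r₁ (suc s₁′) (b₁ ℕ.+ h ℕ.* w ℕ.* suc s₁′) (eOf r (+ suc s′) b) ×
      (∃ λ G′ → + (b₁ ℕ.+ h ℕ.* w ℕ.* suc s₁′) ℤ.* + eOf r (+ suc s′) b ≡ 1ℤ ℤ.+ G′ ℤ.* + suc s₁′) →
      Entries r (+ suc s′) b d′ (b ℕ.+ h ℕ.* suc d′) a B
    finish (first , G′ , me≡) = solution-entries {G = G′} g≡c c≡ first me≡ s≡ r≡ m≡ (≡.trans d≡ (ℕP.*-comm w (suc s′))) rd≤B
  decide : Dec (ℕG.gcd (suc s′) b ≡ cOf r (+ suc s′) b) → Entries r (+ suc s′) b d′ (b ℕ.+ h ℕ.* suc d′) a B
  decide (no g≢c)  = no-entries {r} {s′} {b} {h} g≢c s∣d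
  decide (yes g≡c) = go g≡c (cOf r (+ suc s′) b) ≡.refl
    (ℕD.∣-trans (ℕG.gcd[m,n]∣m (ℕG.gcd ℤ.∣ r ∣ (suc s′)) b) (ℕG.gcd[m,n]∣n ℤ.∣ r ∣ (suc s′)))
    (ℤS.∣ᵤ⇒∣ {+ cOf r (+ suc s′) b} {r} (ℕD.∣-trans (ℕG.gcd[m,n]∣m (ℕG.gcd ℤ.∣ r ∣ (suc s′)) b) (ℕG.gcd[m,n]∣m ℤ.∣ r ∣ (suc s′))))
    (ℕG.gcd[m,n]∣n (ℕG.gcd ℤ.∣ r ∣ (suc s′)) b) (eOf-spec r s′ b g≡c)

term-neg : ∀ r s k → ℤ.∣ term (ℤ.- r) (ℤ.- s) k ∣ ≡ ℤ.∣ term r s k ∣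
term-neg r s k = ≡.trans (≡.cong ℤ.∣_∣ (lem r s (+ k))) (ℤP.∣-i∣≡∣i∣ (term r s k))
  where
  lem : ∀ r s k → ℤ.- r ℤ.+ (ℤ.- s) ℤ.* k ≡ ℤ.- (r ℤ.+ s ℤ.* k)
  lem = solve-∀

hits-neg : ∀ r s m n → hits (ℤ.- r) (ℤ.- s) m n ≡ hits r s m n
hits-neg r s m n = countBelow-cong n (λ k _ → ≡.cong (λ i → does (m ∣? i)) (term-neg r s k))

pointCount-neg : ∀ r s′ b a x → pointCount (ℤ.- r) (+ suc s′) b a x ≡ pointCount r -[1+ s′ ] b a x
pointCount-neg (+ zero)  s′ b a x = ≡.refl
pointCount-neg (+ suc _) s′ b a x = ≡.refl
pointCount-neg -[1+ _ ]  s′ b a x = ≡.refl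

-- A negative s is treated through the pair (- r, - s), which has the same α and, up to sign, the
-- same exponents.
entries-of : ∀ {r s b d′ B} h a → s ≢ 0ℤ → ℤ.∣ s ∣ ∣ℕ suc d′ → ℤ.∣ r ∣ ℕ.* suc d′ ≤ B → B < b ℕ.+ h ℕ.* suc d′ →
  (∀ (k : ℕ) → r ≢ ℤ.- (+ k ℤ.* s)) → Entries r s b d′ (b ℕ.+ h ℕ.* suc d′) a B
entries-of {s = + zero}  h a s≢0 s∣d rd≤B B<m r≢ = contradiction ≡.refl s≢0
entries-of {s = + suc _} h a s≢0 s∣d rd≤B B<m r≢ = positive-entries h a s∣d rd≤B B<m r≢
entries-of {r} { -[1+ s′ ]} {b} {d′} {B} h a s≢0 s∣d rd≤B B<m r≢ = transfer
  (positive-entries {ℤ.- r} h a s∣d (≡.subst (λ i → i ℕ.* suc d′ ≤ B) (≡.sym (ℤP.∣-i∣≡∣i∣ r)) rd≤B) B<m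
    λ k -r≡ → r≢ k (ℤP.neg-injective (≡.trans -r≡ (≡.cong ℤ.-_ (≡.sym (lem (+ k) (+ suc s′)))))))
  where
  lem : ∀ k s → ℤ.- (k ℤ.* (ℤ.- s)) ≡ k ℤ.* s
  lem = solve-∀
  transfer : Entries (ℤ.- r) (+ suc s′) b d′ (b ℕ.+ h ℕ.* suc d′) a B → Entries r -[1+ s′ ] b d′ (b ℕ.+ h ℕ.* suc d′) a B
  transfer (l , loc , hits≡ , points≡) = l , loc ,
    (λ n → ≡.trans (hits≡ n) (hits-neg r -[1+ s′ ] (b ℕ.+ h ℕ.* suc d′) (n ℕ.⊓ (b ℕ.+ h ℕ.* suc d′)))) ,
    (λ x → ≡.trans (points≡ x) (pointCount-neg r s′ b a x))

-- Summation over all symbols and reduction to one period.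

sumFin-cong : ∀ v {f g : Fin v → ℕ} → (∀ i → f i ≡ g i) → sumFin v f ≡ sumFin v g
sumFin-cong zero    f≡g = ≡.refl
sumFin-cong (suc v) f≡g = ≡.cong₂ ℕ._+_ (f≡g Fin.zero) (sumFin-cong v (λ i → f≡g (Fin.suc i)))

sumFin-+ : ∀ v (f g : Fin v → ℕ) → sumFin v (λ i → f i ℕ.+ g i) ≡ sumFin v f ℕ.+ sumFin v g
sumFin-+ zero    f g = ≡.refl
sumFin-+ (suc v) f g = ≡.trans (≡.cong (f Fin.zero ℕ.+ g Fin.zero ℕ.+_) (sumFin-+ v _ _)) (lem (f Fin.zero) (g Fin.zero) _ _)
  where
  lem : ∀ a b c d → a ℕ.+ b ℕ.+ (c ℕ.+ d) ≡ a ℕ.+ c ℕ.+ (b ℕ.+ d)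
  lem = ℕR.solve-∀

totalHits-+-period : ∀ v r s m n → totalHits v r s m (m ℕ.+ n) ≡ totalHits v r s m m ℕ.+ totalHits v r s m n
totalHits-+-period v r s m n = ≡.trans (sumFin-cong v (λ i → hits-+-period (r i) (s i) m n)) (sumFin-+ v _ _)

SideEntries : (v : ℕ) → (r s : Fin v → ℤ) → (b d′ m a B : ℕ) → Set
SideEntries v r s b d′ m a B = ∃ λ entries → All (Located d′ m a B) entries ×
  (∀ n → count (λ e → does (proj₁ e ℕ.<? n)) entries ≡ totalHits v r s m (n ℕ.⊓ m)) ×
  (∀ x → count (λ e → does (proj₂ e ≼? x)) entries ≡ sideCount v r s b a x)

sideEntries : ∀ v r s {b d′ m a B} → (∀ i → Entries (r i) (s i) b d′ m a B) → SideEntries v r s b d′ m a B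
sideEntries v r s {m = m} E = collect v (λ i → proj₁ (E i)) ,
  All-collect v (λ i → proj₁ (proj₂ (E i))) ,
  (λ n → ≡.trans (count-collect _ v _) (sumFin-cong v (λ i → proj₁ (proj₂ (proj₂ (E i))) n))) ,
  (λ x → ≡.trans (count-collect _ v _) (sumFin-cong v (λ i → proj₂ (proj₂ (proj₂ (E i))) x)))

∣lcmFin : ∀ v (s : Fin v → ℤ) i → ℤ.∣ s i ∣ ∣ℕ lcmFin v s
∣lcmFin (suc v) s Fin.zero    = ℕL.m∣lcm[m,n] _ _
∣lcmFin (suc v) s (Fin.suc i) = ℕD.∣-trans (∣lcmFin v (λ i → s (Fin.suc i)) i) (ℕL.n∣lcm[m,n] ℤ.∣ s Fin.zero ∣ _)

lcm≢0 : ∀ {m n} → m ≢ 0 → n ≢ 0 → ℕL.lcm m n ≢ 0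
lcm≢0 {m} {n} m≢0 n≢0 eq with ℕP.m*n≡0⇒m≡0∨n≡0 m (≡.trans (≡.sym (ℕL.gcd*lcm m n)) (≡.trans (≡.cong (ℕG.gcd m n ℕ.*_) eq) (ℕP.*-zeroʳ (ℕG.gcd m n))))
... | inj₁ m≡0 = m≢0 m≡0
... | inj₂ n≡0 = n≢0 n≡0

lcmFin≢0 : ∀ v (s : Fin v → ℤ) → (∀ i → s i ≢ 0ℤ) → lcmFin v s ≢ 0
lcmFin≢0 zero    s s≢0 = λ ()
lcmFin≢0 (suc v) s s≢0 = lcm≢0 (s≢0 Fin.zero ∘ ℤP.∣i∣≡0⇒i≡0) (lcmFin≢0 v _ (s≢0 ∘ Fin.suc))

module _ (v w : ℕ) (r s : Fin v → ℤ) (t u : Fin w → ℤ) {b d′ m a B : ℕ} (1≤a : 1 ≤ a) (2B<m : B ℕ.+ B < m)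
  (N : SideEntries v r s b d′ m a B) (D : SideEntries w t u b d′ m a B) where

  -- Every solution in the list lies below m, so n ≤ m suffices and a failure of the hypothesis can
  -- be found by a finite search.
  hits≤⇒sideCount≤ : (∀ n → n ≤ m → totalHits w t u m n ≤ totalHits v r s m n) → ∀ x → sideCount w t u b a x ≤ sideCount v r s b a x
  hits≤⇒sideCount≤ h x = ≡.subst₂ _≤_ (proj₂ (proj₂ (proj₂ D)) x) (proj₂ (proj₂ (proj₂ N)) x)
    (countK≥⇒countX≥ 1≤a 2B<m (proj₁ (proj₂ N)) (proj₁ (proj₂ D))
      (λ n → ≡.subst₂ _≤_ (≡.sym (proj₁ (proj₂ (proj₂ D)) n)) (≡.sym (proj₁ (proj₂ (proj₂ N)) n)) (h (n ℕ.⊓ m) (ℕP.m⊓n≤n n m))) x)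

  -- The points control the first period. Beyond it, a full period splits off additively on both
  -- sides, and strong induction applies to n - m.
  sideCount≤⇒hits≤ : (∀ x → sideCount w t u b a x ≤ sideCount v r s b a x) → ∀ n → totalHits w t u m n ≤ totalHits v r s m n
  sideCount≤⇒hits≤ h = <-rec _ λ n rec → step n rec (ℕP.≤-total n m)
    where
    initial : ∀ n → totalHits w t u m (n ℕ.⊓ m) ≤ totalHits v r s m (n ℕ.⊓ m)
    initial n = ≡.subst₂ _≤_ (proj₁ (proj₂ (proj₂ D)) n) (proj₁ (proj₂ (proj₂ N)) n)
      (countX≥⇒countK≥ 1≤a 2B<m (proj₁ (proj₂ N)) (proj₁ (proj₂ D))
        (λ x → ≡.subst₂ _≤_ (≡.sym (proj₂ (proj₂ (proj₂ D)) x)) (≡.sym (proj₂ (proj₂ (proj₂ N)) x)) (h x)) n)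
    base : ∀ n → n ≤ m → totalHits w t u m n ≤ totalHits v r s m n
    base n n≤m = ≡.subst (λ k → totalHits w t u m k ≤ totalHits v r s m k) (ℕP.m≤n⇒m⊓n≡m n≤m) (initial n)
    step : ∀ n → (∀ {j} → j < n → totalHits w t u m j ≤ totalHits v r s m j) → n ≤ m ⊎ m ≤ n → totalHits w t u m n ≤ totalHits v r s m n
    step n rec (inj₁ n≤m) = base n n≤m
    step n rec (inj₂ m≤n) = ≡.subst (λ k → totalHits w t u m k ≤ totalHits v r s m k) (ℕP.m+[n∸m]≡n m≤n)
      (≡.subst₂ _≤_ (≡.sym (totalHits-+-period w t u m (n ℕ.∸ m))) (≡.sym (totalHits-+-period v r s m (n ℕ.∸ m)))
        (ℕP.+-mono-≤ (base m ℕP.≤-refl) (rec (ℕP.∸-monoʳ-< {o = 0} (ℕP.≤-<-trans z≤n 2B<m) m≤n))))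

-- Large moduli in the residue classes modulo d.

≤-bounded : ∀ v (f : Fin v → ℕ) → ∃ λ M → ∀ i → f i ≤ M
≤-bounded v f = boundFin v (λ i M≤M′ fi≤M → ℕP.≤-trans fi≤M M≤M′) (λ i → f i , ℕP.≤-refl)

theorem1p3 : (v w : ℕ) → 1 ≤ v → 1 ≤ w →
    (r s : Fin v → ℤ) → (t u : Fin w → ℤ) →
    (∀ i → 0ℤ ℤ.< s i) → (∀ j → u j ≢ 0ℤ) →
    (∀ i (k : ℕ) → r i ≢ ℤ.- (+ k ℤ.* s i)) →
    (∀ j (k : ℕ) → t j ≢ ℤ.- (+ k ℤ.* u j)) →
    QIntegral (QNum v r s) (QNum w t u) ⇔ XiCondition v w r s t u
theorem1p3 v w _ _ r s t u 0<s u≢0 r≢ t≢ = mk⇔ necessary sufficient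
  where
  s≢0 : ∀ i → s i ≢ 0ℤ
  s≢0 i s≡0 = ℤP.<-irrefl (≡.sym s≡0) (0<s i)
  d d′ : ℕ
  d = dRT v w s u
  d′ = ℕ.pred d
  d≡ : suc d′ ≡ d
  d≡ = ℕP.suc-pred d {{ℕ.≢-nonZero (lcm≢0 (lcmFin≢0 v s s≢0) (lcmFin≢0 w u u≢0))}}
  s∣d : ∀ i → ℤ.∣ s i ∣ ∣ℕ suc d′
  s∣d i = ≡.subst (ℤ.∣ s i ∣ ∣ℕ_) (≡.sym d≡) (ℕD.∣-trans (∣lcmFin v s i) (ℕL.m∣lcm[m,n] (lcmFin v s) (lcmFin w u)))
  u∣d : ∀ j → ℤ.∣ u j ∣ ∣ℕ suc d′
  u∣d j = ≡.subst (ℤ.∣ u j ∣ ∣ℕ_) (≡.sym d≡) (ℕD.∣-trans (∣lcmFin w u j) (ℕL.n∣lcm[m,n] (lcmFin v s) (lcmFin w u)))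
  bound-r : ∃ λ M → ∀ i → ℤ.∣ r i ∣ ℕ.* suc d′ ≤ M
  bound-r = ≤-bounded v _
  bound-t : ∃ λ M → ∀ j → ℤ.∣ t j ∣ ℕ.* suc d′ ≤ M
  bound-t = ≤-bounded w _
  -- Over the denominator d the numerators of all α's and β's are at most |r| d or |t| d in absolute
  -- value, so this one bound serves both sides.
  B : ℕ
  B = proj₁ bound-r ℕ.⊔ proj₁ bound-t
  numerator-entries : ∀ b h a → B < b ℕ.+ h ℕ.* suc d′ → SideEntries v r s b d′ (b ℕ.+ h ℕ.* suc d′) a B
  numerator-entries b h a B<m = sideEntries v r s (λ i → entries-of h a (s≢0 i) (s∣d i)
    (ℕP.≤-trans (proj₂ bound-r i) (ℕP.m≤m⊔n _ _)) B<m (r≢ i))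
  denominator-entries : ∀ b h a → B < b ℕ.+ h ℕ.* suc d′ → SideEntries w t u b d′ (b ℕ.+ h ℕ.* suc d′) a B
  denominator-entries b h a B<m = sideEntries w t u (λ j → entries-of h a (u≢0 j) (u∣d j)
    (ℕP.≤-trans (proj₂ bound-t j) (ℕP.m≤n⊔m (proj₁ bound-r) _)) B<m (t≢ j))
  1≤aOf : ∀ b → 1 ≤ aOf d b
  1≤aOf b = SearchResult.positive (firstUpTo-result d (λ a → modEqᵇ (a ℕ.* bTilde d b) 1 d))
  term≢0 : ∀ {r s} → (∀ (k : ℕ) → r ≢ ℤ.- (+ k ℤ.* s)) → ∀ k → term r s k ≢ 0ℤ
  term≢0 {r} {s} r≢ k eq = r≢ k (≡.trans (lem r s (+ k)) (≡.trans (≡.cong (ℤ._- + k ℤ.* s) eq) (ℤP.+-identityˡ _)))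
    where
    lem : ∀ r s k → r ≡ r ℤ.+ s ℤ.* k ℤ.- k ℤ.* s
    lem = solve-∀

  necessary : QIntegral (QNum v r s) (QNum w t u) → XiCondition v w r s t u
  necessary integral@(C , C≢0 , _) b 1≤b _ x = ℤP.i≤j⇒0≤j-i (ℤ.+≤+ (ℕP.≮⇒≥ λ lt →
    C≢0 (≋⇒IsZero C (infinitelyManyΦ∣⇒≋0 C m 1≤m m-injective (λ k → divides-C lt k (deficit? k))))))
    where
    a = aOf d b
    -- The summand B + B pushes every modulus beyond 2B, and k makes the moduli pairwise distinct;
    -- all of them lie in the class of b modulo d.
    h m : ℕ → ℕ
    h k = B ℕ.+ B ℕ.+ k
    m k = b ℕ.+ h k ℕ.* suc d′
    1≤m : ∀ k → 1 ≤ m k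
    1≤m k = ℕP.≤-trans 1≤b (ℕP.m≤m+n b _)
    m-injective : ∀ j k → j < k → m j ≢ m k
    m-injective j k j<k = ℕP.<⇒≢ (ℕP.+-monoʳ-< b (ℕP.*-monoˡ-< (suc d′) (ℕP.+-monoʳ-< (B ℕ.+ B) j<k)))
    2B<m : ∀ k → B ℕ.+ B < m k
    2B<m k = ℕP.+-mono-≤ 1≤b (ℕP.≤-trans (ℕP.m≤m+n (B ℕ.+ B) k) (ℕP.m≤m*n (h k) (suc d′)))
    B<m : ∀ k → B < m k
    B<m k = ℕP.≤-<-trans (ℕP.m≤m+n B B) (2B<m k)
    -- The range n ≤ m k is decidable, so an explicit n with a deficit is obtained or else the
    -- inequality holds on the whole first period.
    deficit? : ∀ k → Dec (∃ λ n → n < suc (m k) × totalHits v r s (m k) n < totalHits w t u (m k) n)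
    deficit? k = ℕP.anyUpTo? (λ n → totalHits v r s (m k) n ℕ.<? totalHits w t u (m k) n) (suc (m k))
    divides-C : sideCount v r s b a x < sideCount w t u b a x → ∀ k →
      Dec (∃ λ n → n < suc (m k) × totalHits v r s (m k) n < totalHits w t u (m k) n) → Φ (m k) ∣ₚ C
    divides-C lt k (yes (n , _ , deficit)) =
      qIntegral⇒Φ∣ v w r s t u (term≢0 ∘ r≢) (term≢0 ∘ t≢) integral (m k) n (1≤m k) deficit
    divides-C lt k (no surplus) = contradiction
      (hits≤⇒sideCount≤ v w r s t u (1≤aOf b) (2B<m k) (numerator-entries b (h k) a (B<m k)) (denominator-entries b (h k) a (B<m k))
        (λ n n≤m → ℕP.≮⇒≥ λ deficit → surplus (n , s≤s n≤m , deficit)) x)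
      (ℕP.<⇒≱ lt)

  sufficient : XiCondition v w r s t u → QIntegral (QNum v r s) (QNum w t u)
  sufficient ξ = hits≤⇒qIntegral v w r s t u (term≢0 ∘ r≢) (term≢0 ∘ t≢) (ℤP.<⇒≤ ∘ 0<s) (B ℕ.+ B) surplus
    where
    surplus : ∀ m n → B ℕ.+ B < m → totalHits w t u m n ≤ totalHits v r s m n
    surplus (suc m′) n 2B<m = ≡.subst (λ m → totalHits w t u m n ≤ totalHits v r s m n) (≡.sym m≡)
      (sideCount≤⇒hits≤ v w r s t u (1≤aOf b) 2B<bh (numerator-entries b h a B<bh) (denominator-entries b h a B<bh)
        (λ x → ℤP.drop‿+≤+ (ℤP.0≤i-j⇒j≤i (ξ b (s≤s z≤n) b≤d x))) n)
      where
      -- Reducing m - 1 instead of m gives the representative in 1, ..., d, so that multiples of d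
      -- belong to b = d.
      b = suc (m′ % suc d′)
      h = m′ ℕM./ suc d′
      a = aOf d b
      m≡ : suc m′ ≡ b ℕ.+ h ℕ.* suc d′
      m≡ = ≡.cong suc (ℕM.m≡m%n+[m/n]*n m′ (suc d′))
      2B<bh : B ℕ.+ B < b ℕ.+ h ℕ.* suc d′
      2B<bh = ≡.subst (B ℕ.+ B <_) m≡ 2B<m
      B<bh : B < b ℕ.+ h ℕ.* suc d′
      B<bh = ℕP.≤-<-trans (ℕP.m≤m+n B B) 2B<bh
      b≤d : b ≤ d
      b≤d = ≡.subst (b ≤_) d≡ (ℕM.m%n<n m′ (suc d′))
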